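{- There exists an absolute constant $C>0$ such that the following holds. Let $G$ be a graph on vertex set $[n]$, let $d$ be a positive integer, and let $\tilde{\mathbb{E}}$ be a degree $d$ independent set pseudo-expectation for $G$. Suppose that $\tilde{\mathbb{E}}$ satisfies the following two properties: (1) there is a positive integer $k_0$ such that $\tilde{\mathbb{E}}[x_i]\ge \frac{1}{k_0}$ for every $i\in[n]$; (2) there is a real number $\lambda>0$ such that for all multilinear polynomials $f$ with $\deg(f)\le d/2$, $\tilde{\mathbb{E}}[f^2]\ge \lambda\,\|\Pi_G f\|_2^2$. Then there is a degree $d' := 1+d/2$ coloring pseudo-expectation $\tilde{\mathbb{E}}'$ for $G$ using $k$ colors, for some positive integer $k\le C\,k_0\,d\,\log(n^d/\lambda)$.
   Context: $E(G)$ is the edge set of $G$. Degree bounds such as $d/2$ are real numbers (so "$\deg(f)\le d/2$" makes sense also for odd $d$). A degree $d$ independent set pseudo-expectation for $G$ is a linear operator $\tilde{\mathbb{E}}$ mapping real polynomials of degree $\le d$ in variables $\{x_i\}_{i\in[n]}$ to $\mathbb{R}$ such that: $\tilde{\mathbb{E}}[1]=1$; $\tilde{\mathbb{E}}[f^2]\ge0$ for every polynomial $f$ of degree at most $d/2$; and for every polynomial $f$ of degree at most $d-2$, $\tilde{\mathbb{E}}[f\cdot(x_i^2-x_i)]=0$ for all $i\in[n]$ and $\tilde{\mathbb{E}}[f\cdot x_ix_j]=0$ for all $\{i,j\}\in E(G)$. Polynomials in $\{x_i\}_{i\in[n]}$ of degree $\le d$ are identified with their coefficient vectors (in the monomial basis),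 with the Euclidean inner product; $\|f\|_2$ is the $\ell_2$ norm of the coefficient vector of $f$. $\Pi_G$ is the orthogonal projection onto the linear subspace orthogonal to $\{g\,x_ix_j : \{i,j\}\in E(G),\ \deg(g)\le d-2\}$. For a degree bound $D$, a degree $D$ coloring pseudo-expectation for $G$ using $k$ colors is a linear operator $\tilde{\mathbb{E}}'$ mapping real polynomials of degree $\le D$ in variables $\{x_{i,c}\}_{i\in[n],c\in[k]}$ to $\mathbb{R}$ such that: $\tilde{\mathbb{E}}'[1]=1$; $\tilde{\mathbb{E}}'[f^2]\ge0$ for every polynomial $f$ of degree at most $D/2$; $\tilde{\mathbb{E}}'[f\cdot(x_{i,c}^2-x_{i,c})]=0$ for every $f$ of degree at most $D-2$ and all $i,c$; $\tilde{\mathbb{E}}'[f\cdot x_{i,c}x_{j,c}]=0$ for every $f$ of degree at most $D-2$, every $\{i,j\}\in E(G)$ and every $c\in[k]$; and $\tilde{\mathbb{E}}'[f^2\cdot(\sum_{c\in[k]}x_{i,c}-1)]\ge0$ for every $f$ of degree at most $\frac{D-1}{2}$ and every $i\in[n]$.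
   Formalization: The formal theorem assumes nd ≥ 2: it excludes n = 0, where log(n^d/λ) is undefined, and n = d = 1, where λ = 1 is possible and the bound would force a positive integer k ≤ 0. -}

module Defs where

open import Level using (suc; _⊔_; 0ℓ)
open import Algebra.Apartness.Bundles using (HeytingField; HeytingCommutativeRing)
open import Algebra.Bundles using (CommutativeRing; Semiring)
import Algebra.Definitions.RawMonoid as RawMonoidDefinitions
import Algebra.Definitions.RawSemiring as RawSemiringDefinitions
import Algebra.Properties.Ring as RingProperties
open import Algebra.Module.Bundles.Raw using (RawLeftModule)
open import Algebra.Module.Morphism.Structures
  using (module LeftModuleMorphisms)
open import Data.Bool.Base using (if_then_else_)
open import Data.Empty using (⊥-elim)
open import Data.Fin.Base using (Fin; combine)
open import Data.Integer.Base as ℤ using (+_)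
import Data.Integer.Properties as ℤ
open import Data.List.Base as List using (List; []; _∷_)
open import Data.List.Membership.Propositional using (_∈_)
open import Data.List.Membership.Propositional.Properties
  using (∈-cartesianProductWith⁻; ∈-upTo⁻)
open import Data.List.Relation.Unary.Any using (here; there)
open import Data.Nat.Base as ℕ using (ℕ; zero; _∸_; s≤s)
import Data.Nat.Properties as ℕ
open import Data.Product.Base using (_×_; _,_; ∃-syntax; proj₁; proj₂)
open import Data.Rational.Unnormalised.Base as ℚ
  using (ℚᵘ; _/_; 0ℚᵘ; 1ℚᵘ; ½; *≤*; *≡*)
import Data.Rational.Unnormalised.Properties as ℚ
open import Data.Sum.Base using (_⊎_; [_,_]′)
open import Data.Vec.Base as Vec using (Vec; []; _∷_; lookup)
import Data.Vec.Properties as Vec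
open import Relation.Binary.Core using (Rel)
open import Relation.Binary.Definitions using (Decidable; Symmetric; Irreflexive)
open import Relation.Binary.PropositionalEquality as ≡ using (_≡_)
open import Relation.Binary.Structures using (IsStrictPartialOrder)
open import Relation.Nullary using (¬_; Dec; yes; no; does)

-- ℝ is axiomatised as a Cauchy-complete Archimedean ordered field.
-- Classically these axioms determine ℝ up to isomorphism; the order is not
-- assumed to be decidable, so constructive models are covered as well.

record RealField c ℓ₁ ℓ₂ : Set (suc (c ⊔ ℓ₁ ⊔ ℓ₂)) where
  field
    heytingField : HeytingField c ℓ₁ ℓ₂

  open HeytingField heytingField public

  commutativeRing : CommutativeRing c ℓ₁
  commutativeRing = HeytingCommutativeRing.commutativeRing heytingCommutativeRing

  open RawSemiringDefinitions (Semiring.rawSemiring (CommutativeRing.semiring commutativeRing)) public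
    using (_^_)
    renaming (_×_ to _×ℕ_)

  infix 4 _<_ _≤_
  infix 4 _⟶_

  field
    _<_                    : Rel Carrier ℓ₂
    <-isStrictPartialOrder : IsStrictPartialOrder _≈_ _<_
    #⇒<⊎>                  : ∀ {x y} → x # y → x < y ⊎ y < x
    <⇒#                    : ∀ {x y} → x < y → x # y
    +-monoˡ-<              : ∀ z {x y} → x < y → x + z < y + z
    *-pos                  : ∀ {x y} → 0# < x → 0# < y → 0# < x * y

  _≤_ : Rel Carrier ℓ₂
  x ≤ y = ¬ (y < x)

  fromℕ : ℕ → Carrier
  fromℕ n = n ×ℕ 1#

  IsWithin : Carrier → Carrier → Carrier → Set ℓ₂
  IsWithin ε x y = x < y + ε × y < x + ε

  _⟶_ : (ℕ → Carrier) → Carrier → Set (c ⊔ ℓ₂)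
  s ⟶ l = ∀ {ε} → 0# < ε → ∃[ N ] ∀ n → N ℕ.≤ n → IsWithin ε (s n) l

  IsCauchy : (ℕ → Carrier) → Set (c ⊔ ℓ₂)
  IsCauchy s = ∀ {ε} → 0# < ε →
    ∃[ N ] ∀ m n → N ℕ.≤ m → N ℕ.≤ n → IsWithin ε (s m) (s n)

  field
    archimedean : ∀ x → ∃[ n ] x < fromℕ n
    complete    : ∀ s → IsCauchy s → ∃[ l ] s ⟶ l

  open IsStrictPartialOrder <-isStrictPartialOrder public
    using (<-respˡ-≈; <-respʳ-≈)
    renaming (trans to <-trans; irrefl to <-irrefl; asym to <-asym)

  recip : ∀ x → x # 0# → Carrier
  recip x x#0 = proj₁ (#⇒invertible x#0)

  private
    module R = CommutativeRing commutativeRing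
    open RingProperties R.ring using (-0#≈0#; -‿involutive; -‿distribˡ-*; -‿distribʳ-*)

  x-0≈x : ∀ x → x - 0# ≈ x
  x-0≈x x = R.trans (R.+-congˡ -0#≈0#) (R.+-identityʳ x)

  recip-inverseʳ : ∀ x (x#0 : x # 0#) → x * recip x x#0 ≈ 1#
  recip-inverseʳ x x#0 =
    R.trans (R.*-congʳ (R.sym (x-0≈x x))) (proj₂ (proj₂ (#⇒invertible x#0)))

  0<1 : 0# < 1#
  0<1 = [ (λ 1<0 → ⊥-elim (<-asym 1<0 (absurd 1<0))) , (λ p → p) ]′ (#⇒<⊎> 1#0)
    where
    1#0 : 1# # 0#
    1#0 = invertible⇒# (1# , R.trans (R.*-identityˡ _) (x-0≈x 1#)
                           , R.trans (R.*-identityʳ _) (x-0≈x 1#))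
    absurd : 1# < 0# → 0# < 1#
    absurd 1<0 = <-respʳ-≈ [-1][-1]≈1 (*-pos 0<-1 0<-1)
      where
      0<-1 : 0# < - 1#
      0<-1 = <-respˡ-≈ (R.-‿inverseʳ 1#) (<-respʳ-≈ (R.+-identityˡ _) (+-monoˡ-< (- 1#) 1<0))
      [-1][-1]≈1 : - 1# * - 1# ≈ 1#
      [-1][-1]≈1 =
        R.trans (R.sym (-‿distribˡ-* 1# (- 1#)))
          (R.trans (R.-‿cong (R.*-identityˡ _)) (-‿involutive 1#))

  0<fromℕ : ∀ n .{{_ : ℕ.NonZero n}} → 0# < fromℕ n
  0<fromℕ (ℕ.suc zero)      = <-respʳ-≈ (R.sym (R.+-identityʳ 1#)) 0<1
  0<fromℕ (ℕ.suc (ℕ.suc n)) =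
    <-trans (0<fromℕ (ℕ.suc n))
      (<-respˡ-≈ (R.+-identityˡ _) (+-monoˡ-< (fromℕ (ℕ.suc n)) 0<1))

  infixl 7 _/ᴿ_⟨_⟩
  _/ᴿ_⟨_⟩ : ∀ x y → 0# < y → Carrier
  x /ᴿ y ⟨ 0<y ⟩ = x * recip y (#-sym (<⇒# 0<y))

  1/ᴿ_ : ∀ n .{{_ : ℕ.NonZero n}} → Carrier
  1/ᴿ n = 1# /ᴿ fromℕ n ⟨ 0<fromℕ n ⟩

  -- y = log x, that is x = exp y = lim (1 + y/m)ᵐ.
  IsLog : Carrier → Carrier → Set (c ⊔ ℓ₂)
  IsLog x y = (λ m → (1# + y * (1/ᴿ ℕ.suc m)) ^ ℕ.suc m) ⟶ x

record Graph (n : ℕ) : Set₁ where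
  field
    Adj       : Rel (Fin n) 0ℓ
    adj?      : Decidable Adj
    symmetric : Symmetric Adj
    loopless  : Irreflexive _≡_ Adj

-- Degree bounds such as d/2 are not rounded: they live in ℚ, and may be
-- negative, in which case only the zero polynomial satisfies them.

toℚ : ℕ → ℚᵘ
toℚ d = + d / 1

infixl 7 _/2
_/2 : ℚᵘ → ℚᵘ
D /2 = D ℚ.* ½

toℚ-mono : ∀ {m n} → m ℕ.≤ n → toℚ m ℚ.≤ toℚ n
toℚ-mono m≤n = *≤* (ℤ.*-monoʳ-≤-nonNeg (+ 1) (ℤ.+≤+ m≤n))

toℚ-+ : ∀ m n → toℚ (m ℕ.+ n) ℚ.≃ toℚ m ℚ.+ toℚ n
toℚ-+ m n = *≡* (≡.cong (ℤ._* + 1)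
  (≡.sym (≡.cong₂ ℤ._+_ (ℤ.*-identityʳ (+ m)) (ℤ.*-identityʳ (+ n)))))

D/2+D/2≤D : ∀ D → D /2 ℚ.+ D /2 ℚ.≤ D
D/2+D/2≤D D = ℚ.≤-reflexive (ℚ.≃-trans (ℚ.≃-sym (ℚ.*-distribˡ-+ D ½ ½))
  (ℚ.≃-trans (ℚ.*-congˡ {D} {½ ℚ.+ ½} {1ℚᵘ} (*≡* ≡.refl)) (ℚ.*-identityʳ D)))

D-E+E≤D : ∀ D E → (D ℚ.- E) ℚ.+ E ℚ.≤ D
D-E+E≤D D E = ℚ.≤-reflexive (ℚ.≃-trans (ℚ.+-assoc D (ℚ.- E) E)
  (ℚ.≃-trans (ℚ.+-congʳ D (ℚ.+-inverseˡ E)) (ℚ.+-identityʳ D)))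

1≤toℚ : ∀ d .{{_ : ℕ.NonZero d}} → 1ℚᵘ ℚ.≤ toℚ d
1≤toℚ d = toℚ-mono (ℕ.>-nonZero⁻¹ d)

d/2≤d : ∀ d → toℚ d /2 ℚ.≤ toℚ d
d/2≤d d = ℚ.≤-trans
  (ℚ.≤-trans (ℚ.≤-reflexive (ℚ.≃-sym (ℚ.≃-trans
                (ℚ.+-congʳ (toℚ d /2) (*≡* {toℚ 0 /2} {0ℚᵘ} ≡.refl))
                (ℚ.+-identityʳ (toℚ d /2)))))
             (ℚ.+-monoʳ-≤ (toℚ d /2) (ℚ.*-monoˡ-≤-nonNeg ½ (toℚ-mono {0} {d} ℕ.z≤n))))
  (D/2+D/2≤D (toℚ d))

Monomial : ℕ → Set
Monomial N = Vec ℕ N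

degree : ∀ {N} → Monomial N → ℕ
degree = Vec.sum

_≟ᴹ_ : ∀ {N} (m m′ : Monomial N) → Dec (m ≡ m′)
_≟ᴹ_ = Vec.≡-dec ℕ._≟_

1ᴹ : ∀ {N} → Monomial N
1ᴹ {N} = Vec.replicate N 0

varᴹ : ∀ {N} → Fin N → Monomial N
varᴹ i = 1ᴹ Vec.[ i ]≔ 1

divisors : ∀ {N} → Monomial N → List (Monomial N)
divisors []      = [] ∷ []
divisors (e ∷ m) = List.cartesianProductWith _∷_ (List.upTo (ℕ.suc e)) (divisors m)

infixl 7 _÷ᴹ_
_÷ᴹ_ : ∀ {N} → Monomial N → Monomial N → Monomial N
_÷ᴹ_ = Vec.zipWith _∸_

-- All exponent vectors in N variables of total degree at most d, without repetition.
monomials : ∀ N → ℕ → List (Monomial N)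
monomials zero      d = [] ∷ []
monomials (ℕ.suc N) d =
  List.concatMap (λ e → List.map (e ∷_) (monomials N (d ∸ e))) (List.upTo (ℕ.suc d))

degree-1ᴹ : ∀ N → degree (1ᴹ {N}) ≡ 0
degree-1ᴹ zero      = ≡.refl
degree-1ᴹ (ℕ.suc N) = degree-1ᴹ N

degree-varᴹ : ∀ {N} (i : Fin N) → degree (varᴹ i) ≡ 1
degree-varᴹ {ℕ.suc N} Fin.zero    = ≡.cong ℕ.suc (degree-1ᴹ N)
degree-varᴹ           (Fin.suc i) = degree-varᴹ i

degree-÷ᴹ : ∀ {N} (m : Monomial N) {a} → a ∈ divisors m →
            degree a ℕ.+ degree (m ÷ᴹ a) ≡ degree m
degree-÷ᴹ []      (here ≡.refl) = ≡.refl
degree-÷ᴹ (e ∷ m) a∈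
  with j , a , j∈ , a∈′ , ≡.refl
         ← ∈-cartesianProductWith⁻ _∷_ (List.upTo (ℕ.suc e)) (divisors m) a∈
  = begin
    (j ℕ.+ degree a) ℕ.+ ((e ∸ j) ℕ.+ degree (m ÷ᴹ a))
      ≡⟨ ℕ.+-assoc j (degree a) _ ⟩
    j ℕ.+ (degree a ℕ.+ ((e ∸ j) ℕ.+ degree (m ÷ᴹ a)))
      ≡⟨ ≡.cong (j ℕ.+_) (ℕ.+-assoc (degree a) (e ∸ j) _) ⟨
    j ℕ.+ ((degree a ℕ.+ (e ∸ j)) ℕ.+ degree (m ÷ᴹ a))
      ≡⟨ ≡.cong (λ z → j ℕ.+ (z ℕ.+ degree (m ÷ᴹ a))) (ℕ.+-comm (degree a) (e ∸ j)) ⟩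
    j ℕ.+ (((e ∸ j) ℕ.+ degree a) ℕ.+ degree (m ÷ᴹ a))
      ≡⟨ ≡.cong (j ℕ.+_) (ℕ.+-assoc (e ∸ j) (degree a) _) ⟩
    j ℕ.+ ((e ∸ j) ℕ.+ (degree a ℕ.+ degree (m ÷ᴹ a)))
      ≡⟨ ℕ.+-assoc j (e ∸ j) _ ⟨
    (j ℕ.+ (e ∸ j)) ℕ.+ (degree a ℕ.+ degree (m ÷ᴹ a))
      ≡⟨ ≡.cong₂ ℕ._+_ (ℕ.m+[n∸m]≡n (ℕ.≤-pred (∈-upTo⁻ j∈))) (degree-÷ᴹ m a∈′) ⟩
    e ℕ.+ degree m ∎
  where open ≡.≡-Reasoning

module PseudoExpectations {c ℓ₁ ℓ₂} (ℛ : RealField c ℓ₁ ℓ₂) where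

  open RealField ℛ

  private
    module R = CommutativeRing commutativeRing
    open RingProperties R.ring using (-0#≈0#)

  ∑ : ∀ {a} {A : Set a} → List A → (A → Carrier) → Carrier
  ∑ xs f = List.foldr (λ x s → f x + s) 0# xs

  ∑-zero : ∀ {a} {A : Set a} (xs : List A) {f : A → Carrier} →
           (∀ {x} → x ∈ xs → f x ≈ 0#) → ∑ xs f ≈ 0#
  ∑-zero []       h = R.refl
  ∑-zero (x ∷ xs) h =
    R.trans (R.+-cong (h (here ≡.refl)) (∑-zero xs (λ x∈ → h (there x∈)))) (R.+-identityˡ 0#)

  -- Polynomials are coefficient functions; the degree bound makes their support finite.
  record Poly≤ (N : ℕ) (D : ℚᵘ) : Set (c ⊔ ℓ₁) where
    constructor poly
    field
      coeff   : Monomial N → Carrier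
      bounded : ∀ m → D ℚ.< toℚ (degree m) → coeff m ≈ 0#

  open Poly≤ public

  poly-rawLeftModule : ℕ → ℚᵘ → RawLeftModule Carrier (c ⊔ ℓ₁) ℓ₁
  poly-rawLeftModule N D = record
    { Carrierᴹ = Poly≤ N D
    ; _≈ᴹ_     = λ f g → ∀ m → coeff f m ≈ coeff g m
    ; _+ᴹ_     = λ f g → poly (λ m → coeff f m + coeff g m) λ m D<m →
        R.trans (R.+-cong (bounded f m D<m) (bounded g m D<m)) (R.+-identityˡ 0#)
    ; _*ₗ_     = λ r f → poly (λ m → r * coeff f m) λ m D<m →
        R.trans (R.*-congˡ (bounded f m D<m)) (R.zeroʳ r)
    ; 0ᴹ       = poly (λ _ → 0#) λ _ _ → R.refl
    ; -ᴹ_      = λ f → poly (λ m → - coeff f m) λ m D<m →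
        R.trans (R.-‿cong (bounded f m D<m)) -0#≈0#
    }

  real-rawLeftModule : RawLeftModule Carrier c ℓ₁
  real-rawLeftModule = record
    { Carrierᴹ = Carrier
    ; _≈ᴹ_     = _≈_
    ; _+ᴹ_     = _+_
    ; _*ₗ_     = _*_
    ; 0ᴹ       = 0#
    ; -ᴹ_      = -_
    }

  module _ {N : ℕ} {D : ℚᵘ} where
    open RawLeftModule (poly-rawLeftModule N D) public
      using (_≈ᴹ_; _+ᴹ_; _*ₗ_; 0ᴹ; -ᴹ_)

    infixl 6 _-ᴹ_
    _-ᴹ_ : Poly≤ N D → Poly≤ N D → Poly≤ N D
    f -ᴹ g = f +ᴹ (-ᴹ g)

    sumᴹ : ∀ {k} → (Fin k → Poly≤ N D) → Poly≤ N D
    sumᴹ = RawMonoidDefinitions.sum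
      (RawLeftModule.+ᴹ-rawMonoid (poly-rawLeftModule N D))

  IsLinear : ∀ {N D} → (Poly≤ N D → Carrier) → Set (c ⊔ ℓ₁)
  IsLinear {N} {D} = LeftModuleMorphisms.IsLeftModuleHomomorphism
    (poly-rawLeftModule N D) real-rawLeftModule

  weaken : ∀ {N D D′} → D ℚ.≤ D′ → Poly≤ N D → Poly≤ N D′
  weaken D≤D′ f = poly (coeff f) λ m D′<m → bounded f m (ℚ.≤-<-trans D≤D′ D′<m)

  monomial : ∀ {N} (m : Monomial N) → Poly≤ N (toℚ (degree m))
  monomial m = poly (λ m′ → if does (m′ ≟ᴹ m) then 1# else 0#) zero-above
    where
    zero-above : ∀ m′ → toℚ (degree m) ℚ.< toℚ (degree m′) →
                 (if does (m′ ≟ᴹ m) then 1# else 0#) ≈ 0#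
    zero-above m′ lt with m′ ≟ᴹ m
    ... | yes ≡.refl = ⊥-elim (ℚ.<-irrefl ℚ.≃-refl lt)
    ... | no  _      = R.refl

  1ₚ : ∀ {N} → Poly≤ N 0ℚᵘ
  1ₚ {N} = weaken (ℚ.≤-reflexive (ℚ.≃-reflexive (≡.cong toℚ (degree-1ᴹ N)))) (monomial 1ᴹ)

  x : ∀ {N} → Fin N → Poly≤ N 1ℚᵘ
  x i = weaken (ℚ.≤-reflexive (ℚ.≃-reflexive (≡.cong toℚ (degree-varᴹ i)))) (monomial (varᴹ i))

  infixl 7 _·_
  _·_ : ∀ {N D E} → Poly≤ N D → Poly≤ N E → Poly≤ N (D ℚ.+ E)
  _·_ {N} {D} {E} f g = poly
    (λ m → ∑ (divisors m) λ a → coeff f a * coeff g (m ÷ᴹ a))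
    (λ m D+E<m → ∑-zero (divisors m) (term≈0 m D+E<m))
    where
    term≈0 : ∀ m → D ℚ.+ E ℚ.< toℚ (degree m) → ∀ {a} → a ∈ divisors m →
             coeff f a * coeff g (m ÷ᴹ a) ≈ 0#
    term≈0 m D+E<m {a} a∈ with D ℚ.<? toℚ (degree a) | E ℚ.<? toℚ (degree (m ÷ᴹ a))
    ... | yes D<a | _       = R.trans (R.*-congʳ (bounded f a D<a)) (R.zeroˡ _)
    ... | no  _   | yes E<b = R.trans (R.*-congˡ (bounded g (m ÷ᴹ a) E<b)) (R.zeroʳ _)
    ... | no  D≮a | no  E≮b = ⊥-elim (ℚ.<-irrefl ℚ.≃-refl (ℚ.<-≤-trans D+E<m (ℚ.≤-trans
            (ℚ.≤-reflexive (ℚ.≃-trans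
              (ℚ.≃-reflexive (≡.cong toℚ (≡.sym (degree-÷ᴹ m a∈))))
              (toℚ-+ (degree a) (degree (m ÷ᴹ a)))))
            (ℚ.+-mono-≤ (ℚ.≮⇒≥ D≮a) (ℚ.≮⇒≥ E≮b)))))

  infix 9 _²
  _² : ∀ {N D} → Poly≤ N (D /2) → Poly≤ N D
  _² {D = D} f = weaken (D/2+D/2≤D D) (f · f)

  Multilinear : ∀ {N D} → Poly≤ N D → Set ℓ₁
  Multilinear f = ∀ m i → 2 ℕ.≤ lookup m i → coeff f m ≈ 0#

  infixl 7 _·ᵇ_
  _·ᵇ_ : ∀ {N D E} → Poly≤ N (D ℚ.- E) → Poly≤ N E → Poly≤ N D
  _·ᵇ_ {D = D} {E} f g = weaken (D-E+E≤D D E) (f · g)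

  x²-x : ∀ {N} → Fin N → Poly≤ N (toℚ 2)
  x²-x i = x i · x i -ᴹ weaken (toℚ-mono (s≤s ℕ.z≤n)) (x i)

  module _ {N d : ℕ} where

    ⟨_,_⟩ : Poly≤ N (toℚ d) → Poly≤ N (toℚ d) → Carrier
    ⟨ f , g ⟩ = ∑ (monomials N d) λ m → coeff f m * coeff g m

    ‖_‖² : Poly≤ N (toℚ d) → Carrier
    ‖ f ‖² = ⟨ f , f ⟩

    -- Membership in the orthogonal complement of
    -- { g xᵢ xⱼ : {i,j} ∈ E(G), deg g ≤ d − 2 }.
    _∈EdgeComplement_ : Poly≤ N (toℚ d) → Graph N → Set (c ⊔ ℓ₁)
    p ∈EdgeComplement G = ∀ {i j} → Graph.Adj G i j →
      ∀ (g : Poly≤ N (toℚ d ℚ.- toℚ 2)) → ⟨ p , g ·ᵇ (x i · x j) ⟩ ≈ 0#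

    -- p = Π_G f.
    record IsProjection (G : Graph N) (f p : Poly≤ N (toℚ d)) : Set (c ⊔ ℓ₁) where
      field
        in-complement : p ∈EdgeComplement G
        orthogonal    : ∀ q → q ∈EdgeComplement G → ⟨ f -ᴹ p , q ⟩ ≈ 0#

  -- The argument 0≤D of normalised says that 1 lies in the domain of 𝔼.
  record IndependentSetPE {n} (G : Graph n) (D : ℚᵘ) : Set (c ⊔ ℓ₁ ⊔ ℓ₂) where
    open Graph G
    field
      𝔼           : Poly≤ n D → Carrier
      linear      : IsLinear 𝔼
      normalised  : ∀ (0≤D : 0ℚᵘ ℚ.≤ D) → 𝔼 (weaken 0≤D 1ₚ) ≈ 1#
      positive    : ∀ (f : Poly≤ n (D /2)) → 0# ≤ 𝔼 (f ²)
      boolean     : ∀ (f : Poly≤ n (D ℚ.- toℚ 2)) i → 𝔼 (f ·ᵇ x²-x i) ≈ 0#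
      independent : ∀ (f : Poly≤ n (D ℚ.- toℚ 2)) {i j} → Adj i j →
                    𝔼 (f ·ᵇ (x i · x j)) ≈ 0#

  -- The variables x_{i,c} are indexed by Fin (n * k) through the bijection
  -- combine : Fin n → Fin k → Fin (n * k).
  record ColoringPE {n} (G : Graph n) (k : ℕ) (D : ℚᵘ) : Set (c ⊔ ℓ₁ ⊔ ℓ₂) where
    open Graph G

    xᶜ : Fin n → Fin k → Poly≤ (n ℕ.* k) 1ℚᵘ
    xᶜ i c = x (combine {n} {k} i c)

    field
      𝔼          : Poly≤ (n ℕ.* k) D → Carrier
      linear     : IsLinear 𝔼
      normalised : ∀ (0≤D : 0ℚᵘ ℚ.≤ D) → 𝔼 (weaken 0≤D 1ₚ) ≈ 1#
      positive   : ∀ (f : Poly≤ (n ℕ.* k) (D /2)) → 0# ≤ 𝔼 (f ²)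
      boolean    : ∀ (f : Poly≤ (n ℕ.* k) (D ℚ.- toℚ 2)) i c →
                   𝔼 (f ·ᵇ x²-x (combine {n} {k} i c)) ≈ 0#
      proper     : ∀ (f : Poly≤ (n ℕ.* k) (D ℚ.- toℚ 2)) {i j} → Adj i j → ∀ c →
                   𝔼 (f ·ᵇ (xᶜ i c · xᶜ j c)) ≈ 0#
      covering   : ∀ (f : Poly≤ (n ℕ.* k) ((D ℚ.- 1ℚᵘ) /2)) i →
                   0# ≤ 𝔼 (f ² ·ᵇ (sumᴹ (xᶜ i) -ᴹ weaken (toℚ-mono ℕ.z≤n) 1ₚ))

{-# OPTIONS --safe #-}

-- The coloring pseudo-expectation is the k-fold product of the given one: the colors behave like
-- independent samples of an independent set.  Its moment matrix is an entrywise product of k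
-- positive semidefinite matrices, so positivity is the Schur product theorem.
--
-- For the covering constraint fix a vertex with indicator y_c in color c, let p be the mean of y_c,
-- and let f have degree at most t.  For a single color and g of degree at most t, with s = E g,
--
--   2 E[y g²] ≥ p s² - 2 (E[g²] - s²),
--
-- because 2 y g² + 2 (g - s)² - y s² = y (2g - s)² + 2 (1 - y) (g - s)² whenever y² = y.  Split the
-- moment matrix of every color into its rank-one part (the means) and the covariance.  The covariance
-- vanishes on constants, so in a product over the colors at most t of the factors can be covariances,
-- and summing over c gives 2 E[(Σ_c y_c) f²] ≥ (p (k - t) - 2 t) E[f²].  For k = 5 k₀ d the factor is
-- at least 2.  The logarithm is not needed for this; testing the eigenvalue bound on 1, or on 1 - 2x
-- if n = 1, gives n ^ d / λ ≥ 2, hence L ≥ 1/4 and k ≤ 20 k₀ d L.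
module Submission where

open import Defs
open import Algebra.Bundles using (CommutativeRing)
open import Algebra.Bundles.Raw using (RawRing)
import Algebra.Apartness.Properties.HeytingCommutativeRing as HeytingProperties
open import Algebra.Module.Morphism.Structures using (module LeftModuleMorphisms)
import Algebra.Properties.AbelianGroup as AbelianGroupProperties
import Algebra.Properties.Ring as RingProperties
import Algebra.Properties.Semiring.Mult as SemiringMult
import Algebra.Properties.Semiring.Sum as SemiringSum
import Algebra.Solver.Ring as RingSolver
open import Algebra.Solver.Ring.AlmostCommutativeRing
  using (fromCommutativeRing; _-Raw-AlmostCommutative⟶_)
open import Data.Bool.Base using (Bool; true; false; _∧_; if_then_else_)
open import Data.Empty using (⊥; ⊥-elim)
open import Data.Fin.Base using (Fin; zero; suc; splitAt; combine)
import Data.Fin.Properties as Fin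
open import Data.Integer.Base as ℤ using (ℤ; +_; -[1+_])
import Data.Integer.Properties as ℤ
import Data.Integer.Solver as ℤ
open import Data.List.Base as List using (List; []; _∷_; _++_)
import Data.List.Properties as List
open import Data.Maybe.Base using (Maybe; just; nothing)
open import Data.Nat.Base as ℕ using (ℕ; zero; suc; z≤n; s≤s; _∸_; NonZero)
import Data.Nat.DivMod as ℕ
import Data.Nat.Properties as ℕ
open import Data.Nat.Solver using (module +-*-Solver)
open import Data.Product.Base using (_×_; _,_; ∃-syntax; proj₁; proj₂)
open import Data.Rational.Unnormalised.Base as ℚ using (ℚᵘ; 0ℚᵘ; 1ℚᵘ; *≤*)
import Data.Rational.Unnormalised.Properties as ℚ
open import Data.Sum.Base as Sum using (_⊎_; inj₁; inj₂; [_,_]′)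
open import Data.Vec.Base as Vec using (Vec; []; _∷_)
import Data.Vec.Functional as F
import Data.Vec.Properties as Vec
open import Function.Base using (_∘_; id)
open import Level using (_⊔_)
open import Relation.Binary.PropositionalEquality as ≡ using (_≡_; _≢_)
open import Relation.Nullary using (¬_; Dec; yes; no; does)
open import Relation.Nullary.Decidable using (dec-true; dec-false)

-- The count of covariance factors is an induction over the colors with t as a degree budget, which
-- avoids an expansion over subsets of colors: a mean factor leaves t alone, a covariance factor
-- lowers it by one. The induction hypothesis must speak about matrices instead of a single
-- polynomial, because the first color and the remaining ones are combined entrywise.
--
-- Degrees fit as follows. The covering constraint concerns f of degree at most d/4, and multiplying
-- such an f by y_c inside a square uses moments of degree 2 t + 2 in color c. With t the integer
-- part of d/4 this is at most d when d is at least 2, but it exceeds d when d = 1. Hence a second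
-- degree e, at least 2, for the moments of one color.
--
-- The order on the reals is not decidable, so neither diagonalisation nor a rank argument is at
-- hand. Positivity comes from explicit sums of squares and from elimination with a pivot. Since
-- `x ≤ y` is the negation of `y < x`, classical case distinctions are still allowed while such a
-- goal is being proved.

module OrderedField {c ℓ₁ ℓ₂} (ℛ : RealField c ℓ₁ ℓ₂) where

  open RealField ℛ
  module R = CommutativeRing commutativeRing
  open RingProperties R.ring using (-0#≈0#; -‿distribˡ-*; -‿involutive)
  open AbelianGroupProperties R.+-abelianGroup using (⁻¹-∙-comm)
  open SemiringMult R.semiring using (×-homo-+; ×1-homo-*)
  open HeytingProperties heytingCommutativeRing using (invertibleʳ⇒#; #-congʳ)
  open import Relation.Binary.Reasoning.Setoid R.setoid

  -- Integer coefficients for the ring solver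

  fromℕ-+ : ∀ m n → fromℕ (m ℕ.+ n) ≈ fromℕ m + fromℕ n
  fromℕ-+ = ×-homo-+ 1#

  fromℕ-* : ∀ m n → fromℕ (m ℕ.* n) ≈ fromℕ m * fromℕ n
  fromℕ-* = ×1-homo-*

  fromℕ-suc : ∀ k → fromℕ (suc k) ≈ fromℕ 1 + fromℕ k
  fromℕ-suc k = R.+-congʳ (R.sym (R.+-identityʳ 1#))

  fromℤ : ℤ → Carrier
  fromℤ (+ n)    = fromℕ n
  fromℤ -[1+ n ] = - fromℕ (suc n)

  fromℤ-⊖ : ∀ m n → fromℤ (m ℤ.⊖ n) ≈ fromℕ m - fromℕ n
  fromℤ-⊖ zero    zero    = R.sym (R.-‿inverseʳ 0#)
  fromℤ-⊖ zero    (suc n) = R.sym (R.+-identityˡ _)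
  fromℤ-⊖ (suc m) zero    = R.sym (x-0≈x _)
  fromℤ-⊖ (suc m) (suc n) = begin
    fromℤ (suc m ℤ.⊖ suc n)            ≡⟨ ≡.cong fromℤ (ℤ.[1+m]⊖[1+n]≡m⊖n m n) ⟩
    fromℤ (m ℤ.⊖ n)                    ≈⟨ fromℤ-⊖ m n ⟩
    fromℕ m - fromℕ n                  ≈⟨ R.+-congʳ (R.+-identityˡ _) ⟨
    0# + fromℕ m - fromℕ n             ≈⟨ R.+-congʳ (R.+-congʳ (R.-‿inverseʳ 1#)) ⟨
    1# - 1# + fromℕ m - fromℕ n        ≈⟨ R.+-congʳ (R.+-assoc _ _ _) ⟩
    1# + (- 1# + fromℕ m) - fromℕ n    ≈⟨ R.+-congʳ (R.+-congˡ (R.+-comm _ _)) ⟩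
    1# + (fromℕ m - 1#) - fromℕ n      ≈⟨ R.+-congʳ (R.+-assoc _ _ _) ⟨
    1# + fromℕ m - 1# - fromℕ n        ≈⟨ R.+-assoc _ _ _ ⟩
    1# + fromℕ m + (- 1# - fromℕ n)    ≈⟨ R.+-congˡ (⁻¹-∙-comm _ _) ⟩
    1# + fromℕ m - (1# + fromℕ n)      ∎

  fromℤ-neg : ∀ i → fromℤ (ℤ.- i) ≈ - fromℤ i
  fromℤ-neg (+ zero)  = R.sym -0#≈0#
  fromℤ-neg (+ suc n) = R.refl
  fromℤ-neg -[1+ n ]  = R.sym (-‿involutive _)

  fromℤ-+ : ∀ i j → fromℤ (i ℤ.+ j) ≈ fromℤ i + fromℤ j
  fromℤ-+ (+ m)    (+ n)    = fromℕ-+ m n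
  fromℤ-+ (+ m)    -[1+ n ] = fromℤ-⊖ m (suc n)
  fromℤ-+ -[1+ m ] (+ n)    = R.trans (fromℤ-⊖ n (suc m)) (R.+-comm _ _)
  fromℤ-+ -[1+ m ] -[1+ n ] = begin
    - fromℕ (suc (suc (m ℕ.+ n)))        ≡⟨ ≡.cong (λ k → - fromℕ (suc k)) (ℕ.+-suc m n) ⟨
    - fromℕ (suc m ℕ.+ suc n)            ≈⟨ R.-‿cong (fromℕ-+ (suc m) (suc n)) ⟩
    - (fromℕ (suc m) + fromℕ (suc n))    ≈⟨ ⁻¹-∙-comm _ _ ⟨
    - fromℕ (suc m) - fromℕ (suc n)      ∎

  fromℤ-*⁺ : ∀ m j → fromℤ (+ m ℤ.* j) ≈ fromℕ m * fromℤ j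
  fromℤ-*⁺ zero    j = R.trans (R.reflexive (≡.cong fromℤ (ℤ.*-zeroˡ j))) (R.sym (R.zeroˡ _))
  fromℤ-*⁺ (suc m) j = begin
    fromℤ (+ suc m ℤ.* j)                   ≡⟨ ≡.cong fromℤ (ℤ.suc-* (+ m) j) ⟩
    fromℤ (j ℤ.+ + m ℤ.* j)                 ≈⟨ fromℤ-+ j (+ m ℤ.* j) ⟩
    fromℤ j + fromℤ (+ m ℤ.* j)             ≈⟨ R.+-cong (R.sym (R.*-identityˡ _)) (fromℤ-*⁺ m j) ⟩
    1# * fromℤ j + fromℕ m * fromℤ j        ≈⟨ R.distribʳ _ _ _ ⟨
    fromℕ (suc m) * fromℤ j                 ∎

  fromℤ-* : ∀ i j → fromℤ (i ℤ.* j) ≈ fromℤ i * fromℤ j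
  fromℤ-* (+ m)    j = fromℤ-*⁺ m j
  fromℤ-* -[1+ m ] j = begin
    fromℤ (-[1+ m ] ℤ.* j)           ≡⟨ ≡.cong fromℤ (ℤ.neg-distribˡ-* (+ suc m) j) ⟨
    fromℤ (ℤ.- (+ suc m ℤ.* j))      ≈⟨ fromℤ-neg (+ suc m ℤ.* j) ⟩
    - fromℤ (+ suc m ℤ.* j)          ≈⟨ R.-‿cong (fromℤ-*⁺ (suc m) j) ⟩
    - (fromℕ (suc m) * fromℤ j)      ≈⟨ -‿distribˡ-* _ _ ⟩
    - fromℕ (suc m) * fromℤ j        ∎

  ℤ-rawRing : RawRing _ _
  ℤ-rawRing = record
    { Carrier = ℤ ; _≈_ = _≡_ ; _+_ = ℤ._+_ ; _*_ = ℤ._*_ ; -_ = ℤ.-_ ; 0# = + 0 ; 1# = + 1 }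

  -- The numeral 1 is interpreted as `1# + 0#`, the unfolding of `fromℕ 1`; this is why
  -- `+-identityʳ` accompanies many applications of the solver.
  fromℤ-morphism : ℤ-rawRing -Raw-AlmostCommutative⟶ fromCommutativeRing commutativeRing
  fromℤ-morphism = record
    { ⟦_⟧ = fromℤ ; +-homo = fromℤ-+ ; *-homo = fromℤ-* ; -‿homo = fromℤ-neg
    ; 0-homo = R.refl ; 1-homo = R.+-identityʳ 1# }

  fromℤ≟ : ∀ i j → Maybe (fromℤ i ≈ fromℤ j)
  fromℤ≟ i j with i ℤ.≟ j
  ... | yes ≡.refl = just R.refl
  ... | no  _      = nothing

  module Solver =
    RingSolver ℤ-rawRing (fromCommutativeRing commutativeRing) fromℤ-morphism fromℤ≟

  open Solver using (solve; _:=_; con; _:+_; _:*_; _:-_; :-_)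

  -- Ordered field arithmetic with an undecidable order

  zero-*-cong : ∀ {x y z} → x ≈ 0# → x * y ≈ x * z
  zero-*-cong x≈0 = R.trans (R.trans (R.*-congʳ x≈0) (R.zeroˡ _))
    (R.sym (R.trans (R.*-congʳ x≈0) (R.zeroˡ _)))

  x-y<0⇒x<y : ∀ {x y} → x - y < 0# → x < y
  x-y<0⇒x<y {x} {y} p =
    <-respˡ-≈ (solve 2 (λ x y → x :- y :+ y := x) R.refl x y)
      (<-respʳ-≈ (R.+-identityˡ y) (+-monoˡ-< y p))

  x<y⇒x-y<0 : ∀ {x y} → x < y → x - y < 0#
  x<y⇒x-y<0 {x} {y} p = <-respʳ-≈ (R.-‿inverseʳ y) (+-monoˡ-< (- y) p)

  x<y⇒0<y-x : ∀ {x y} → x < y → 0# < y - x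
  x<y⇒0<y-x {x} {y} p = <-respˡ-≈ (R.-‿inverseʳ x) (+-monoˡ-< (- x) p)

  ≤⇒0≤- : ∀ {x y} → x ≤ y → 0# ≤ y - x
  ≤⇒0≤- x≤y y-x<0 = x≤y (x-y<0⇒x<y y-x<0)

  0≤-⇒≤ : ∀ {x y} → 0# ≤ y - x → x ≤ y
  0≤-⇒≤ 0≤y-x y<x = 0≤y-x (x<y⇒x-y<0 y<x)

  -- Takes the place of trichotomy. Apartness is cotransitive, and when it yields the inequality in
  -- the wrong direction, transitivity gives the other alternative.
  <-cotrans : ∀ {x y} → x < y → ∀ z → x < z ⊎ z < y
  <-cotrans x<y z with #-cotrans (<⇒# x<y) z
  ... | inj₁ x#z with #⇒<⊎> x#z
  ...   | inj₁ x<z = inj₁ x<z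
  ...   | inj₂ z<x = inj₂ (<-trans z<x x<y)
  <-cotrans x<y z | inj₂ z#y with #⇒<⊎> z#y
  ...   | inj₁ z<y = inj₂ z<y
  ...   | inj₂ y<z = inj₁ (<-trans x<y y<z)

  ≤-respʳ : ∀ {x y z} → y ≈ z → x ≤ y → x ≤ z
  ≤-respʳ y≈z x≤y z<x = x≤y (<-respˡ-≈ (R.sym y≈z) z<x)

  ≤-respˡ : ∀ {x y z} → x ≈ z → x ≤ y → z ≤ y
  ≤-respˡ x≈z x≤y y<z = x≤y (<-respʳ-≈ (R.sym x≈z) y<z)

  <⇒≤ : ∀ {x y} → x < y → x ≤ y
  <⇒≤ = <-asym

  ≤-refl : ∀ {x} → x ≤ x
  ≤-refl = <-irrefl R.refl

  ≈⇒≤ : ∀ {x y} → x ≈ y → x ≤ y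
  ≈⇒≤ x≈y = ≤-respʳ x≈y ≤-refl

  ≤-antisym : ∀ {x y} → x ≤ y → y ≤ x → x ≈ y
  ≤-antisym x≤y y≤x = proj₁ (tight _ _) λ x#y → case# (#⇒<⊎> x#y)
    where
    case# : _ → ⊥
    case# (inj₁ x<y) = y≤x x<y
    case# (inj₂ y<x) = x≤y y<x

  ≤-<-trans : ∀ {x y z} → x ≤ y → y < z → x < z
  ≤-<-trans {x} x≤y y<z with <-cotrans y<z x
  ... | inj₁ y<x = ⊥-elim (x≤y y<x)
  ... | inj₂ x<z = x<z

  ≤-trans : ∀ {x y z} → x ≤ y → y ≤ z → x ≤ z
  ≤-trans x≤y y≤z z<x with <-cotrans z<x _
  ... | inj₁ z<y = y≤z z<y
  ... | inj₂ y<x = x≤y y<x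

  0≤+ : ∀ {x y} → 0# ≤ x → 0# ≤ y → 0# ≤ x + y
  0≤+ {x} {y} 0≤x 0≤y x+y<0 with <-cotrans x+y<0 y
  ... | inj₂ y<0   = 0≤y y<0
  ... | inj₁ x+y<y = 0≤x (<-respˡ-≈ (solve 2 (λ x y → x :+ y :- y := x) R.refl x y)
                           (x<y⇒x-y<0 x+y<y))

  *#0⇒#0 : ∀ {x y} → x * y # 0# → x # 0#
  *#0⇒#0 {x} {y} xy#0 with #⇒invertible xy#0
  ... | z , _ , inv = invertibleʳ⇒# (y * z , R.trans
          (solve 3 (λ x y z → (x :- con (+ 0)) :* (y :* z) := (x :* y :- con (+ 0)) :* z) R.refl x y z)
          inv)

  0≤∧#0⇒0< : ∀ {x} → 0# ≤ x → x # 0# → 0# < x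
  0≤∧#0⇒0< 0≤x x#0 = [ (λ x<0 → ⊥-elim (0≤x x<0)) , id ]′ (#⇒<⊎> x#0)

  -- A negative product is apart from 0, so it is invertible and both factors are invertible too.
  -- Being nonnegative and apart from 0 they are positive, which contradicts the sign of the
  -- product.
  0≤* : ∀ {x y} → 0# ≤ x → 0# ≤ y → 0# ≤ x * y
  0≤* {x} {y} 0≤x 0≤y xy<0 = <-asym xy<0 (*-pos
    (0≤∧#0⇒0< 0≤x (*#0⇒#0 (<⇒# xy<0)))
    (0≤∧#0⇒0< 0≤y (*#0⇒#0 (<⇒# (<-respˡ-≈ (R.*-comm x y) xy<0)))))

  0≤x² : ∀ x → 0# ≤ x * x
  0≤x² x xx<0 = [ neg , (λ 0<x → <-asym xx<0 (*-pos 0<x 0<x)) ]′ (#⇒<⊎> (*#0⇒#0 (<⇒# xx<0)))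
    where
    neg : x < 0# → ⊥
    neg x<0 = <-asym xx<0 (<-respʳ-≈
      (solve 1 (λ x → (con (+ 0) :- x) :* (con (+ 0) :- x) := x :* x) R.refl x)
      (*-pos (x<y⇒0<y-x x<0) (x<y⇒0<y-x x<0)))

  0<⇒0≤-cancel : ∀ {x y} → 0# < x → 0# ≤ x * y → 0# ≤ y
  0<⇒0≤-cancel {x} {y} 0<x 0≤xy y<0 = 0≤xy (<-respˡ-≈
    (solve 2 (λ x y → con (+ 0) :- x :* (con (+ 0) :- y) := x :* y) R.refl x y)
    (x<y⇒x-y<0 (*-pos 0<x (x<y⇒0<y-x y<0))))

  0≤fromℕ : ∀ n → 0# ≤ fromℕ n
  0≤fromℕ zero    = ≤-refl
  0≤fromℕ (suc n) = <⇒≤ (0<fromℕ (suc n))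

  fromℕ-mono : ∀ {m n} → m ℕ.≤ n → fromℕ m ≤ fromℕ n
  fromℕ-mono {m} {n} m≤n with ℕ.m≤n⇒∃[o]m+o≡n m≤n
  ... | o , ≡.refl = 0≤-⇒≤ (≤-respʳ
          (R.trans (solve 2 (λ x y → y := x :+ y :- x) R.refl (fromℕ m) (fromℕ o))
                   (R.+-congʳ (R.sym (fromℕ-+ m o))))
          (0≤fromℕ o))

-- Positive semidefinite matrices and the Schur product theorem

module Schur {c ℓ₁ ℓ₂} (ℛ : RealField c ℓ₁ ℓ₂) where

  open RealField ℛ hiding (zero)
  open OrderedField ℛ
  private module S = SemiringSum R.semiring
  open Solver using (solve; _:=_; con; _:+_; _:*_; _:-_; :-_)
  open import Relation.Binary.Reasoning.Setoid R.setoid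

  -- Opaque, so that summands are recovered by unification.
  opaque
    sum : ∀ {n} → (Fin n → Carrier) → Carrier
    sum = S.sum

    sum-nil : ∀ (f : Fin 0 → Carrier) → sum f ≈ 0#
    sum-nil f = R.refl

    sum-suc : ∀ {n} (f : Fin (suc n) → Carrier) → sum f ≈ f zero + sum (λ i → f (suc i))
    sum-suc f = R.refl

    sum-cong : ∀ {n} {f g : Fin n → Carrier} → (∀ i → f i ≈ g i) → sum f ≈ sum g
    sum-cong = S.sum-cong-≋

    sum-+ : ∀ {n} (f g : Fin n → Carrier) → sum (λ i → f i + g i) ≈ sum f + sum g
    sum-+ = S.∑-distrib-+

    sum-*ˡ : ∀ {n} x (f : Fin n → Carrier) → sum (λ i → x * f i) ≈ x * sum f
    sum-*ˡ x f = R.sym (S.*-distribˡ-sum x f)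

    sum-*ʳ : ∀ {n} x (f : Fin n → Carrier) → sum (λ i → f i * x) ≈ sum f * x
    sum-*ʳ x f = R.sym (S.*-distribʳ-sum x f)

    sum-0 : ∀ n → sum {n} (λ _ → 0#) ≈ 0#
    sum-0 = S.sum-replicate-zero

  Matrix : ℕ → Set c
  Matrix n = Fin n → Fin n → Carrier

  SymmetricM : ∀ {n} → Matrix n → Set ℓ₁
  SymmetricM A = ∀ i j → A i j ≈ A j i

  sum₂ : ∀ {n} → Matrix n → Carrier
  sum₂ A = sum λ i → sum λ j → A i j

  sum₂-cong : ∀ {n} {A B : Matrix n} → (∀ i j → A i j ≈ B i j) → sum₂ A ≈ sum₂ B
  sum₂-cong A≈B = sum-cong λ i → sum-cong λ j → A≈B i j

  sum₂-+ : ∀ {n} (A B : Matrix n) → sum₂ (λ i j → A i j + B i j) ≈ sum₂ A + sum₂ B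
  sum₂-+ A B = R.trans (sum-cong λ i → sum-+ (A i) (B i)) (sum-+ _ _)

  sum₂-*ˡ : ∀ {n} r (A : Matrix n) → sum₂ (λ i j → r * A i j) ≈ r * sum₂ A
  sum₂-*ˡ r A = R.trans (sum-cong λ i → sum-*ˡ r (A i)) (sum-*ˡ r _)

  sum₂-product : ∀ {n} (a b : Fin n → Carrier) → sum₂ (λ i j → a i * b j) ≈ sum a * sum b
  sum₂-product a b = R.trans (sum-cong λ i → sum-*ˡ (a i) b) (sum-*ʳ (sum b) a)

  sum-zero : ∀ {n} {a : Fin n → Carrier} → (∀ i → a i ≈ 0#) → sum a ≈ 0#
  sum-zero {n} a≈0 = R.trans (sum-cong a≈0) (sum-0 n)

  sum₂-suc : ∀ {n} (A : Matrix (suc n)) → SymmetricM A →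
             sum₂ A ≈ A zero zero + (sum (λ j → A zero (suc j)) + sum (λ j → A zero (suc j)))
                      + sum₂ (λ i j → A (suc i) (suc j))
  sum₂-suc A sym = begin
    sum₂ A
      ≈⟨ R.trans (sum-suc _) (R.+-cong (sum-suc _) (sum-cong λ i → sum-suc _)) ⟩
    A zero zero + s + sum (λ i → A (suc i) zero + sum (λ j → A (suc i) (suc j)))
      ≈⟨ R.+-congˡ (sum-+ (λ i → A (suc i) zero) _) ⟩
    A zero zero + s + (sum (λ i → A (suc i) zero) + A⁺)
      ≈⟨ R.+-congˡ (R.+-congʳ (sum-cong λ i → sym (suc i) zero)) ⟩
    A zero zero + s + (s + A⁺)
      ≈⟨ solve 3 (λ a s t → a :+ s :+ (s :+ t) := a :+ (s :+ s) :+ t) R.refl (A zero zero) s A⁺ ⟩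
    A zero zero + (s + s) + A⁺ ∎
    where
    s = sum λ j → A zero (suc j)
    A⁺ = sum₂ λ i j → A (suc i) (suc j)

  form : ∀ {n} → Matrix n → (Fin n → Carrier) → Carrier
  form A a = sum₂ λ i j → a i * a j * A i j

  PSD : ∀ {n} → Matrix n → Set _
  PSD A = ∀ a → 0# ≤ form A a

  scaled-symmetric : ∀ {n} (A : Matrix n) (a : Fin n → Carrier) → SymmetricM A →
                     SymmetricM (λ i j → a i * a j * A i j)
  scaled-symmetric A a sym i j = R.*-cong (R.*-comm (a i) (a j)) (sym i j)

  form-∷ : ∀ {n} (A : Matrix (suc n)) → SymmetricM A → ∀ x a →
           let s = sum λ j → a j * A zero (suc j) in
           form A (x F.∷ a) ≈ x * x * A zero zero + (x * s + x * s)
                              + form (λ i j → A (suc i) (suc j)) a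
  form-∷ A sym x a = R.trans
    (sum₂-suc (λ i j → (x F.∷ a) i * (x F.∷ a) j * A i j) (scaled-symmetric A (x F.∷ a) sym))
    (R.+-congʳ (R.+-congˡ (R.+-cong cross cross)))
    where
    cross : sum (λ j → x * a j * A zero (suc j)) ≈ x * sum (λ j → a j * A zero (suc j))
    cross = R.trans (sum-cong λ j → R.*-assoc x (a j) _) (sum-*ˡ x _)

  form-0∷ : ∀ {n} (A : Matrix (suc n)) → SymmetricM A → ∀ a →
            form A (0# F.∷ a) ≈ form (λ i j → A (suc i) (suc j)) a
  form-0∷ A sym a = R.trans (form-∷ A sym 0# a)
    (solve 3 (λ x s f → con (+ 0) :* con (+ 0) :* x :+ (con (+ 0) :* s :+ con (+ 0) :* s) :+ f := f)
      R.refl (A zero zero) _ _)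

  PSD-tail : ∀ {n} (A : Matrix (suc n)) → SymmetricM A → PSD A → PSD (λ i j → A (suc i) (suc j))
  PSD-tail A sym psd a = ≤-respʳ (form-0∷ A sym a) (psd (0# F.∷ a))

  form-*ˡ : ∀ {n} (A : Matrix n) r a → form A (λ i → r * a i) ≈ r * r * form A a
  form-*ˡ A r a = R.trans
    (sum₂-cong λ i j → solve 4 (λ r x y z → r :* x :* (r :* y) :* z := r :* r :* (x :* y :* z))
                         R.refl r (a i) (a j) (A i j))
    (sum₂-*ˡ (r * r) _)

  -- If s were apart from 0, then y = - (u + 1) / s would give the value -1. Tightness of apartness
  -- turns this refutation into an equality.
  bounded-affine⇒const : ∀ s u → (∀ y → 0# ≤ y * s + u) → s ≈ 0#
  bounded-affine⇒const s u bounded = proj₁ (tight s 0#) λ s#0 →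
    bounded (- (u + 1#) * recip s s#0) (<-respˡ-≈ (R.sym (value s#0)) -1<0)
    where
    -1<0 : - 1# < 0#
    -1<0 = <-respˡ-≈ (R.+-identityˡ _) (x<y⇒x-y<0 0<1)
    value : ∀ s#0 → - (u + 1#) * recip s s#0 * s + u ≈ - 1#
    value s#0 = begin
      - (u + 1#) * r * s + u
        ≈⟨ R.+-congʳ (solve 3 (λ v r s → v :* r :* s := v :* (s :* r)) R.refl (- (u + 1#)) r s) ⟩
      - (u + 1#) * (s * r) + u    ≈⟨ R.+-congʳ (R.*-congˡ (recip-inverseʳ s s#0)) ⟩
      - (u + 1#) * 1# + u         ≈⟨ R.+-congʳ (R.*-identityʳ _) ⟩
      - (u + 1#) + u              ≈⟨ solve 2 (λ u o → :- (u :+ o) :+ u := :- o) R.refl u 1# ⟩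
      - 1#                        ∎
      where r = recip s s#0

  -- Schur complementation one pivot at a time.  Multiplying through by the pivot A₀₀ avoids
  -- division; since the goal is a negation, we may assume that A₀₀ is positive or zero.
  schur-trace : ∀ n (A B : Matrix n) → SymmetricM A → SymmetricM B → PSD A → PSD B →
                0# ≤ sum₂ (λ i j → A i j * B i j)
  schur-trace zero    A B symA symB psdA psdB = ≈⇒≤ (R.sym (sum-nil _))
  schur-trace (suc n) A B symA symB psdA psdB sum<0 =
    zero-pivot (≤-antisym (λ 0<A₀₀ → positive-pivot 0<A₀₀ sum<0) 0≤A₀₀) sum<0
    where
    A₀₀ = A zero zero
    A⁺ B⁺ : Matrix n
    A⁺ i j = A (suc i) (suc j)
    B⁺ i j = B (suc i) (suc j)
    A₀ : Fin n → Carrier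
    A₀ j = A zero (suc j)
    B₀ : Fin n → Carrier
    B₀ j = B zero (suc j)
    A₀B₀ = sum λ j → A₀ j * B₀ j

    split : sum₂ (λ i j → A i j * B i j) ≈
            A₀₀ * B zero zero + (A₀B₀ + A₀B₀) + sum₂ (λ i j → A⁺ i j * B⁺ i j)
    split = sum₂-suc (λ i j → A i j * B i j) λ i j → R.*-cong (symA i j) (symB i j)

    0≤A₀₀ : 0# ≤ A₀₀
    0≤A₀₀ = ≤-respʳ value (psdA (1# F.∷ λ _ → 0#))
      where
      value : form A (1# F.∷ λ _ → 0#) ≈ A₀₀
      value = R.trans (form-∷ A symA 1# λ _ → 0#) (R.trans
        (R.+-cong (R.+-cong (R.trans (R.*-congʳ (R.*-identityˡ 1#)) (R.*-identityˡ A₀₀))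
          (R.+-cong s≈0 s≈0)) form≈0)
        (solve 1 (λ a → a :+ (con (+ 0) :+ con (+ 0)) :+ con (+ 0) := a) R.refl A₀₀))
        where
        s≈0 : 1# * sum (λ j → 0# * A₀ j) ≈ 0#
        s≈0 = R.trans (R.*-identityˡ _) (sum-zero λ j → R.zeroˡ (A₀ j))
        form≈0 : form A⁺ (λ _ → 0#) ≈ 0#
        form≈0 = sum-zero λ i → sum-zero λ j →
          R.trans (R.*-congʳ (R.zeroˡ 0#)) (R.zeroˡ (A⁺ i j))

    positive-pivot : 0# < A₀₀ → 0# ≤ sum₂ (λ i j → A i j * B i j)
    positive-pivot 0<A₀₀ = 0<⇒0≤-cancel 0<A₀₀ (≤-respʳ (R.sym expansion)
      (0≤+ (psdB (A₀₀ F.∷ A₀)) (schur-trace n A′ B⁺ symA′ (λ i j → symB (suc i) (suc j)) psdA′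
        (PSD-tail B symB psdB))))
      where
      A′ : Matrix n
      A′ i j = A₀₀ * A⁺ i j - A₀ i * A₀ j
      symA′ : SymmetricM A′
      symA′ i j = R.+-cong (R.*-congˡ (symA (suc i) (suc j))) (R.-‿cong (R.*-comm (A₀ i) (A₀ j)))

      -- With a the first row of A, the matrix A₀₀ A is a aᵀ plus the block `A′` on the remaining
      -- indices. Pairing a aᵀ with B gives the quadratic form of B at a.
      expansion : A₀₀ * sum₂ (λ i j → A i j * B i j) ≈
                  form B (A₀₀ F.∷ A₀) + sum₂ (λ i j → A′ i j * B⁺ i j)
      expansion = begin
        A₀₀ * sum₂ (λ i j → A i j * B i j)
          ≈⟨ R.*-congˡ split ⟩
        A₀₀ * (A₀₀ * B zero zero + (A₀B₀ + A₀B₀) + AB⁺)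
          ≈⟨ solve 4 (λ a b s t → a :* (a :* b :+ (s :+ s) :+ t)
                         := a :* a :* b :+ (a :* s :+ a :* s) :+ a :* t)
               R.refl A₀₀ (B zero zero) A₀B₀ AB⁺ ⟩
        A₀₀ * A₀₀ * B zero zero + (A₀₀ * A₀B₀ + A₀₀ * A₀B₀) + A₀₀ * AB⁺
          ≈⟨ R.+-congˡ (R.sym (sum₂-*ˡ A₀₀ _)) ⟩
        A₀₀ * A₀₀ * B zero zero + (A₀₀ * A₀B₀ + A₀₀ * A₀B₀) + sum₂ (λ i j → A₀₀ * (A⁺ i j * B⁺ i j))
          ≈⟨ R.+-congˡ (R.trans (sum₂-cong λ i j →
               solve 4 (λ a x y b → a :* (x :* b) := y :* b :+ (a :* x :- y) :* b)
                 R.refl A₀₀ (A⁺ i j) (A₀ i * A₀ j) (B⁺ i j)) (sum₂-+ _ _)) ⟩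
        A₀₀ * A₀₀ * B zero zero + (A₀₀ * A₀B₀ + A₀₀ * A₀B₀) + (form B⁺ A₀ + A′B⁺)
          ≈⟨ R.+-assoc _ _ _ ⟨
        A₀₀ * A₀₀ * B zero zero + (A₀₀ * A₀B₀ + A₀₀ * A₀B₀) + form B⁺ A₀ + A′B⁺
          ≈⟨ R.+-congʳ (form-∷ B symB A₀₀ A₀) ⟨
        form B (A₀₀ F.∷ A₀) + A′B⁺ ∎
        where
        AB⁺ = sum₂ λ i j → A⁺ i j * B⁺ i j
        A′B⁺ = sum₂ λ i j → A′ i j * B⁺ i j

      psdA′ : PSD A′
      -- Completing the square: once the other coordinates are scaled by A₀₀, the minimising first
      -- coordinate is - s.
      psdA′ a = 0<⇒0≤-cancel 0<A₀₀ (≤-respʳ value (psdA (- s F.∷ λ i → A₀₀ * a i)))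
        where
        s = sum λ j → a j * A₀ j
        value : form A (- s F.∷ λ i → A₀₀ * a i) ≈ A₀₀ * form A′ a
        value = begin
          form A (- s F.∷ λ i → A₀₀ * a i)
            ≈⟨ form-∷ A symA (- s) _ ⟩
          - s * - s * A₀₀ + (- s * s′ + - s * s′) + form A⁺ (λ i → A₀₀ * a i)
            ≈⟨ R.+-cong (R.+-congˡ (R.+-cong (R.*-congˡ s′≈) (R.*-congˡ s′≈))) (form-*ˡ A⁺ A₀₀ a) ⟩
          - s * - s * A₀₀ + (- s * (A₀₀ * s) + - s * (A₀₀ * s)) + A₀₀ * A₀₀ * form A⁺ a
            ≈⟨ solve 3 (λ s p f → :- s :* :- s :* p :+ (:- s :* (p :* s) :+ :- s :* (p :* s)) :+ p :* p :* f
                         := p :* (p :* f :+ :- con (+ 1) :* (s :* s))) R.refl s A₀₀ (form A⁺ a) ⟩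
          A₀₀ * (A₀₀ * form A⁺ a + - (1# + 0#) * (s * s))
            ≈⟨ R.*-congˡ (R.+-cong (sum₂-*ˡ A₀₀ _)
                 (R.trans (sum₂-*ˡ _ _) (R.*-congˡ (sum₂-product _ _)))) ⟨
          A₀₀ * (sum₂ (λ i j → A₀₀ * (a i * a j * A⁺ i j))
                 + sum₂ (λ i j → - (1# + 0#) * (a i * A₀ i * (a j * A₀ j))))
            ≈⟨ R.*-congˡ (sum₂-+ _ _) ⟨
          A₀₀ * sum₂ (λ i j → A₀₀ * (a i * a j * A⁺ i j) + - (1# + 0#) * (a i * A₀ i * (a j * A₀ j)))
            ≈⟨ R.*-congˡ (sum₂-cong λ i j →
                 solve 6 (λ p x y m u v → p :* (x :* y :* m) :+ :- con (+ 1) :* (x :* u :* (y :* v))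
                           := x :* y :* (p :* m :- u :* v))
                   R.refl A₀₀ (a i) (a j) (A⁺ i j) (A₀ i) (A₀ j)) ⟩
          A₀₀ * form A′ a ∎
          where
          s′ = sum λ j → A₀₀ * a j * A₀ j
          s′≈ : s′ ≈ A₀₀ * s
          s′≈ = R.trans (sum-cong λ j → R.*-assoc A₀₀ (a j) _) (sum-*ˡ A₀₀ _)

    zero-pivot : A₀₀ ≈ 0# → 0# ≤ sum₂ (λ i j → A i j * B i j)
    zero-pivot A₀₀≈0 = ≤-respʳ (R.sym value)
      (schur-trace n A⁺ B⁺ (λ i j → symA (suc i) (suc j)) (λ i j → symB (suc i) (suc j))
        (PSD-tail A symA psdA) (PSD-tail B symB psdB))
      where
      s = sum λ j → B₀ j * A₀ j

      -- With a zero pivot the form is affine in the first coordinate, so its slope must vanish. The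
      -- tail `B₀` of the test vector makes that slope the very cross term that occurs in `split`.
      affine : ∀ y → form A (y F.∷ B₀) ≈ y * (s + s) + form A⁺ B₀
      affine y = R.trans (form-∷ A symA y B₀) (R.trans
        (R.+-congʳ (R.+-congʳ (R.*-congˡ A₀₀≈0)))
        (solve 3 (λ y s f → y :* y :* con (+ 0) :+ (y :* s :+ y :* s) :+ f := y :* (s :+ s) :+ f)
          R.refl y s (form A⁺ B₀)))

      A₀B₀≈s : A₀B₀ ≈ s
      A₀B₀≈s = sum-cong λ j → R.*-comm (A₀ j) (B₀ j)

      value : sum₂ (λ i j → A i j * B i j) ≈ sum₂ (λ i j → A⁺ i j * B⁺ i j)
      value = R.trans split (R.trans
        (R.+-congʳ (R.+-cong (R.trans (R.*-congʳ A₀₀≈0) (R.zeroˡ _))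
          (R.trans (R.+-cong A₀B₀≈s A₀B₀≈s)
            (bounded-affine⇒const (s + s) (form A⁺ B₀) λ y → ≤-respʳ (affine y) (psdA (y F.∷ B₀))))))
        (R.trans (R.+-congʳ (R.+-identityˡ 0#)) (R.+-identityˡ _)))

  PSD-cong : ∀ {n} {A B : Matrix n} → (∀ i j → A i j ≈ B i j) → PSD A → PSD B
  PSD-cong A≈B psd a = ≤-respʳ (sum₂-cong λ i j → R.*-congˡ (A≈B i j)) (psd a)

  PSD-+ : ∀ {n} {A B : Matrix n} → PSD A → PSD B → PSD (λ i j → A i j + B i j)
  PSD-+ psdA psdB a = ≤-respʳ
    (R.sym (R.trans (sum₂-cong λ i j → R.distribˡ _ _ _) (sum₂-+ _ _))) (0≤+ (psdA a) (psdB a))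

  PSD-*ˡ : ∀ {n} {A : Matrix n} {r} → 0# ≤ r → PSD A → PSD (λ i j → r * A i j)
  PSD-*ˡ {A = A} {r} 0≤r psd a = ≤-respʳ
    (R.sym (R.trans
      (sum₂-cong λ i j → solve 3 (λ r x m → x :* (r :* m) := r :* (x :* m)) R.refl r (a i * a j) (A i j))
      (sum₂-*ˡ r _)))
    (0≤* 0≤r (psd a))

  PSD-congruence : ∀ {n} {A : Matrix n} (b : Fin n → Carrier) → PSD A → PSD (λ i j → b i * b j * A i j)
  PSD-congruence {A = A} b psd a = ≤-respʳ
    (sum₂-cong λ i j → solve 5 (λ x y u v m → x :* u :* (y :* v) :* m := x :* y :* (u :* v :* m))
       R.refl (a i) (a j) (b i) (b j) (A i j))
    (psd λ i → a i * b i)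

  PSD-1 : ∀ {n} → PSD {n} (λ _ _ → 1#)
  PSD-1 a = ≤-respʳ
    (R.sym (R.trans (sum₂-cong λ i j → R.*-identityʳ _) (sum₂-product a a))) (0≤x² (sum a))

  -- The form of the entrywise product at a is the pairing of A with diag(a) B diag(a), which is
  -- again positive semidefinite.
  schur-product : ∀ {n} {A B : Matrix n} → SymmetricM A → SymmetricM B → PSD A → PSD B →
                  PSD (λ i j → A i j * B i j)
  schur-product {n} {A} {B} symA symB psdA psdB a = ≤-respʳ
    (sum₂-cong λ i j → solve 3 (λ x y z → x :* (y :* z) := y :* (x :* z)) R.refl (A i j) (a i * a j) (B i j))
    (schur-trace n A (λ i j → a i * a j * B i j) symA (scaled-symmetric B a symB) psdA
      (PSD-congruence a psdB))

-- Exponent vectors and their decomposition by color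

infixl 6 _⊕_
_⊕_ : ∀ {N} → Monomial N → Monomial N → Monomial N
_⊕_ = Vec.zipWith ℕ._+_

⊕-comm : ∀ {N} (a b : Monomial N) → a ⊕ b ≡ b ⊕ a
⊕-comm = Vec.zipWith-comm ℕ.+-comm

⊕-assoc : ∀ {N} (a b c : Monomial N) → (a ⊕ b) ⊕ c ≡ a ⊕ (b ⊕ c)
⊕-assoc = Vec.zipWith-assoc ℕ.+-assoc

⊕-identityˡ : ∀ {N} (a : Monomial N) → 1ᴹ ⊕ a ≡ a
⊕-identityˡ = Vec.zipWith-identityˡ ℕ.+-identityˡ

⊕-identityʳ : ∀ {N} (a : Monomial N) → a ⊕ 1ᴹ ≡ a
⊕-identityʳ = Vec.zipWith-identityʳ ℕ.+-identityʳ

⊕-swap : ∀ {N} (a b c : Monomial N) → (a ⊕ b) ⊕ c ≡ (a ⊕ c) ⊕ b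
⊕-swap a b c = ≡.trans (⊕-assoc a b c)
  (≡.trans (≡.cong (a ⊕_) (⊕-comm b c)) (≡.sym (⊕-assoc a c b)))

⊕-interchange : ∀ {N} (a b c d : Monomial N) → (a ⊕ b) ⊕ (c ⊕ d) ≡ (a ⊕ c) ⊕ (b ⊕ d)
⊕-interchange a b c d = ≡.trans (≡.sym (⊕-assoc (a ⊕ b) c d))
  (≡.trans (≡.cong (_⊕ d) (⊕-swap a b c)) (⊕-assoc (a ⊕ c) b d))

degree-⊕ : ∀ {N} (a b : Monomial N) → degree (a ⊕ b) ≡ degree a ℕ.+ degree b
degree-⊕ []      []      = ≡.refl
degree-⊕ (x ∷ a) (y ∷ b) = ≡.trans (≡.cong (x ℕ.+ y ℕ.+_) (degree-⊕ a b))
  (+-*-Solver.solve 4 (λ x y a b → x :+ y :+ (a :+ b) := x :+ a :+ (y :+ b)) ≡.refl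
    x y (degree a) (degree b))
  where open +-*-Solver

degree≡0⇒1ᴹ : ∀ {N} (a : Monomial N) → degree a ≡ 0 → a ≡ 1ᴹ
degree≡0⇒1ᴹ []         _  = ≡.refl
degree≡0⇒1ᴹ (zero ∷ a) eq = ≡.cong (0 ∷_) (degree≡0⇒1ᴹ a eq)

-- A monomial in the variables x_{v,c}, stored color by color, because the product expectation
-- contributes one factor for each color.
Colored : ℕ → ℕ → Set
Colored n k = Fin k → Monomial n

infixl 6 _⊕ᶜ_
_⊕ᶜ_ : ∀ {n k} → Colored n k → Colored n k → Colored n k
(u ⊕ᶜ w) c = u c ⊕ w c

single : ∀ {n k} → Fin k → Monomial n → Colored n k
single zero    m zero    = m
single zero    m (suc b) = 1ᴹ
single (suc c) m zero    = 1ᴹ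
single (suc c) m (suc b) = single c m b

single-same : ∀ {n k} (c : Fin k) (m : Monomial n) → single c m c ≡ m
single-same zero    m = ≡.refl
single-same (suc c) m = single-same c m

single-other : ∀ {n k} (c b : Fin k) (m : Monomial n) → b ≢ c → single c m b ≡ 1ᴹ
single-other zero    zero    m b≢c = ⊥-elim (b≢c ≡.refl)
single-other zero    (suc b) m b≢c = ≡.refl
single-other (suc c) zero    m b≢c = ≡.refl
single-other (suc c) (suc b) m b≢c = single-other c b m (b≢c ∘ ≡.cong suc)

single-⊕ : ∀ {n k} (c : Fin k) (m m′ : Monomial n) b → single c (m ⊕ m′) b ≡ single c m b ⊕ single c m′ b
single-⊕ zero    m m′ zero    = ≡.refl
single-⊕ zero    m m′ (suc b) = ≡.sym (⊕-identityˡ 1ᴹ)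
single-⊕ (suc c) m m′ zero    = ≡.sym (⊕-identityˡ 1ᴹ)
single-⊕ (suc c) m m′ (suc b) = single-⊕ c m m′ b

total : ∀ {n k} → Colored n k → ℕ
total {k = zero}  w = 0
total {k = suc k} w = degree (w zero) ℕ.+ total (w ∘ suc)

total-cong : ∀ {n k} {u w : Colored n k} → (∀ c → u c ≡ w c) → total u ≡ total w
total-cong {k = zero}  u≡w = ≡.refl
total-cong {k = suc k} u≡w = ≡.cong₂ ℕ._+_ (≡.cong degree (u≡w zero)) (total-cong (u≡w ∘ suc))

degree≤total : ∀ {n k} (w : Colored n k) c → degree (w c) ℕ.≤ total w
degree≤total w zero    = ℕ.m≤m+n _ _
degree≤total w (suc c) = ℕ.≤-trans (degree≤total (w ∘ suc) c) (ℕ.m≤n+m _ (degree (w zero)))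

total-1 : ∀ n k → total {n} {k} (λ _ → 1ᴹ) ≡ 0
total-1 n zero    = ≡.refl
total-1 n (suc k) = ≡.cong₂ ℕ._+_ (degree-1ᴹ n) (total-1 n k)

total-∷ : ∀ {n k} (xs : Vec ℕ k) (w : Colored n k) →
          total (λ c → Vec.lookup xs c ∷ w c) ≡ Vec.sum xs ℕ.+ total w
total-∷ []       w = ≡.refl
total-∷ (e ∷ xs) w = ≡.trans (≡.cong (e ℕ.+ degree (w zero) ℕ.+_) (total-∷ xs (w ∘ suc)))
  (+-*-Solver.solve 4 (λ x y a b → x :+ y :+ (a :+ b) := x :+ a :+ (y :+ b)) ≡.refl
    e (degree (w zero)) (Vec.sum xs) (total (w ∘ suc)))
  where open +-*-Solver

parts : ∀ {n k} → Monomial (n ℕ.* k) → Colored n k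
parts m c = Vec.tabulate λ v → Vec.lookup m (combine v c)

lookup-extensionality : ∀ {n} (a b : Vec ℕ n) → (∀ i → Vec.lookup a i ≡ Vec.lookup b i) → a ≡ b
lookup-extensionality a b a≗b = ≡.trans (≡.sym (Vec.tabulate∘lookup a))
  (≡.trans (Vec.tabulate-cong a≗b) (Vec.tabulate∘lookup b))

lookup-parts : ∀ {n k} (m : Monomial (n ℕ.* k)) c v →
               Vec.lookup (parts {n} {k} m c) v ≡ Vec.lookup m (combine v c)
lookup-parts m c v = Vec.lookup∘tabulate _ v

parts-⊕ : ∀ {n k} (a b : Monomial (n ℕ.* k)) c → parts {n} {k} (a ⊕ b) c ≡ parts a c ⊕ parts b c
parts-⊕ {n} {k} a b c = lookup-extensionality _ _ λ v → begin
  Vec.lookup (parts {n} {k} (a ⊕ b) c) v             ≡⟨ lookup-parts (a ⊕ b) c v ⟩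
  Vec.lookup (a ⊕ b) (combine v c)                   ≡⟨ Vec.lookup-zipWith ℕ._+_ (combine v c) a b ⟩
  Vec.lookup a (combine v c) ℕ.+ Vec.lookup b (combine v c)
    ≡⟨ ≡.cong₂ ℕ._+_ (lookup-parts a c v) (lookup-parts b c v) ⟨
  Vec.lookup (parts {n} {k} a c) v ℕ.+ Vec.lookup (parts {n} {k} b c) v
    ≡⟨ Vec.lookup-zipWith ℕ._+_ v (parts {n} {k} a c) (parts b c) ⟨
  Vec.lookup (parts {n} {k} a c ⊕ parts b c) v       ∎
  where open ≡.≡-Reasoning

parts-1ᴹ : ∀ {n k} c → parts {n} {k} 1ᴹ c ≡ 1ᴹ
parts-1ᴹ {n} {k} c = lookup-extensionality _ _ λ v → ≡.trans (lookup-parts {n} {k} 1ᴹ c v)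
  (≡.trans (Vec.lookup-replicate (combine v c) 0) (≡.sym (Vec.lookup-replicate v 0)))

lookup-varᴹ-other : ∀ {N} (i j : Fin N) → j ≢ i → Vec.lookup (varᴹ i) j ≡ 0
lookup-varᴹ-other i j j≢i = ≡.trans (Vec.lookup∘updateAt′ j i j≢i 1ᴹ) (Vec.lookup-replicate j 0)

lookup-varᴹ : ∀ {N} (i : Fin N) → Vec.lookup (varᴹ i) i ≡ 1
lookup-varᴹ i = Vec.lookup∘updateAt i 1ᴹ

parts-varᴹ : ∀ {n k} (v : Fin n) (c b : Fin k) → parts (varᴹ (combine v c)) b ≡ single c (varᴹ v) b
parts-varᴹ v c b with b Fin.≟ c
... | no b≢c = ≡.trans
  (lookup-extensionality _ _ λ w → ≡.trans (lookup-parts (varᴹ (combine v c)) b w)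
    (≡.trans (lookup-varᴹ-other (combine v c) (combine w b) (b≢c ∘ Fin.combine-injectiveʳ w b v c))
      (≡.sym (Vec.lookup-replicate w 0))))
  (≡.sym (single-other c b (varᴹ v) b≢c))
... | yes ≡.refl = ≡.trans
  (lookup-extensionality _ _ λ w → ≡.trans (lookup-parts (varᴹ (combine v c)) c w) (eq w))
  (≡.sym (single-same c (varᴹ v)))
  where
  eq : ∀ w → Vec.lookup (varᴹ (combine v c)) (combine w c) ≡ Vec.lookup (varᴹ v) w
  eq w with w Fin.≟ v
  ... | yes ≡.refl = ≡.trans (lookup-varᴹ (combine v c)) (≡.sym (lookup-varᴹ v))
  ... | no  w≢v    = ≡.trans
    (lookup-varᴹ-other (combine v c) (combine w c) (w≢v ∘ Fin.combine-injectiveˡ w c v c))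
    (≡.sym (lookup-varᴹ-other v w w≢v))

-- `combine` places the k exponents of the first vertex in front, so induction on n peels one
-- exponent off every color at the same time.
total-parts : ∀ {n k} (m : Monomial (n ℕ.* k)) → total (parts {n} {k} m) ≡ degree m
total-parts {zero}  {k} []  = total-1 0 k
total-parts {suc n} {k} m with Vec.splitAt k m
... | xs , ys , ≡.refl = begin
  total (parts {suc n} {k} (xs Vec.++ ys))
    ≡⟨ total-cong (λ c → ≡.cong₂ _∷_ (Vec.lookup-++ˡ xs ys c)
         (Vec.tabulate-cong λ v → Vec.lookup-++ʳ xs ys (combine v c))) ⟩
  total (λ c → Vec.lookup xs c ∷ parts {n} {k} ys c)
    ≡⟨ total-∷ xs (parts ys) ⟩
  Vec.sum xs ℕ.+ total (parts {n} {k} ys)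
    ≡⟨ ≡.cong (Vec.sum xs ℕ.+_) (total-parts {n} {k} ys) ⟩
  Vec.sum xs ℕ.+ Vec.sum ys
    ≡⟨ Vec.sum-++ xs ⟨
  degree (xs Vec.++ ys) ∎
  where open ≡.≡-Reasoning

splitAt-elim : ∀ {a p} {A : Set a} (P : A → Set p) {m n} (u : Fin m → A) (w : Fin n → A) →
               (∀ i → P (u i)) → (∀ i → P (w i)) → ∀ i → P ([ u , w ]′ (splitAt m i))
splitAt-elim P {m} u w Pu Pw i with splitAt m i
... | inj₁ j = Pu j
... | inj₂ j = Pw j

-- Products over colors and the covering inequality

module ColorProduct {c ℓ₁ ℓ₂} (ℛ : RealField c ℓ₁ ℓ₂) where

  open RealField ℛ hiding (zero)
  open OrderedField ℛ
  open Schur ℛ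
  open Solver using (solve; _:=_; con; _:+_; _:*_; _:-_; :-_)
  open import Relation.Binary.Reasoning.Setoid R.setoid

  sum-splitAt : ∀ m {n} (h : Fin m ⊎ Fin n → Carrier) →
                sum (λ i → h (splitAt m i)) ≈ sum (h ∘ inj₁) + sum (h ∘ inj₂)
  sum-splitAt zero    h = R.sym (R.trans (R.+-congʳ (sum-nil _)) (R.+-identityˡ _))
  sum-splitAt (suc m) h = R.trans (sum-suc _) (R.trans
    (R.+-congˡ (sum-splitAt m (h ∘ Sum.map₁ suc)))
    (R.trans (R.sym (R.+-assoc _ _ _)) (R.+-congʳ (R.sym (sum-suc (h ∘ inj₁))))))

  -- The result is the Gram matrix of the combinations r u_i + b_i w_i, obtained from the Gram
  -- matrix of all 2 N points. It serves for g - y g and for r g - E g.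
  PSD-combine : ∀ {X : Set} (κ : X → X → Carrier) {N} (u w : Fin N → X)
    (r : Carrier) (b : Fin N → Carrier) →
    PSD (λ i j → κ ([ u , w ]′ (splitAt N i)) ([ u , w ]′ (splitAt N j))) →
    PSD (λ i j → r * r * κ (u i) (u j) + r * b j * κ (u i) (w j)
                 + (r * b i * κ (w i) (u j) + b i * b j * κ (w i) (w j)))
  PSD-combine κ {N} u w r b psd a = ≤-respʳ value (psd (λ i → coeff′ (splitAt N i)))
    where
    coeff′ : Fin N ⊎ Fin N → Carrier
    coeff′ = [ (λ i → r * a i) , (λ i → b i * a i) ]′
    point : Fin N ⊎ Fin N → _
    point = [ u , w ]′
    H : Fin N ⊎ Fin N → Fin N ⊎ Fin N → Carrier
    H p q = coeff′ p * coeff′ q * κ (point p) (point q)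
    value : sum₂ (λ i j → H (splitAt N i) (splitAt N j)) ≈ _
    value = begin
      sum₂ (λ i j → H (splitAt N i) (splitAt N j))
        ≈⟨ sum-cong (λ i → sum-splitAt N (H (splitAt N i))) ⟩
      sum (λ i → sum (H (splitAt N i) ∘ inj₁) + sum (H (splitAt N i) ∘ inj₂))
        ≈⟨ sum-splitAt N (λ p → sum (H p ∘ inj₁) + sum (H p ∘ inj₂)) ⟩
      sum (λ i → sum (H (inj₁ i) ∘ inj₁) + sum (H (inj₁ i) ∘ inj₂))
        + sum (λ i → sum (H (inj₂ i) ∘ inj₁) + sum (H (inj₂ i) ∘ inj₂))
        ≈⟨ sum-+ _ _ ⟨
      sum (λ i → sum (H (inj₁ i) ∘ inj₁) + sum (H (inj₁ i) ∘ inj₂)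
               + (sum (H (inj₂ i) ∘ inj₁) + sum (H (inj₂ i) ∘ inj₂)))
        ≈⟨ sum-cong (λ i → R.+-cong (sum-+ _ _) (sum-+ _ _)) ⟨
      sum (λ i → sum (λ j → H (inj₁ i) (inj₁ j) + H (inj₁ i) (inj₂ j))
               + sum (λ j → H (inj₂ i) (inj₁ j) + H (inj₂ i) (inj₂ j)))
        ≈⟨ sum-cong (λ i → sum-+ _ _) ⟨
      sum₂ (λ i j → H (inj₁ i) (inj₁ j) + H (inj₁ i) (inj₂ j)
                  + (H (inj₂ i) (inj₁ j) + H (inj₂ i) (inj₂ j)))
        ≈⟨ sum₂-cong (λ i j → solve 9 (λ x y r bi bj k₁ k₂ k₃ k₄ →
             r :* x :* (r :* y) :* k₁ :+ r :* x :* (bj :* y) :* k₂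
               :+ (bi :* x :* (r :* y) :* k₃ :+ bi :* x :* (bj :* y) :* k₄)
             := x :* y :* (r :* r :* k₁ :+ r :* bj :* k₂ :+ (r :* bi :* k₃ :+ bi :* bj :* k₄)))
             R.refl (a i) (a j) r (b i) (b j) (κ (u i) (u j)) (κ (u i) (w j)) (κ (w i) (u j)) (κ (w i) (w j))) ⟩
      _ ∎

  -- The data of a single color. Squares and y² = y are available up to degree e, the edge
  -- constraints up to degree d; the two degrees differ only when d = 1. Values of `μ` at higher
  -- degrees are arbitrary.
  record Moments {n} (G : Graph n) (d e : ℕ) : Set (c ⊔ ℓ₁ ⊔ ℓ₂) where
    field
      μ       : Monomial n → Carrier
      μ-1     : μ 1ᴹ ≈ 1#
      μ-psd   : ∀ {N} (u : Fin N → Monomial n) → (∀ i → 2 ℕ.* degree (u i) ℕ.≤ e) →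
                PSD (λ i j → μ (u i ⊕ u j))
      μ-bool  : ∀ m v → degree m ℕ.+ 2 ℕ.≤ e → μ (m ⊕ (varᴹ v ⊕ varᴹ v)) ≈ μ (m ⊕ varᴹ v)
      μ-indep : ∀ m {i j} → Graph.Adj G i j → degree m ℕ.+ 2 ℕ.≤ d →
                μ (m ⊕ (varᴹ i ⊕ varᴹ j)) ≈ 0#

  module _ {n} {G : Graph n} {d e : ℕ} (M : Moments G d e) where
    open Moments M

    Ψ : ∀ {k} → Colored n k → Carrier
    Ψ {zero}  u = 1#
    Ψ {suc k} u = μ (u zero) * Ψ (u ∘ suc)

    Ψ-cong : ∀ {k} {u w : Colored n k} → (∀ c → u c ≡ w c) → Ψ u ≈ Ψ w
    Ψ-cong {zero}  u≡w = R.refl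
    Ψ-cong {suc k} u≡w = R.*-cong (R.reflexive (≡.cong μ (u≡w zero))) (Ψ-cong (u≡w ∘ suc))

    Ψ-1 : ∀ {k} {u : Colored n k} → (∀ c → u c ≡ 1ᴹ) → Ψ u ≈ 1#
    Ψ-1 {zero}  u≡1 = R.refl
    Ψ-1 {suc k} u≡1 = R.trans (R.*-cong (R.trans (R.reflexive (≡.cong μ (u≡1 zero))) μ-1) (Ψ-1 (u≡1 ∘ suc)))
      (R.*-identityˡ 1#)

    Ψ-single-zero : ∀ {k} (w : Colored n (suc k)) m →
                    Ψ (w ⊕ᶜ single zero m) ≈ μ (w zero ⊕ m) * Ψ (w ∘ suc)
    Ψ-single-zero w m = R.*-congˡ (Ψ-cong λ b → ⊕-identityʳ (w (suc b)))

    Ψ-single-suc : ∀ {k} (w : Colored n (suc k)) c m →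
                   Ψ (w ⊕ᶜ single (suc c) m) ≈ μ (w zero) * Ψ ((w ∘ suc) ⊕ᶜ single c m)
    Ψ-single-suc w c m = R.*-congʳ (R.reflexive (≡.cong μ (⊕-identityʳ (w zero))))

    Ψ-single-cong : ∀ {k} (w : Colored n k) c {m m′} → μ (w c ⊕ m) ≈ μ (w c ⊕ m′) →
                    Ψ (w ⊕ᶜ single c m) ≈ Ψ (w ⊕ᶜ single c m′)
    Ψ-single-cong w zero {m} {m′} eq =
      R.trans (Ψ-single-zero w m) (R.trans (R.*-congʳ eq) (R.sym (Ψ-single-zero w m′)))
    Ψ-single-cong w (suc c) {m} {m′} eq =
      R.trans (Ψ-single-suc w c m) (R.trans (R.*-congˡ (Ψ-single-cong (w ∘ suc) c eq))
        (R.sym (Ψ-single-suc w c m′)))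

    Ψ-single-zeroed : ∀ {k} (w : Colored n k) c {m} → μ (w c ⊕ m) ≈ 0# → Ψ (w ⊕ᶜ single c m) ≈ 0#
    Ψ-single-zeroed w zero {m} eq =
      R.trans (Ψ-single-zero w m) (R.trans (R.*-congʳ eq) (R.zeroˡ _))
    Ψ-single-zeroed w (suc c) {m} eq =
      R.trans (Ψ-single-suc w c m) (R.trans (R.*-congˡ (Ψ-single-zeroed (w ∘ suc) c eq)) (R.zeroʳ _))

    Ψ-symmetric : ∀ {k N} (u : Fin N → Colored n k) → SymmetricM (λ i j → Ψ (u i ⊕ᶜ u j))
    Ψ-symmetric u i j = Ψ-cong λ c → ⊕-comm (u i c) (u j c)

    Ψ-psd : ∀ {k N} (u : Fin N → Colored n k) → (∀ i c → 2 ℕ.* degree (u i c) ℕ.≤ e) →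
            PSD (λ i j → Ψ (u i ⊕ᶜ u j))
    Ψ-psd {zero}  u deg≤ = PSD-1
    Ψ-psd {suc k} u deg≤ = schur-product
      (λ i j → R.reflexive (≡.cong μ (⊕-comm (u i zero) (u j zero))))
      (Ψ-symmetric (λ i → u i ∘ suc))
      (μ-psd (λ i → u i zero) (λ i → deg≤ i zero))
      (Ψ-psd (λ i → u i ∘ suc) (λ i c → deg≤ i (suc c)))

    module _ (v : Fin n) where

      p : Carrier
      p = μ (varᴹ v)

      μᵛ : Monomial n → Carrier
      μᵛ m = μ (m ⊕ varᴹ v)

      -- The expectation of (Σ_c y_c) w, unrolled by a Leibniz rule so that the induction over
      -- colors can detach the first color.
      T : ∀ {k} → Colored n k → Carrier
      T {zero}  w = 0#
      T {suc k} w = μᵛ (w zero) * Ψ (w ∘ suc) + μ (w zero) * T (w ∘ suc)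

      T-sum : ∀ {k} (w : Colored n k) → sum (λ c → Ψ (w ⊕ᶜ single c (varᴹ v))) ≈ T w
      T-sum {zero}  w = sum-nil _
      T-sum {suc k} w = R.trans (sum-suc _) (R.+-cong (Ψ-single-zero w (varᴹ v))
        (R.trans (sum-cong λ c → Ψ-single-suc w c (varᴹ v))
          (R.trans (sum-*ˡ _ _) (R.*-congˡ (T-sum (w ∘ suc))))))

      T-cong : ∀ {k} {u w : Colored n k} → (∀ c → u c ≡ w c) → T u ≈ T w
      T-cong {zero}  u≡w = R.refl
      T-cong {suc k} u≡w = R.+-cong
        (R.*-cong (R.reflexive (≡.cong μᵛ (u≡w zero))) (Ψ-cong (u≡w ∘ suc)))
        (R.*-cong (R.reflexive (≡.cong μ (u≡w zero))) (T-cong (u≡w ∘ suc)))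

      μᵛ-1ˡ : μᵛ 1ᴹ ≈ p
      μᵛ-1ˡ = R.reflexive (≡.cong μ (⊕-identityˡ (varᴹ v)))

      -- The covariance of two monomials within one color.
      K : Monomial n → Monomial n → Carrier
      K a b = μ (a ⊕ b) - μ a * μ b

      K-symmetric : ∀ a b → K a b ≈ K b a
      K-symmetric a b = R.+-cong (R.reflexive (≡.cong μ (⊕-comm a b))) (R.-‿cong (R.*-comm _ _))

      K-1ˡ : ∀ {a b} → degree a ≡ 0 → K a b ≈ 0#
      K-1ˡ {a} {b} deg≡0 with ≡.refl ← degree≡0⇒1ᴹ a deg≡0 = begin
        μ (1ᴹ ⊕ b) - μ 1ᴹ * μ b
          ≈⟨ R.+-cong (R.reflexive (≡.cong μ (⊕-identityˡ b))) (R.-‿cong (R.trans (R.*-congʳ μ-1) (R.*-identityˡ _))) ⟩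
        μ b - μ b
          ≈⟨ R.-‿inverseʳ _ ⟩
        0# ∎

      two : Carrier
      two = fromℕ 2

      -- The bound leaves room for the square of y g when g has degree at most t.
      module _ {t : ℕ} (2t+2≤e : 2 ℕ.* t ℕ.+ 2 ℕ.≤ e) where

        2*degree≤e : ∀ (m : Monomial n) → degree m ℕ.≤ t → 2 ℕ.* degree m ℕ.≤ e
        2*degree≤e m deg≤t = ℕ.≤-trans (ℕ.*-monoʳ-≤ 2 deg≤t) (ℕ.≤-trans (ℕ.m≤m+n _ 2) 2t+2≤e)

        2*degree⊕varᴹ≤e : ∀ (m : Monomial n) → degree m ℕ.≤ t → 2 ℕ.* degree (m ⊕ varᴹ v) ℕ.≤ e
        2*degree⊕varᴹ≤e m deg≤t = ℕ.≤-trans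
          (ℕ.≤-reflexive (≡.cong (2 ℕ.*_)
            (≡.trans (degree-⊕ m (varᴹ v)) (≡.cong (degree m ℕ.+_) (degree-varᴹ v)))))
          (ℕ.≤-trans (ℕ.*-monoʳ-≤ 2 (ℕ.+-monoˡ-≤ 1 deg≤t))
            (ℕ.≤-trans (ℕ.≤-reflexive (ℕ.*-distribˡ-+ 2 t 1)) 2t+2≤e))

        bool : ∀ {a b : Monomial n} → degree a ℕ.≤ t → degree b ℕ.≤ t →
               μ ((a ⊕ varᴹ v) ⊕ (b ⊕ varᴹ v)) ≈ μᵛ (a ⊕ b)
        bool {a} {b} a≤t b≤t = R.trans (R.reflexive (≡.cong μ (⊕-interchange a (varᴹ v) b (varᴹ v))))
          (μ-bool (a ⊕ b) v (ℕ.≤-trans (ℕ.+-monoˡ-≤ 2 (ℕ.≤-trans (ℕ.≤-reflexive (degree-⊕ a b))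
            (ℕ.≤-trans (ℕ.+-mono-≤ a≤t b≤t) (ℕ.≤-reflexive (≡.cong (t ℕ.+_) (≡.sym (ℕ.+-identityʳ t)))))))
            2t+2≤e))

        μᵛ-psd : ∀ {N} (u : Fin N → Monomial n) → (∀ i → degree (u i) ℕ.≤ t) →
                 PSD (λ i j → μᵛ (u i ⊕ u j))
        μᵛ-psd u u≤t = PSD-cong (λ i j → bool (u≤t i) (u≤t j))
          (μ-psd (λ i → u i ⊕ varᴹ v) (λ i → 2*degree⊕varᴹ≤e (u i) (u≤t i)))

        -- y and 1 - y are squares modulo y² = y.
        1-μᵛ-psd : ∀ {N} (u : Fin N → Monomial n) → (∀ i → degree (u i) ℕ.≤ t) →
                   PSD (λ i j → μ (u i ⊕ u j) - μᵛ (u i ⊕ u j))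
        1-μᵛ-psd u u≤t = PSD-cong value
          (PSD-combine (λ a b → μ (a ⊕ b)) u (λ i → u i ⊕ varᴹ v) 1# (λ _ → - 1#)
            (μ-psd _ (splitAt-elim (λ m → 2 ℕ.* degree m ℕ.≤ e) u _
              (λ i → 2*degree≤e (u i) (u≤t i)) (λ i → 2*degree⊕varᴹ≤e (u i) (u≤t i)))))
          where
          value : ∀ i j → 1# * 1# * μ (u i ⊕ u j) + 1# * - 1# * μ (u i ⊕ (u j ⊕ varᴹ v))
                  + (1# * - 1# * μ ((u i ⊕ varᴹ v) ⊕ u j) + - 1# * - 1# * μ ((u i ⊕ varᴹ v) ⊕ (u j ⊕ varᴹ v)))
                  ≈ μ (u i ⊕ u j) - μᵛ (u i ⊕ u j)
          value i j = R.trans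
            (R.+-cong (R.+-congˡ (R.*-congˡ (R.reflexive (≡.cong μ (≡.sym (⊕-assoc (u i) (u j) (varᴹ v)))))))
              (R.+-cong (R.*-congˡ (R.reflexive (≡.cong μ (⊕-swap (u i) (varᴹ v) (u j)))))
                (R.*-congˡ (bool (u≤t i) (u≤t j)))))
            (R.trans (R.+-cong (R.+-cong (R.*-congʳ (R.*-identityˡ _)) (R.*-congʳ (R.*-identityˡ _)))
               (R.+-cong (R.*-congʳ (R.*-identityˡ _)) (R.*-congʳ neg-neg)))
             (R.trans (R.+-cong (R.+-cong (R.*-identityˡ _) neg) (R.+-cong neg (R.*-identityˡ _)))
               (solve 2 (λ x y → x :+ :- y :+ (:- y :+ y) := x :- y) R.refl (μ (u i ⊕ u j)) (μᵛ (u i ⊕ u j)))))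
            where
            neg : ∀ {x} → - 1# * x ≈ - x
            neg {x} = R.trans (R.*-congʳ (R.-‿cong (R.sym (R.+-identityʳ 1#))))
              (solve 1 (λ x → :- con (+ 1) :* x := :- x) R.refl x)
            neg-neg : - 1# * - 1# ≈ 1#
            neg-neg = R.trans neg (R.trans (R.sym (R.+-identityˡ _))
              (solve 1 (λ o → con (+ 0) :+ :- :- o := o) R.refl 1#))

        -- The Gram matrix of the polynomials r g - E g, where the mean E is taken under `μ` and the
        -- product under κ. It is applied to κ = `μ` and to the weights y and 1 - y; r = 1 gives
        -- deviations from the mean, and r = 2 gives the square (2 g - s)².
        centre : ∀ {N} (κ : Monomial n → Carrier) (u : Fin N → Monomial n) (r : Carrier) →
                 (∀ i → degree (u i) ℕ.≤ t) →
                 (∀ {N′} (w : Fin N′ → Monomial n) → (∀ i → degree (w i) ℕ.≤ t) →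
                   PSD (λ i j → κ (w i ⊕ w j))) →
                 PSD (λ i j → r * r * κ (u i ⊕ u j) - r * μ (u j) * κ (u i)
                              - (r * μ (u i) * κ (u j) - μ (u i) * μ (u j) * κ 1ᴹ))
        centre κ u r u≤t psd = PSD-cong value
          (PSD-combine (λ a b → κ (a ⊕ b)) u (λ _ → 1ᴹ) r (λ i → - μ (u i))
            (psd _ (splitAt-elim (λ m → degree m ℕ.≤ t) u _ u≤t
              (λ _ → ℕ.≤-trans (ℕ.≤-reflexive (degree-1ᴹ n)) z≤n))))
          where
          value : ∀ i j → _
          value i j = R.trans
            (R.+-cong (R.+-congˡ (R.*-congˡ (R.reflexive (≡.cong κ (⊕-identityʳ (u i))))))
              (R.+-cong (R.*-congˡ (R.reflexive (≡.cong κ (⊕-identityˡ (u j)))))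
                (R.*-congˡ (R.reflexive (≡.cong κ (⊕-identityˡ 1ᴹ))))))
            (solve 7 (λ r x y a b c d →
               r :* r :* a :+ r :* :- y :* b :+ (r :* :- x :* c :+ :- x :* :- y :* d)
               := r :* r :* a :- r :* y :* b :- (r :* x :* c :- x :* y :* d))
               R.refl r (μ (u i)) (μ (u j)) (κ (u i ⊕ u j)) (κ (u i)) (κ (u j)) (κ 1ᴹ))

        K-psd : ∀ {N} (u : Fin N → Monomial n) → (∀ i → degree (u i) ℕ.≤ t) →
                PSD (λ i j → K (u i) (u j))
        K-psd u u≤t = PSD-cong value (centre μ u 1# u≤t λ w w≤t → μ-psd w λ i → 2*degree≤e (w i) (w≤t i))
          where
          value : ∀ i j → _
          value i j = R.trans
            (R.+-cong
              (R.+-cong (R.trans (R.*-congʳ (R.*-identityˡ 1#)) (R.*-identityˡ _))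
                (R.-‿cong (R.*-congʳ (R.*-identityˡ _))))
              (R.-‿cong (R.+-cong (R.*-congʳ (R.*-identityˡ _))
                (R.-‿cong (R.trans (R.*-congˡ μ-1) (R.*-identityʳ _))))))
            (solve 3 (λ m x y → m :- y :* x :- (x :* y :- x :* y) := m :- x :* y) R.refl
              (μ (u i ⊕ u j)) (μ (u i)) (μ (u j)))

        -- With s = E g this is  y (2g - s)² + 2 (1 - y) (g - s)² = 2 y g² + 2 (g - s)² - y s².
        single-color : ∀ {N} (u : Fin N → Monomial n) → (∀ i → degree (u i) ℕ.≤ t) →
          PSD (λ i j → two * μᵛ (u i ⊕ u j) - p * (μ (u i) * μ (u j)) + two * K (u i) (u j))
        single-color u u≤t = PSD-cong value (PSD-+
          (centre μᵛ u two u≤t μᵛ-psd)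
          (PSD-*ˡ (0≤fromℕ 2) (centre (λ m → μ m - μᵛ m) u 1# u≤t 1-μᵛ-psd)))
          where
          value : ∀ i j → _
          value i j = R.trans (R.+-cong
            (R.+-congˡ (R.-‿cong (R.+-congˡ (R.-‿cong (R.*-congˡ μᵛ-1ˡ)))))
            (R.*-congˡ (R.+-cong
              (R.+-cong (R.trans (R.*-congʳ (R.*-identityˡ 1#)) (R.*-identityˡ _))
                (R.-‿cong (R.*-congʳ (R.*-identityˡ _))))
              (R.-‿cong (R.+-cong (R.*-congʳ (R.*-identityˡ _))
                (R.-‿cong (R.*-congˡ (R.+-cong (R.trans μ-1 (R.sym (R.+-identityʳ 1#))) (R.-‿cong μᵛ-1ˡ)))))))))
            (solve 7 (λ yij mij x y yi yj q →
              con (+ 2) :* con (+ 2) :* yij :- con (+ 2) :* y :* yi :- (con (+ 2) :* x :* yj :- x :* y :* q)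
              :+ con (+ 2) :* ((mij :- yij) :- y :* (x :- yi) :- (x :* (y :- yj) :- x :* y :* (con (+ 1) :- q)))
              := con (+ 2) :* yij :- q :* (x :* y) :+ con (+ 2) :* (mij :- x :* y))
              R.refl (μᵛ (u i ⊕ u j)) (μ (u i ⊕ u j)) (μ (u i)) (μ (u j)) (μᵛ (u i)) (μᵛ (u j)) p)

      -- This is p (k - t) - 2 t with the terms in t collected. Every color brings p, and every unit
      -- of degree may pay for one covariance factor, which forfeits that p and costs 2 more.
      β : ℕ → ℕ → Carrier
      β k t = p * fromℕ k - (two + p) * fromℕ t

      -- Semidefiniteness of `X (β k t)` is the covering inequality 2 E[(Σ_c y_c) f²] ≥ β E[f²].
      X : ∀ {k} → Carrier → Colored n k → Carrier
      X b w = two * T w - b * Ψ w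

      X-congᵝ : ∀ {k b b′} (w : Colored n k) → b ≈ b′ → X b w ≈ X b′ w
      X-congᵝ w b≈b′ = R.+-congˡ (R.-‿cong (R.*-congʳ b≈b′))

      X-cong : ∀ {k} b {u w : Colored n k} → (∀ c → u c ≡ w c) → X b u ≈ X b w
      X-cong b u≡w = R.+-cong (R.*-congˡ (T-cong u≡w)) (R.-‿cong (R.*-congˡ (Ψ-cong u≡w)))

      β-sucˡ : ∀ k t → β (suc k) t ≈ β k t + p
      β-sucˡ k t = R.trans (R.+-congʳ (R.*-congˡ (fromℕ-suc k)))
        (solve 3 (λ q k t → q :* (con (+ 1) :+ k) :- (con (+ 2) :+ q) :* t
                            := q :* k :- (con (+ 2) :+ q) :* t :+ q) R.refl p (fromℕ k) (fromℕ t))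

      β-suc : ∀ k t → β (suc k) (suc t) + two ≈ β k t
      β-suc k t = R.trans
        (R.+-congʳ (R.+-cong (R.*-congˡ (fromℕ-suc k)) (R.-‿cong (R.*-congˡ (fromℕ-suc t)))))
        (solve 3 (λ q k t → q :* (con (+ 1) :+ k) :- (con (+ 2) :+ q) :* (con (+ 1) :+ t) :+ con (+ 2)
                            := q :* k :- (con (+ 2) :+ q) :* t) R.refl p (fromℕ k) (fromℕ t))

      -- A row whose first color is constant may spend all of its degree on the other colors, one
      -- unit more than the induction hypothesis with a smaller budget permits. Its covariances
      -- vanish, so its tail can be replaced by 1 without changing any product with `K`.
      reset : ∀ {k} → ℕ → Colored n k → Colored n k
      reset zero    w = λ _ → 1ᴹ
      reset (suc _) w = w

      total-reset : ∀ {k} (w : Colored n k) s t → s ℕ.+ total w ℕ.≤ suc t → total (reset s w) ℕ.≤ t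
      total-reset {k} w zero    t _       = ℕ.≤-trans (ℕ.≤-reflexive (total-1 n k)) z≤n
      total-reset     w (suc s) t (s≤s p) = ℕ.≤-trans (ℕ.m≤n+m _ s) p

      K-reset : ∀ {k} a b (f : Colored n k → Carrier) w w′ s s′ → degree a ≡ s → degree b ≡ s′ →
                K a b * f (reset s w ⊕ᶜ reset s′ w′) ≈ K a b * f (w ⊕ᶜ w′)
      K-reset a b f w w′ (suc s) (suc s′) a≡ b≡ = R.refl
      K-reset a b f w w′ zero    s′       a≡ b≡ = zero-*-cong (K-1ˡ {a} {b} a≡)
      K-reset a b f w w′ (suc s) zero     a≡ b≡ =
        zero-*-cong (R.trans (K-symmetric a b) (K-1ˡ {b} {a} b≡))

      -- K vanishes on constants, so a color whose K-factor is selected uses up one unit of degree.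
      covering-psd : 0# ≤ p → ∀ k t → 2 ℕ.* t ℕ.+ 2 ℕ.≤ e → ∀ {N} (u : Fin N → Colored n k) →
                     (∀ i → total (u i) ℕ.≤ t) → PSD (λ i j → X (β k t) (u i ⊕ᶜ u j))
      -- Without colors the sum `T` is 0, and - β = (2 + p) t is nonnegative.
      covering-psd 0≤p zero t 2t+2≤e u u≤t = PSD-cong
        (λ i j → value) (PSD-*ˡ (0≤* (0≤+ (0≤fromℕ 2) 0≤p) (0≤fromℕ t)) PSD-1)
        where
        value : (two + p) * fromℕ t * 1# ≈ two * 0# - β 0 t * 1#
        value = R.trans (R.*-identityʳ _) (R.trans
          (solve 2 (λ q t → (con (+ 2) :+ q) :* t
                          := con (+ 2) :* con (+ 0) :- (q :* con (+ 0) :- (con (+ 2) :+ q) :* t))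
            R.refl p (fromℕ t))
          (R.+-congˡ (R.-‿cong (R.sym (R.*-identityʳ _)))))
      -- The moment matrix of the first color is the rank-one part plus `K`. The one-color bound has
      -- the defect 2 K, which is charged to the covariance part. There the tails have one unit of
      -- degree less, and `β-suc` says that this pays exactly for the defect and for the lost p.
      covering-psd 0≤p (suc k) t 2t+2≤e {N} u u≤t = PSD-cong value
        (PSD-+ (PSD-+ head-part mean-part) (covariance-part t 2t+2≤e tail≤t))
        where
        m : Fin N → Monomial n
        m i = u i zero
        w : Fin N → Colored n k
        w i = u i ∘ suc
        m≤t : ∀ i → degree (m i) ℕ.≤ t
        m≤t i = ℕ.≤-trans (ℕ.m≤m+n _ _) (u≤t i)
        tail≤t : ∀ i → degree (m i) ℕ.+ total (w i) ℕ.≤ t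
        tail≤t = u≤t
        w≤t : ∀ i → total (w i) ℕ.≤ t
        w≤t i = ℕ.≤-trans (ℕ.m≤n+m _ (degree (m i))) (u≤t i)

        head-matrix : Matrix N
        head-matrix i j = two * μᵛ (m i ⊕ m j) - p * (μ (m i) * μ (m j)) + two * K (m i) (m j)

        head-part : PSD (λ i j → head-matrix i j * Ψ (w i ⊕ᶜ w j))
        head-part = schur-product
          (λ i j → R.+-cong (R.+-cong (R.*-congˡ (R.reflexive (≡.cong μᵛ (⊕-comm (m i) (m j)))))
             (R.-‿cong (R.*-congˡ (R.*-comm _ _)))) (R.*-congˡ (K-symmetric (m i) (m j))))
          (Ψ-symmetric w)
          (single-color {t} 2t+2≤e m m≤t)
          (Ψ-psd w λ i c → 2*degree≤e {t} 2t+2≤e (w i c) (ℕ.≤-trans (degree≤total (w i) c) (w≤t i)))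

        mean-part : PSD (λ i j → μ (m i) * μ (m j) * X (β k t) (w i ⊕ᶜ w j))
        mean-part = PSD-congruence (λ i → μ (m i)) (covering-psd 0≤p k t 2t+2≤e w w≤t)

        covariance-part : ∀ t → 2 ℕ.* t ℕ.+ 2 ℕ.≤ e → (∀ i → degree (m i) ℕ.+ total (w i) ℕ.≤ t) →
                          PSD (λ i j → K (m i) (m j) * X (β (suc k) t + two) (w i ⊕ᶜ w j))
        -- With no degree left every first-color monomial is 1, so this part is the zero matrix.
        covariance-part zero _ ≤0 = PSD-cong
          (λ i j → R.trans (R.zeroˡ 1#) (R.sym (R.trans
            (R.*-congʳ (K-1ˡ {m i} {m j} (ℕ.n≤0⇒n≡0 (ℕ.≤-trans (ℕ.m≤m+n _ _) (≤0 i))))) (R.zeroˡ _))))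
          (PSD-*ˡ ≤-refl PSD-1)
        covariance-part (suc t) 2t+4≤e ≤1+t = PSD-cong
          (λ i j → R.trans
            (K-reset (m i) (m j) (X (β k t)) (w i) (w j) (degree (m i)) (degree (m j)) ≡.refl ≡.refl)
            (R.*-congˡ (X-congᵝ (w i ⊕ᶜ w j) (R.sym (β-suc k t)))))
          (schur-product
            (λ i j → K-symmetric (m i) (m j))
            (λ i j → X-cong (β k t) λ c → ⊕-comm (w′ i c) (w′ j c))
            (K-psd {suc t} 2t+4≤e m λ i → ℕ.≤-trans (ℕ.m≤m+n _ _) (≤1+t i))
            (covering-psd 0≤p k t bound w′ λ i → total-reset (w i) (degree (m i)) t (≤1+t i)))
          where
          w′ : Fin N → Colored n k
          w′ i = reset (degree (m i)) (w i)
          bound : 2 ℕ.* t ℕ.+ 2 ℕ.≤ e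
          bound = ℕ.≤-trans (ℕ.+-monoˡ-≤ 2 (ℕ.*-monoʳ-≤ 2 (ℕ.n≤1+n t))) 2t+4≤e

        value : ∀ i j →
          head-matrix i j * Ψ (w i ⊕ᶜ w j) + μ (m i) * μ (m j) * X (β k t) (w i ⊕ᶜ w j)
            + K (m i) (m j) * X (β (suc k) t + two) (w i ⊕ᶜ w j)
          ≈ X (β (suc k) t) (u i ⊕ᶜ u j)
        value i j = R.trans
          (R.+-congˡ (R.*-congˡ (X-congᵝ (w i ⊕ᶜ w j) (R.+-congʳ (β-sucˡ k t)))))
          (R.trans
            (solve 8 (λ Y M x y P S q b →
              (con (+ 2) :* Y :- q :* (x :* y) :+ con (+ 2) :* (M :- x :* y)) :* P
                :+ x :* y :* (con (+ 2) :* S :- b :* P)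
                :+ (M :- x :* y) :* (con (+ 2) :* S :- (b :+ q :+ con (+ 2)) :* P)
              := con (+ 2) :* (Y :* P :+ M :* S) :- (b :+ q) :* (M :* P)) R.refl
              (μᵛ (m i ⊕ m j)) (μ (m i ⊕ m j)) (μ (m i)) (μ (m j))
              (Ψ (w i ⊕ᶜ w j)) (T (w i ⊕ᶜ w j)) p (β k t))
            (X-congᵝ (u i ⊕ᶜ u j) (R.sym (β-sucˡ k t))))

-- Coefficient functions paired with moment functions

module Pairing {c ℓ₁ ℓ₂} (ℛ : RealField c ℓ₁ ℓ₂) where

  open RealField ℛ hiding (zero)
  open OrderedField ℛ
  open Schur ℛ
  open PseudoExpectations ℛ using (∑)
  open Solver using (solve; _:=_; con; _:+_; _:*_; _:-_; :-_)
  open import Relation.Binary.Reasoning.Setoid R.setoid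

  opaque
    sumᴸ : ∀ {a} {A : Set a} → List A → (A → Carrier) → Carrier
    sumᴸ = ∑

    ∑≈sumᴸ : ∀ {a} {A : Set a} (xs : List A) f → ∑ xs f ≈ sumᴸ xs f
    ∑≈sumᴸ xs f = R.refl

  module _ {a} {A : Set a} where
    opaque
      unfolding sumᴸ

      sumᴸ-[] : ∀ (f : A → Carrier) → sumᴸ [] f ≈ 0#
      sumᴸ-[] f = R.refl

      sumᴸ-∷ : ∀ x xs (f : A → Carrier) → sumᴸ (x ∷ xs) f ≈ f x + sumᴸ xs f
      sumᴸ-∷ x xs f = R.refl

      sumᴸ-cong : ∀ xs {f g : A → Carrier} → (∀ x → f x ≈ g x) → sumᴸ xs f ≈ sumᴸ xs g
      sumᴸ-cong []       f≈g = R.refl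
      sumᴸ-cong (x ∷ xs) f≈g = R.+-cong (f≈g x) (sumᴸ-cong xs f≈g)

      sumᴸ-0 : ∀ xs → sumᴸ xs (λ (_ : A) → 0#) ≈ 0#
      sumᴸ-0 []       = R.refl
      sumᴸ-0 (x ∷ xs) = R.trans (R.+-identityˡ _) (sumᴸ-0 xs)

      sumᴸ-+ : ∀ xs (f g : A → Carrier) → sumᴸ xs (λ x → f x + g x) ≈ sumᴸ xs f + sumᴸ xs g
      sumᴸ-+ []       f g = R.sym (R.+-identityˡ 0#)
      sumᴸ-+ (x ∷ xs) f g = R.trans (R.+-congˡ (sumᴸ-+ xs f g))
        (solve 4 (λ a b s t → a :+ b :+ (s :+ t) := a :+ s :+ (b :+ t)) R.refl (f x) (g x) _ _)

      sumᴸ-*ˡ : ∀ xs r (f : A → Carrier) → sumᴸ xs (λ x → r * f x) ≈ r * sumᴸ xs f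
      sumᴸ-*ˡ []       r f = R.sym (R.zeroʳ r)
      sumᴸ-*ˡ (x ∷ xs) r f = R.trans (R.+-congˡ (sumᴸ-*ˡ xs r f)) (R.sym (R.distribˡ r _ _))

      sumᴸ-++ : ∀ xs ys (f : A → Carrier) → sumᴸ (xs ++ ys) f ≈ sumᴸ xs f + sumᴸ ys f
      sumᴸ-++ []       ys f = R.sym (R.+-identityˡ _)
      sumᴸ-++ (x ∷ xs) ys f = R.trans (R.+-congˡ (sumᴸ-++ xs ys f)) (R.sym (R.+-assoc _ _ _))

      sumᴸ-map : ∀ {b} {B : Set b} xs (g : B → A) f → sumᴸ (List.map g xs) f ≈ sumᴸ xs (f ∘ g)
      sumᴸ-map []       g f = R.refl
      sumᴸ-map (x ∷ xs) g f = R.+-congˡ (sumᴸ-map xs g f)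

      sumᴸ-lookup : ∀ xs (f : A → Carrier) → sumᴸ xs f ≈ sum (λ i → f (List.lookup xs i))
      sumᴸ-lookup []       f = R.sym (sum-nil _)
      sumᴸ-lookup (x ∷ xs) f = R.trans (R.+-congˡ (sumᴸ-lookup xs f)) (R.sym (sum-suc _))

      sumᴸ-sum : ∀ {n} xs (f : A → Fin n → Carrier) →
                 sumᴸ xs (λ x → sum (f x)) ≈ sum (λ i → sumᴸ xs (λ x → f x i))
      sumᴸ-sum []       f = R.sym (sum-0 _)
      sumᴸ-sum (x ∷ xs) f = R.trans (R.+-congˡ (sumᴸ-sum xs f)) (R.sym (sum-+ _ _))

    sumᴸ-zero : ∀ xs {f : A → Carrier} → (∀ x → f x ≈ 0#) → sumᴸ xs f ≈ 0#
    sumᴸ-zero xs f≈0 = R.trans (sumᴸ-cong xs f≈0) (sumᴸ-0 xs)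

    sumᴸ-*ʳ : ∀ xs r (f : A → Carrier) → sumᴸ xs (λ x → f x * r) ≈ sumᴸ xs f * r
    sumᴸ-*ʳ xs r f = R.trans (sumᴸ-cong xs λ x → R.*-comm (f x) r)
      (R.trans (sumᴸ-*ˡ xs r f) (R.*-comm r _))

  module _ {a b} {A : Set a} {B : Set b} where

    sumᴸ-swap : ∀ xs ys (f : A → B → Carrier) →
                sumᴸ xs (λ x → sumᴸ ys (f x)) ≈ sumᴸ ys (λ y → sumᴸ xs (λ x → f x y))
    sumᴸ-swap []       ys f = R.trans (sumᴸ-[] _) (R.sym (sumᴸ-zero ys λ y → sumᴸ-[] _))
    sumᴸ-swap (x ∷ xs) ys f = R.trans (sumᴸ-∷ x xs _) (R.trans
      (R.+-congˡ (sumᴸ-swap xs ys f)) (R.trans (R.sym (sumᴸ-+ ys _ _))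
        (sumᴸ-cong ys λ y → R.sym (sumᴸ-∷ x xs _))))

    sumᴸ-concatMap : ∀ xs (g : A → List B) f →
                     sumᴸ (List.concatMap g xs) f ≈ sumᴸ xs (λ x → sumᴸ (g x) f)
    sumᴸ-concatMap []       g f = R.trans (sumᴸ-[] _) (R.sym (sumᴸ-[] _))
    sumᴸ-concatMap (x ∷ xs) g f = R.trans (sumᴸ-++ (g x) _ f)
      (R.trans (R.+-congˡ (sumᴸ-concatMap xs g f)) (R.sym (sumᴸ-∷ x xs _)))

    sumᴸ-cartesianProductWith : ∀ {c} {C : Set c} (g : A → B → C) xs ys f →
      sumᴸ (List.cartesianProductWith g xs ys) f ≈ sumᴸ xs (λ x → sumᴸ ys (λ y → f (g x y)))
    sumᴸ-cartesianProductWith g []       ys f = R.trans (sumᴸ-[] _) (R.sym (sumᴸ-[] _))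
    sumᴸ-cartesianProductWith g (x ∷ xs) ys f = R.trans (sumᴸ-++ (List.map (g x) ys) _ f)
      (R.trans (R.+-cong (sumᴸ-map ys (g x) f) (sumᴸ-cartesianProductWith g xs ys f))
        (R.sym (sumᴸ-∷ x xs _)))

  sumᴸ-upTo-suc : ∀ n f → sumᴸ (List.upTo (suc n)) f ≈ f 0 + sumᴸ (List.upTo n) (f ∘ suc)
  sumᴸ-upTo-suc n f = R.trans (sumᴸ-∷ 0 _ f) (R.+-congˡ (R.trans
    (R.reflexive (≡.cong (λ xs → sumᴸ xs f) (≡.sym (List.map-upTo suc n))))
    (sumᴸ-map (List.upTo n) suc f)))

  indicator : Bool → Carrier
  indicator b = if b then 1# else 0#

  indicator-∧ : ∀ a b → indicator (a ∧ b) ≈ indicator a * indicator b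
  indicator-∧ true  b = R.sym (R.*-identityˡ _)
  indicator-∧ false b = R.sym (R.zeroˡ _)

  δᴺ : ℕ → ℕ → Carrier
  δᴺ i j = indicator (does (i ℕ.≟ j))

  δ : ∀ {N} → Monomial N → Monomial N → Carrier
  δ a b = indicator (does (a ≟ᴹ b))

  δ-∷ : ∀ {N} x y (a b : Monomial N) → δ (x ∷ a) (y ∷ b) ≈ δᴺ x y * δ a b
  δ-∷ x y a b = indicator-∧ (does (x ℕ.≟ y)) (does (a ≟ᴹ b))

  δ-refl : ∀ {N} (a : Monomial N) → δ a a ≈ 1#
  δ-refl a = R.reflexive (≡.cong indicator (dec-true (a ≟ᴹ a) ≡.refl))

  δ-≢ : ∀ {N} (a b : Monomial N) → a ≢ b → δ a b ≈ 0#
  δ-≢ a b a≢b = R.reflexive (≡.cong indicator (dec-false (a ≟ᴹ b) a≢b))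

  δ-sym : ∀ {N} (a b : Monomial N) → δ a b ≈ δ b a
  δ-sym a b with a ≟ᴹ b
  ... | yes ≡.refl = R.sym (δ-refl a)
  ... | no  a≢b    = R.sym (δ-≢ b a (a≢b ∘ ≡.sym))

  δ-degree : ∀ {N} (a b : Monomial N) → degree a ℕ.< degree b → δ a b ≈ 0#
  δ-degree a b a<b = δ-≢ a b λ { ≡.refl → ℕ.<-irrefl ≡.refl a<b }

  upTo-δ : ∀ {p n} → p ℕ.< n → ∀ (F : ℕ → Carrier) → sumᴸ (List.upTo n) (λ j → δᴺ p j * F j) ≈ F p
  upTo-δ {zero}  {suc n} _ F = R.trans (sumᴸ-upTo-suc n _) (R.trans
    (R.+-cong (R.*-identityˡ _) (sumᴸ-zero (List.upTo n) λ j → R.zeroˡ _)) (R.+-identityʳ _))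
  upTo-δ {suc p} {suc n} (s≤s p<n) F = R.trans (sumᴸ-upTo-suc n _) (R.trans
    (R.+-cong (R.zeroˡ _) (upTo-δ p<n (F ∘ suc))) (R.+-identityˡ _))

  upTo-δ-outside : ∀ {p n} → n ℕ.≤ p → ∀ (F : ℕ → Carrier) → sumᴸ (List.upTo n) (λ j → δᴺ p j * F j) ≈ 0#
  upTo-δ-outside {p}     {zero}  _ F = sumᴸ-[] _
  upTo-δ-outside {suc p} {suc n} (s≤s n≤p) F = R.trans (sumᴸ-upTo-suc n _) (R.trans
    (R.+-cong (R.zeroˡ _) (upTo-δ-outside n≤p (F ∘ suc))) (R.+-identityˡ _))

  -- The reproducing property expresses that the enumeration contains every monomial of degree at
  -- most D exactly once.
  monomials-δ : ∀ {N} D (u : Monomial N) → degree u ℕ.≤ D → ∀ (F : Monomial N → Carrier) →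
                sumᴸ (monomials N D) (λ m → δ u m * F m) ≈ F u
  monomials-δ D []      _   F = R.trans (sumᴸ-∷ _ _ _) (R.trans
    (R.+-cong (R.*-identityˡ _) (sumᴸ-[] _)) (R.+-identityʳ _))
  monomials-δ {suc N} D (p ∷ u) u≤D F = begin
    sumᴸ (monomials (suc N) D) (λ m → δ (p ∷ u) m * F m)
      ≈⟨ sumᴸ-concatMap (List.upTo (suc D)) _ _ ⟩
    sumᴸ (List.upTo (suc D)) (λ e → sumᴸ (List.map (e ∷_) (monomials N (D ∸ e))) (λ m → δ (p ∷ u) m * F m))
      ≈⟨ sumᴸ-cong (List.upTo (suc D)) (λ e → R.trans (sumᴸ-map _ (e ∷_) _) (R.trans
           (sumᴸ-cong _ λ m → R.trans (R.*-congʳ (δ-∷ p e u m)) (R.*-assoc _ _ _)) (sumᴸ-*ˡ _ (δᴺ p e) _))) ⟩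
    sumᴸ (List.upTo (suc D)) (λ e → δᴺ p e * sumᴸ (monomials N (D ∸ e)) (λ m → δ u m * F (e ∷ m)))
      ≈⟨ upTo-δ (s≤s (ℕ.≤-trans (ℕ.m≤m+n p _) u≤D)) _ ⟩
    sumᴸ (monomials N (D ∸ p)) (λ m → δ u m * F (p ∷ m))
      ≈⟨ monomials-δ (D ∸ p) u (ℕ.m+n≤o⇒m≤o∸n _ (ℕ.≤-trans (ℕ.≤-reflexive (ℕ.+-comm _ p)) u≤D))
           (λ m → F (p ∷ m)) ⟩
    F (p ∷ u) ∎

  upTo-δ-÷ : ∀ p q x → sumᴸ (List.upTo (suc x)) (λ j → δᴺ p j * δᴺ q (x ∸ j)) ≈ δᴺ (p ℕ.+ q) x
  upTo-δ-÷ p q x = [ inside , outside ]′ (ℕ.≤-<-connex p x)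
    where
    shift : ∀ p x → p ℕ.≤ x → δᴺ q (x ∸ p) ≡ δᴺ (p ℕ.+ q) x
    shift zero    x       _         = ≡.refl
    shift (suc p) (suc x) (s≤s p≤x) = shift p x p≤x
    inside : p ℕ.≤ x → _
    inside p≤x = R.trans (upTo-δ (s≤s p≤x) (λ j → δᴺ q (x ∸ j))) (R.reflexive (shift p x p≤x))
    outside : x ℕ.< p → _
    outside x<p = R.trans (upTo-δ-outside x<p (λ j → δᴺ q (x ∸ j)))
      (R.reflexive (≡.cong indicator (≡.sym (dec-false (p ℕ.+ q ℕ.≟ x)
        λ p+q≡x → ℕ.<⇒≱ x<p (ℕ.≤-trans (ℕ.m≤m+n p q) (ℕ.≤-reflexive p+q≡x))))))

  -- Point masses convolve to a point mass: this is the product of two monomials, coefficient by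
  -- coefficient. The sum over divisors factors over the variables.
  divisors-δ : ∀ {N} (m u v : Monomial N) →
               sumᴸ (divisors m) (λ a → δ u a * δ v (m ÷ᴹ a)) ≈ δ (u ⊕ v) m
  divisors-δ []      []      []      = R.trans (sumᴸ-∷ _ _ _) (R.trans
    (R.+-cong (R.*-identityˡ _) (sumᴸ-[] _)) (R.+-identityʳ _))
  divisors-δ (x ∷ m) (p ∷ u) (q ∷ v) = begin
    sumᴸ (divisors (x ∷ m)) (λ a → δ (p ∷ u) a * δ (q ∷ v) ((x ∷ m) ÷ᴹ a))
      ≈⟨ sumᴸ-cartesianProductWith _∷_ (List.upTo (suc x)) (divisors m) _ ⟩
    sumᴸ (List.upTo (suc x)) (λ j → sumᴸ (divisors m) (λ a →
      δ (p ∷ u) (j ∷ a) * δ (q ∷ v) ((x ∸ j) ∷ (m ÷ᴹ a))))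
      ≈⟨ sumᴸ-cong (List.upTo (suc x)) (λ j → R.trans
           (sumᴸ-cong (divisors m) λ a → R.trans
             (R.*-cong (δ-∷ p j u a) (δ-∷ q (x ∸ j) v (m ÷ᴹ a)))
             (solve 4 (λ a b c d → a :* b :* (c :* d) := a :* c :* (b :* d)) R.refl _ _ _ _))
           (R.trans (sumᴸ-*ˡ (divisors m) _ _) (R.*-congˡ (divisors-δ m u v)))) ⟩
    sumᴸ (List.upTo (suc x)) (λ j → δᴺ p j * δᴺ q (x ∸ j) * δ (u ⊕ v) m)
      ≈⟨ sumᴸ-*ʳ (List.upTo (suc x)) _ _ ⟩
    sumᴸ (List.upTo (suc x)) (λ j → δᴺ p j * δᴺ q (x ∸ j)) * δ (u ⊕ v) m
      ≈⟨ R.*-congʳ (upTo-δ-÷ p q x) ⟩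
    δᴺ (p ℕ.+ q) x * δ (u ⊕ v) m
      ≈⟨ δ-∷ (p ℕ.+ q) x (u ⊕ v) m ⟨
    δ ((p ∷ u) ⊕ (q ∷ v)) (x ∷ m) ∎

  Coefficients : ℕ → Set c
  Coefficients N = Monomial N → Carrier

  Bounded : ∀ {N} → ℕ → Coefficients N → Set ℓ₁
  Bounded D f = ∀ m → D ℕ.< degree m → f m ≈ 0#

  -- The linear functional with moments F, evaluated at f and cut off at degree B.
  pairing : ∀ {N} → ℕ → Coefficients N → Coefficients N → Carrier
  pairing {N} B f F = sumᴸ (monomials N B) λ m → f m * F m

  module _ {N : ℕ} where

    pairing-congˡ : ∀ B {f g F : Coefficients N} → (∀ m → f m ≈ g m) → pairing B f F ≈ pairing B g F
    pairing-congˡ B f≈g = sumᴸ-cong (monomials N B) λ m → R.*-congʳ (f≈g m)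

    pairing-congʳ : ∀ B {f F F′ : Coefficients N} → (∀ m → F m ≈ F′ m) → pairing B f F ≈ pairing B f F′
    pairing-congʳ B F≈F′ = sumᴸ-cong (monomials N B) λ m → R.*-congˡ (F≈F′ m)

    pairing-+ : ∀ B (f g F : Coefficients N) →
                pairing B (λ m → f m + g m) F ≈ pairing B f F + pairing B g F
    pairing-+ B f g F = R.trans (sumᴸ-cong (monomials N B) λ m → R.distribʳ (F m) (f m) (g m))
      (sumᴸ-+ (monomials N B) _ _)

    pairing-*ˡ : ∀ B r (f F : Coefficients N) → pairing B (λ m → r * f m) F ≈ r * pairing B f F
    pairing-*ˡ B r f F = R.trans (sumᴸ-cong (monomials N B) λ m → R.*-assoc r (f m) (F m))
      (sumᴸ-*ˡ (monomials N B) r _)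

    pairing-neg : ∀ B (f F : Coefficients N) → pairing B (λ m → - f m) F ≈ - pairing B f F
    pairing-neg B f F = R.trans
      (pairing-congˡ B λ m → solve 1 (λ x → :- x := :- con (+ 1) :* x) R.refl (f m))
      (R.trans (pairing-*ˡ B _ f F) (solve 1 (λ x → :- con (+ 1) :* x := :- x) R.refl (pairing B f F)))

    pairing-sum : ∀ {k} B (f : Fin k → Coefficients N) F →
                  pairing B (λ m → sum λ i → f i m) F ≈ sum λ i → pairing B (f i) F
    pairing-sum B f F = R.trans
      (sumᴸ-cong (monomials N B) λ m → R.sym (sum-*ʳ (F m) (λ i → f i m)))
      (sumᴸ-sum (monomials N B) λ m i → f i m * F m)

    pairing-δ : ∀ {B} (u : Monomial N) F → degree u ℕ.≤ B → pairing B (λ m → δ m u) F ≈ F u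
    pairing-δ {B} u F u≤B = R.trans (pairing-congˡ B λ m → δ-sym m u) (monomials-δ B u u≤B F)

    pairing-vanishing : ∀ B {f F : Coefficients N} → (∀ m → f m ≈ 0# ⊎ F m ≈ 0#) → pairing B f F ≈ 0#
    pairing-vanishing B zeros = sumᴸ-zero (monomials N B) λ m →
      [ (λ f≈0 → R.trans (R.*-congʳ f≈0) (R.zeroˡ _))
      , (λ F≈0 → R.trans (R.*-congˡ F≈0) (R.zeroʳ _)) ]′ (zeros m)

    expansion : ∀ {D} {f : Coefficients N} → Bounded D f → ∀ a →
                f a ≈ pairing D f (λ u → δ u a)
    expansion {D} {f} bounded a = [ inside , outside ]′ (ℕ.≤-<-connex (degree a) D)
      where
      inside : degree a ℕ.≤ D → _
      inside a≤D = R.sym (R.trans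
        (sumᴸ-cong (monomials N D) λ u → R.trans (R.*-comm _ _) (R.*-congʳ (δ-sym u a)))
        (monomials-δ D a a≤D f))
      outside : D ℕ.< degree a → _
      outside D<a = R.trans (bounded a D<a) (R.sym (pairing-vanishing D λ u →
        Sum.swap (Sum.map (λ u≤D → δ-degree u a (ℕ.≤-<-trans u≤D D<a)) (bounded u) (ℕ.≤-<-connex (degree u) D))))

    -- Lets each computation choose its own cut-off. The enumerations for D and B are not compared
    -- directly: f is expanded into point masses and the two sums are exchanged.
    pairing-bound : ∀ {D B} {f : Coefficients N} → Bounded D f → D ℕ.≤ B → ∀ F →
                    pairing B f F ≈ pairing D f F
    pairing-bound {D} {B} {f} bounded D≤B F = begin
      pairing B f F
        ≈⟨ pairing-congˡ B (expansion bounded) ⟩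
      sumᴸ (monomials N B) (λ m → pairing D f (λ u → δ u m) * F m)
        ≈⟨ sumᴸ-cong (monomials N B) (λ m → R.trans (R.sym (sumᴸ-*ʳ (monomials N D) (F m) _))
             (sumᴸ-cong (monomials N D) λ u → R.*-assoc _ _ _)) ⟩
      sumᴸ (monomials N B) (λ m → sumᴸ (monomials N D) (λ u → f u * (δ u m * F m)))
        ≈⟨ sumᴸ-swap (monomials N B) (monomials N D) _ ⟩
      sumᴸ (monomials N D) (λ u → sumᴸ (monomials N B) (λ m → f u * (δ u m * F m)))
        ≈⟨ sumᴸ-cong (monomials N D) (λ u → R.trans (sumᴸ-*ˡ (monomials N B) (f u) _) (term u)) ⟩
      pairing D f F ∎
      where
      term : ∀ u → f u * sumᴸ (monomials N B) (λ m → δ u m * F m) ≈ f u * F u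
      term u = [ (λ u≤D → R.*-congˡ (monomials-δ B u (ℕ.≤-trans u≤D D≤B) F))
               , (λ D<u → zero-*-cong (bounded u D<u)) ]′
               (ℕ.≤-<-connex (degree u) D)

    infixl 7 _⋆_
    _⋆_ : Coefficients N → Coefficients N → Coefficients N
    (f ⋆ g) m = sumᴸ (divisors m) λ a → f a * g (m ÷ᴹ a)

    ⋆-expansion : ∀ {D E} {f g : Coefficients N} → Bounded D f → Bounded E g → ∀ m →
      (f ⋆ g) m ≈ pairing D f λ u → pairing E g λ v → δ (u ⊕ v) m
    ⋆-expansion {D} {E} {f} {g} f≤D g≤E m = begin
      sumᴸ (divisors m) (λ a → f a * g (m ÷ᴹ a))
        ≈⟨ sumᴸ-cong (divisors m) (λ a → R.*-cong (expansion f≤D a) (expansion g≤E (m ÷ᴹ a))) ⟩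
      sumᴸ (divisors m) (λ a → pairing D f (λ u → δ u a) * pairing E g (λ v → δ v (m ÷ᴹ a)))
        ≈⟨ sumᴸ-cong (divisors m) (λ a → R.trans (R.sym (sumᴸ-*ʳ (monomials N D) _ _))
             (sumᴸ-cong (monomials N D) λ u → R.trans (R.*-assoc _ _ _)
               (R.*-congˡ (R.trans (R.sym (sumᴸ-*ˡ (monomials N E) _ _))
                 (sumᴸ-cong (monomials N E) λ v →
                   solve 3 (λ x y z → x :* (y :* z) := y :* (x :* z)) R.refl _ _ _))))) ⟩
      sumᴸ (divisors m) (λ a → pairing D f (λ u → pairing E g (λ v → δ u a * δ v (m ÷ᴹ a))))
        ≈⟨ sumᴸ-swap (divisors m) (monomials N D) _ ⟩
      sumᴸ (monomials N D) (λ u → sumᴸ (divisors m) (λ a → f u * pairing E g (λ v → δ u a * δ v (m ÷ᴹ a))))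
        ≈⟨ sumᴸ-cong (monomials N D) (λ u → R.trans (sumᴸ-*ˡ (divisors m) _ _)
             (R.*-congˡ (R.trans (sumᴸ-swap (divisors m) (monomials N E) _)
               (sumᴸ-cong (monomials N E) λ v → R.trans (sumᴸ-*ˡ (divisors m) _ _)
                 (R.*-congˡ (divisors-δ m u v)))))) ⟩
      pairing D f (λ u → pairing E g λ v → δ (u ⊕ v) m) ∎

    -- The bridge from polynomials to moment matrices: the expectation of f g becomes a bilinear
    -- form with entries F (u ⊕ v).
    pairing-⋆ : ∀ {D E B} {f g : Coefficients N} → Bounded D f → Bounded E g → D ℕ.+ E ℕ.≤ B → ∀ F →
                pairing B (f ⋆ g) F ≈ pairing D f λ u → pairing E g λ v → F (u ⊕ v)
    pairing-⋆ {D} {E} {B} {f} {g} f≤D g≤E D+E≤B F = begin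
      pairing B (f ⋆ g) F
        ≈⟨ pairing-congˡ B (⋆-expansion f≤D g≤E) ⟩
      sumᴸ (monomials N B) (λ m → pairing D f (λ u → pairing E g (λ v → δ (u ⊕ v) m)) * F m)
        ≈⟨ sumᴸ-cong (monomials N B) (λ m → R.trans (R.sym (sumᴸ-*ʳ (monomials N D) _ _))
             (sumᴸ-cong (monomials N D) λ u → R.trans (R.*-assoc _ _ _)
               (R.*-congˡ (R.trans (R.sym (sumᴸ-*ʳ (monomials N E) _ _))
                 (sumᴸ-cong (monomials N E) λ v → R.*-assoc _ _ _))))) ⟩
      sumᴸ (monomials N B) (λ m → pairing D f (λ u → pairing E g (λ v → δ (u ⊕ v) m * F m)))
        ≈⟨ sumᴸ-swap (monomials N B) (monomials N D) _ ⟩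
      sumᴸ (monomials N D) (λ u → sumᴸ (monomials N B) (λ m → f u * pairing E g (λ v → δ (u ⊕ v) m * F m)))
        ≈⟨ sumᴸ-cong (monomials N D) (λ u → R.trans (sumᴸ-*ˡ (monomials N B) _ _)
             (R.trans (R.*-congˡ (sumᴸ-swap (monomials N B) (monomials N E) _))
               (R.trans (R.sym (sumᴸ-*ˡ (monomials N E) _ _))
                 (R.trans (sumᴸ-cong (monomials N E) λ v →
                    R.trans (R.*-congˡ (sumᴸ-*ˡ (monomials N B) _ _)) (term u v))
                  (sumᴸ-*ˡ (monomials N E) _ _))))) ⟩
      pairing D f (λ u → pairing E g λ v → F (u ⊕ v)) ∎
      where
      term : ∀ u v → f u * (g v * sumᴸ (monomials N B) (λ m → δ (u ⊕ v) m * F m)) ≈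
                     f u * (g v * F (u ⊕ v))
      term u v with ℕ.≤-<-connex (degree u) D | ℕ.≤-<-connex (degree v) E
      ... | inj₂ D<u | _        = zero-*-cong (f≤D u D<u)
      ... | inj₁ _   | inj₂ E<v = R.*-congˡ (zero-*-cong (g≤E v E<v))
      ... | inj₁ u≤D | inj₁ v≤E = R.*-congˡ (R.*-congˡ (monomials-δ B (u ⊕ v)
              (ℕ.≤-trans (ℕ.≤-reflexive (degree-⊕ u v)) (ℕ.≤-trans (ℕ.+-mono-≤ u≤D v≤E) D+E≤B)) F))

    -- The retraction replaces the monomials outside the support of f.
    pairing-psd : ∀ {D} {f : Coefficients N} (κ : Monomial N → Monomial N → Carrier)
      (r : Monomial N → Monomial N) → (∀ m → f m ≈ 0# ⊎ r m ≡ m) →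
      (∀ {k} (u : Fin k → Monomial N) → PSD (λ i j → κ (r (u i)) (r (u j)))) →
      0# ≤ pairing D f λ u → pairing D f λ v → κ u v
    pairing-psd {D} {f} κ r supported psd = ≤-respʳ (R.sym value) (psd u (λ i → f (u i)))
      where
      u : Fin _ → Monomial N
      u = List.lookup (monomials N D)
      vanish : ∀ {x y k k′} → x ≈ 0# → x * y * k ≈ x * y * k′
      vanish x≈0 = zero-*-cong (R.trans (R.*-congʳ x≈0) (R.zeroˡ _))
      retract : ∀ x y → f x ≈ 0# ⊎ r x ≡ x → f y ≈ 0# ⊎ r y ≡ y →
                f x * f y * κ x y ≈ f x * f y * κ (r x) (r y)
      retract x y (inj₁ f≈0) _          = vanish f≈0
      retract x y (inj₂ _)   (inj₁ f≈0) = R.trans (R.*-congʳ (R.*-comm _ _))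
        (R.trans (vanish f≈0) (R.*-congʳ (R.*-comm _ _)))
      retract x y (inj₂ rx)  (inj₂ ry)  = R.reflexive (≡.sym (≡.cong₂ (λ a b → f x * f y * κ a b) rx ry))
      value : (pairing D f λ u → pairing D f λ v → κ u v) ≈ form (λ i j → κ (r (u i)) (r (u j))) (λ i → f (u i))
      value = R.trans (sumᴸ-lookup (monomials N D) _) (sum-cong λ i → R.trans
        (R.*-congˡ (sumᴸ-lookup (monomials N D) _))
        (R.trans (R.sym (sum-*ˡ _ _)) (sum-cong λ j → R.trans (R.sym (R.*-assoc _ _ _))
          (retract (u i) (u j) (supported (u i)) (supported (u j))))))

-- Rational degree bounds translated to natural numbers

module _ where

  open ℤ.+-*-Solver using (solve; _:=_; con; _:+_; _:*_)

  ≤-from-+ : ∀ {i j} k → j ≡ i ℤ.+ + k → i ℤ.≤ j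
  ≤-from-+ {i} k ≡.refl = ℤ.i≤i+j i (+ k)

  2*a≤d⇒a≤d/2 : ∀ a d → 2 ℕ.* a ℕ.≤ d → toℚ a ℚ.≤ toℚ d /2
  2*a≤d⇒a≤d/2 a d 2a≤d with ℕ.m≤n⇒∃[o]m+o≡n 2a≤d
  -- The equation concerns the cross-multiplied numerators to which the unnormalised fractions
  -- reduce. The integer identities in the next lemmas have the same origin.
  ... | k , ≡.refl = *≤* (≤-from-+ k (solve 2 (λ a k →
          (a :+ (a :+ con (+ 0)) :+ k) :* con (+ 1) :* con (+ 1) := a :* con (+ 2) :+ k) ≡.refl (+ a) (+ k)))

  a+2≤d⇒a≤d-2 : ∀ a d → a ℕ.+ 2 ℕ.≤ d → toℚ a ℚ.≤ toℚ d ℚ.- toℚ 2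
  a+2≤d⇒a≤d-2 a d a+2≤d with ℕ.m≤n⇒∃[o]m+o≡n a+2≤d
  ... | k , ≡.refl = *≤* (≤-from-+ k (solve 2 (λ a k →
          ((a :+ con (+ 2) :+ k) :* con (+ 1) :+ con -[1+ 1 ] :* con (+ 1)) :* con (+ 1)
          := a :* con (+ 1) :+ k) ≡.refl (+ a) (+ k)))

  a≤[1+d/2]/2⇒4*a≤d+2 : ∀ a d → toℚ a ℚ.≤ (1ℚᵘ ℚ.+ toℚ d /2) /2 → 4 ℕ.* a ℕ.≤ d ℕ.+ 2
  a≤[1+d/2]/2⇒4*a≤d+2 a d (*≤* p) = ℤ.drop‿+≤+ (≡.subst₂ ℤ._≤_
    (solve 1 (λ a → a :* con (+ 4) := a :+ (a :+ (a :+ (a :+ con (+ 0))))) ≡.refl (+ a))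
    (solve 1 (λ d → (con (+ 1) :* con (+ 2) :+ (d :* con (+ 1)) :* con (+ 1)) :* con (+ 1) :* con (+ 1)
                    := d :+ con (+ 2)) ≡.refl (+ d)) p)

  a≤[1+d/2]-2⇒2*a+2≤d : ∀ a d → toℚ a ℚ.≤ (1ℚᵘ ℚ.+ toℚ d /2) ℚ.- toℚ 2 → 2 ℕ.* a ℕ.+ 2 ℕ.≤ d
  a≤[1+d/2]-2⇒2*a+2≤d a d (*≤* p) = ℤ.drop‿+≤+ (≡.subst₂ ℤ._≤_
    (solve 1 (λ a → a :* con (+ 2) :+ con (+ 2) := a :+ (a :+ con (+ 0)) :+ con (+ 2)) ≡.refl (+ a))
    (solve 1 (λ d → ((con (+ 1) :* con (+ 2) :+ (d :* con (+ 1)) :* con (+ 1)) :* con (+ 1)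
                      :+ con -[1+ 1 ] :* con (+ 2)) :* con (+ 1) :+ con (+ 2)
                    := d) ≡.refl (+ d)) (ℤ.+-monoˡ-≤ (+ 2) p))

  a≤[[1+d/2]-1]/2⇒4*a≤d : ∀ a d → toℚ a ℚ.≤ ((1ℚᵘ ℚ.+ toℚ d /2) ℚ.- 1ℚᵘ) /2 → 4 ℕ.* a ℕ.≤ d
  a≤[[1+d/2]-1]/2⇒4*a≤d a d (*≤* p) = ℤ.drop‿+≤+ (≡.subst₂ ℤ._≤_
    (solve 1 (λ a → a :* con (+ 4) := a :+ (a :+ (a :+ (a :+ con (+ 0))))) ≡.refl (+ a))
    (solve 1 (λ d → ((con (+ 1) :* con (+ 2) :+ (d :* con (+ 1)) :* con (+ 1)) :* con (+ 1)
                      :+ con -[1+ 0 ] :* con (+ 2)) :* con (+ 1) :* con (+ 1)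
                    := d) ≡.refl (+ d)) p)

  a≤1+d/2⇒2*a≤d+2 : ∀ a d → toℚ a ℚ.≤ 1ℚᵘ ℚ.+ toℚ d /2 → 2 ℕ.* a ℕ.≤ d ℕ.+ 2
  a≤1+d/2⇒2*a≤d+2 a d (*≤* p) = ℤ.drop‿+≤+ (≡.subst₂ ℤ._≤_
    (solve 1 (λ a → a :* con (+ 2) := a :+ (a :+ con (+ 0))) ≡.refl (+ a))
    (solve 1 (λ d → (con (+ 1) :* con (+ 2) :+ (d :* con (+ 1)) :* con (+ 1)) :* con (+ 1)
                    := d :+ con (+ 2)) ≡.refl (+ d)) p)

toℚ-cancel-≤ : ∀ {m n} → toℚ m ℚ.≤ toℚ n → m ℕ.≤ n
toℚ-cancel-≤ {m} {n} (*≤* p) = ℤ.drop‿+≤+ (≡.subst₂ ℤ._≤_ (ℤ.*-identityʳ (+ m)) (ℤ.*-identityʳ (+ n)) p)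

-- Moments of an independent set pseudo-expectation

module PolynomialPairing {c ℓ₁ ℓ₂} (ℛ : RealField c ℓ₁ ℓ₂) where

  open RealField ℛ hiding (zero)
  open OrderedField ℛ
  open Schur ℛ
  open PseudoExpectations ℛ
  open ColorProduct ℛ using (Moments)
  open Pairing ℛ
  open Solver using (solve; _:=_; _:+_; _:-_)
  open import Relation.Binary.Reasoning.Setoid R.setoid

  support : ∀ {N q} (f : Poly≤ N q) m → coeff f m ≈ 0# ⊎ toℚ (degree m) ℚ.≤ q
  support {q = q} f m with q ℚ.<? toℚ (degree m)
  ... | yes q<m = inj₁ (bounded f m q<m)
  ... | no  q≮m = inj₂ (ℚ.≮⇒≥ q≮m)

  poly-Bounded : ∀ {N q D} (f : Poly≤ N q) → (∀ a → toℚ a ℚ.≤ q → a ℕ.≤ D) → Bounded D (coeff f)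
  poly-Bounded f q≤D m D<m =
    [ id , (λ m≤q → ⊥-elim (ℕ.<⇒≱ D<m (q≤D (degree m) m≤q))) ]′ (support f m)

  poly-Boundedᴺ : ∀ {N D} (f : Poly≤ N (toℚ D)) → Bounded D (coeff f)
  poly-Boundedᴺ f = poly-Bounded f λ _ → toℚ-cancel-≤

  pairing-· : ∀ {N q r D E B} (f : Poly≤ N q) (g : Poly≤ N r) → Bounded D (coeff f) → Bounded E (coeff g) →
              D ℕ.+ E ℕ.≤ B → ∀ F →
              pairing B (coeff (f · g)) F ≈ pairing D (coeff f) λ u → pairing E (coeff g) λ v → F (u ⊕ v)
  pairing-· {B = B} f g f≤D g≤E D+E≤B F =
    R.trans (pairing-congˡ B λ m → ∑≈sumᴸ (divisors m) _) (pairing-⋆ f≤D g≤E D+E≤B F)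

  ·-Bounded : ∀ {N q r D E} (f : Poly≤ N q) (g : Poly≤ N r) → Bounded D (coeff f) → Bounded E (coeff g) →
              Bounded (D ℕ.+ E) (coeff (f · g))
  ·-Bounded {D = D} {E} f g f≤D g≤E m D+E<m = R.trans (∑≈sumᴸ (divisors m) _) (R.trans
    (⋆-expansion f≤D g≤E m) (pairing-vanishing D λ u → Sum.swap (Sum.map
      (λ u≤D → pairing-vanishing E λ v → Sum.swap (Sum.map
        (λ v≤E → δ-degree (u ⊕ v) m (ℕ.≤-<-trans
          (ℕ.≤-trans (ℕ.≤-reflexive (degree-⊕ u v)) (ℕ.+-mono-≤ u≤D v≤E)) D+E<m))
        (g≤E v) (ℕ.≤-<-connex (degree v) E)))
      (f≤D u) (ℕ.≤-<-connex (degree u) D))))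

  pairing-1ₚ : ∀ {N} B (F : Coefficients N) → pairing B (coeff {N} 1ₚ) F ≈ F 1ᴹ
  pairing-1ₚ {N} B F = pairing-δ 1ᴹ F (ℕ.≤-trans (ℕ.≤-reflexive (degree-1ᴹ N)) z≤n)

  pairing-x : ∀ {N B} (i : Fin N) (F : Coefficients N) → 1 ℕ.≤ B → pairing B (coeff (x i)) F ≈ F (varᴹ i)
  pairing-x i F 1≤B = pairing-δ (varᴹ i) F (ℕ.≤-trans (ℕ.≤-reflexive (degree-varᴹ i)) 1≤B)

  pairing-xx : ∀ {N} (i j : Fin N) (F : Coefficients N) →
               pairing 2 (coeff (x i · x j)) F ≈ F (varᴹ i ⊕ varᴹ j)
  pairing-xx i j F = R.trans
    (pairing-· (x i) (x j) (poly-Boundedᴺ (x i)) (poly-Boundedᴺ (x j)) ℕ.≤-refl F)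
    (R.trans (pairing-x i (λ u → pairing 1 (coeff (x j)) (λ v → F (u ⊕ v))) ℕ.≤-refl)
      (pairing-x j (λ v → F (varᴹ i ⊕ v)) ℕ.≤-refl))

  pairing-x²-x : ∀ {N} (i : Fin N) (F : Coefficients N) →
                 pairing 2 (coeff (x²-x i)) F ≈ F (varᴹ i ⊕ varᴹ i) - F (varᴹ i)
  pairing-x²-x i F = R.trans (pairing-+ 2 (coeff (x i · x i)) (λ m → - coeff (x i) m) F)
    (R.+-cong (pairing-xx i i F) (R.trans (pairing-neg 2 (coeff (x i)) F) (R.-‿cong (pairing-x i F (s≤s z≤n)))))

  module LinearFunctional {N d} (𝔼 : Poly≤ N (toℚ d) → Carrier) (linear : IsLinear 𝔼) where

    open LeftModuleMorphisms.IsLeftModuleHomomorphism linear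

    polySum : ∀ {a} {A : Set a} → List A → (A → Poly≤ N (toℚ d)) → Poly≤ N (toℚ d)
    polySum []       f = 0ᴹ
    polySum (x ∷ xs) f = f x +ᴹ polySum xs f

    coeff-polySum : ∀ {a} {A : Set a} (xs : List A) f m →
                    coeff (polySum xs f) m ≈ sumᴸ xs (λ x → coeff (f x) m)
    coeff-polySum []       f m = R.sym (sumᴸ-[] _)
    coeff-polySum (x ∷ xs) f m = R.trans (R.+-congˡ (coeff-polySum xs f m)) (R.sym (sumᴸ-∷ x xs _))

    𝔼-polySum : ∀ {a} {A : Set a} (xs : List A) f → 𝔼 (polySum xs f) ≈ sumᴸ xs (𝔼 ∘ f)
    𝔼-polySum []       f = R.trans 0ᴹ-homo (R.sym (sumᴸ-[] _))
    𝔼-polySum (x ∷ xs) f = R.trans (+ᴹ-homo (f x) (polySum xs f))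
      (R.trans (R.+-congˡ (𝔼-polySum xs f)) (R.sym (sumᴸ-∷ x xs _)))

    -- Beyond degree d the moment becomes 𝔼 0 = 0, a default that is always multiplied by a
    -- vanishing coefficient when 𝔼 is evaluated. The decision is an argument so that proofs can
    -- split on it.
    truncated : (m : Monomial N) → Dec (degree m ℕ.≤ d) → Poly≤ N (toℚ d)
    truncated m (yes m≤d) = weaken (toℚ-mono m≤d) (monomial m)
    truncated m (no  _)   = 0ᴹ

    moment : Monomial N → Carrier
    moment m = 𝔼 (truncated m (degree m ℕ.≤? d))

    moment-expansion : ∀ f → f ≈ᴹ polySum (monomials N d) λ u → coeff f u *ₗ truncated u (degree u ℕ.≤? d)
    moment-expansion f m = R.trans (expansion (poly-Boundedᴺ f) m) (R.sym (R.trans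
      (coeff-polySum (monomials N d) _ m) (sumᴸ-cong (monomials N d) λ u → term u (degree u ℕ.≤? d))))
      where
      term : ∀ u dec → coeff f u * coeff (truncated u dec) m ≈ coeff f u * δ u m
      term u (yes _)   = R.*-congˡ (δ-sym m u)
      term u (no  u≰d) = R.trans (R.zeroʳ _)
        (R.sym (R.trans (R.*-congʳ (poly-Boundedᴺ f u (ℕ.≰⇒> u≰d))) (R.zeroˡ _)))

    -- A polynomial is a finite combination of monomials, so linearity determines 𝔼 from its
    -- moments. The two sides of that combination agree only coefficientwise, which is enough
    -- because 𝔼 respects `≈ᴹ`.
    𝔼-pairing : ∀ f {B} → d ℕ.≤ B → 𝔼 f ≈ pairing B (coeff f) moment
    𝔼-pairing f d≤B = R.trans (⟦⟧-cong (moment-expansion f)) (R.trans (𝔼-polySum (monomials N d) _)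
      (R.trans (sumᴸ-cong (monomials N d) λ u → *ₗ-homo (coeff f u) _)
        (R.sym (pairing-bound (poly-Boundedᴺ f) d≤B moment))))

    𝔼-· : ∀ {q r D E} (f : Poly≤ N q) (g : Poly≤ N r) (q+r≤d : q ℚ.+ r ℚ.≤ toℚ d) →
          Bounded D (coeff f) → Bounded E (coeff g) →
          𝔼 (weaken q+r≤d (f · g)) ≈ pairing D (coeff f) λ u → pairing E (coeff g) λ v → moment (u ⊕ v)
    𝔼-· {D = D} {E} f g q+r≤d f≤D g≤E = R.trans
      (𝔼-pairing (weaken q+r≤d (f · g)) (ℕ.m≤m+n d (D ℕ.+ E)))
      (pairing-· f g f≤D g≤E (ℕ.m≤n+m (D ℕ.+ E) d) moment)

  module FromIndependentSetPE {n} {G : Graph n} {d} .{{_ : NonZero d}} (Ẽ : IndependentSetPE G (toℚ d)) where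

    open IndependentSetPE Ẽ
    open LinearFunctional 𝔼 linear public

    -- The polynomial Σ a_i u_i. Coefficients of repeated monomials add up, so the u_i may coincide,
    -- as they do for the constant family in `centre`.
    combination : ∀ {k} (u : Fin k → Monomial n) → (∀ i → 2 ℕ.* degree (u i) ℕ.≤ d) →
                  (Fin k → Carrier) → Poly≤ n (toℚ d /2)
    combination u u≤d/2 a = poly (λ m → sum λ i → a i * δ m (u i)) λ m d/2<m →
      sum-zero λ i → R.trans (R.*-congˡ (R.trans (δ-sym m (u i)) (δ-≢ (u i) m λ u≡m →
        ℚ.<⇒≱ d/2<m (≡.subst (λ m → toℚ (degree m) ℚ.≤ toℚ d /2) u≡m
          (2*a≤d⇒a≤d/2 (degree (u i)) d (u≤d/2 i)))))) (R.zeroʳ _)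

    pairing-combination : ∀ {k} (u : Fin k → Monomial n) (u≤d/2 : ∀ i → 2 ℕ.* degree (u i) ℕ.≤ d) a F →
                          pairing d (coeff (combination u u≤d/2 a)) F ≈ sum λ i → a i * F (u i)
    pairing-combination u u≤d/2 a F = R.trans (pairing-sum d (λ i m → a i * δ m (u i)) F)
      (sum-cong λ i → R.trans (pairing-*ˡ d (a i) (λ m → δ m (u i)) F)
        (R.*-congˡ (pairing-δ (u i) F (ℕ.≤-trans (ℕ.m≤m+n _ _) (u≤d/2 i)))))

    moment-psd : ∀ {k} (u : Fin k → Monomial n) → (∀ i → 2 ℕ.* degree (u i) ℕ.≤ d) →
                 PSD (λ i j → moment (u i ⊕ u j))
    moment-psd u u≤d/2 a = ≤-respʳ value (positive f)
      where
      f = combination u u≤d/2 a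
      f≤d : Bounded d (coeff f)
      f≤d = poly-Boundedᴺ (weaken (d/2≤d d) f)
      value : 𝔼 (f ²) ≈ form (λ i j → moment (u i ⊕ u j)) a
      value = begin
        𝔼 (f ²)
          ≈⟨ 𝔼-· f f (D/2+D/2≤D (toℚ d)) f≤d f≤d ⟩
        pairing d (coeff f) (λ w → pairing d (coeff f) λ w′ → moment (w ⊕ w′))
          ≈⟨ pairing-combination u u≤d/2 a _ ⟩
        sum (λ i → a i * pairing d (coeff f) (λ w′ → moment (u i ⊕ w′)))
          ≈⟨ sum-cong (λ i → R.*-congˡ (pairing-combination u u≤d/2 a _)) ⟩
        sum (λ i → a i * sum (λ j → a j * moment (u i ⊕ u j)))
          ≈⟨ sum-cong (λ i → R.trans (R.sym (sum-*ˡ (a i) _)) (sum-cong λ j → R.sym (R.*-assoc _ _ _))) ⟩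
        form (λ i j → moment (u i ⊕ u j)) a ∎

    multiplier : ∀ m → degree m ℕ.+ 2 ℕ.≤ d → Poly≤ n (toℚ d ℚ.- toℚ 2)
    multiplier m m+2≤d = weaken (a+2≤d⇒a≤d-2 (degree m) d m+2≤d) (monomial m)

    𝔼-multiplier : ∀ m (m+2≤d : degree m ℕ.+ 2 ℕ.≤ d) (g : Poly≤ n (toℚ 2)) →
      𝔼 (_·ᵇ_ {D = toℚ d} (multiplier m m+2≤d) g) ≈ pairing 2 (coeff g) (λ w → moment (m ⊕ w))
    𝔼-multiplier m m+2≤d g = R.trans
      (𝔼-· (multiplier m m+2≤d) g (D-E+E≤D (toℚ d) (toℚ 2)) (poly-Boundedᴺ (monomial m)) (poly-Boundedᴺ g))
      (pairing-δ m _ ℕ.≤-refl)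

    moment-bool : ∀ m v → degree m ℕ.+ 2 ℕ.≤ d → moment (m ⊕ (varᴹ v ⊕ varᴹ v)) ≈ moment (m ⊕ varᴹ v)
    moment-bool m v m+2≤d = x-y≈0⇒x≈y (R.trans
      (R.sym (R.trans (𝔼-multiplier m m+2≤d (x²-x v)) (pairing-x²-x v λ w → moment (m ⊕ w))))
      (boolean (multiplier m m+2≤d) v))
      where
      x-y≈0⇒x≈y : ∀ {x y} → x - y ≈ 0# → x ≈ y
      x-y≈0⇒x≈y {x} {y} x-y≈0 = R.trans (solve 2 (λ a b → a := a :- b :+ b) R.refl x y)
        (R.trans (R.+-congʳ x-y≈0) (R.+-identityˡ y))

    moment-indep : ∀ m {i j} → Graph.Adj G i j → degree m ℕ.+ 2 ℕ.≤ d →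
                   moment (m ⊕ (varᴹ i ⊕ varᴹ j)) ≈ 0#
    moment-indep m {i} {j} i~j m+2≤d = R.trans
      (R.sym (R.trans (𝔼-multiplier m m+2≤d (x i · x j)) (pairing-xx i j λ w → moment (m ⊕ w))))
      (independent (multiplier m m+2≤d) i~j)

    moment-1 : moment 1ᴹ ≈ 1#
    moment-1 = R.trans (R.sym (R.trans (𝔼-pairing (weaken 0≤d 1ₚ) ℕ.≤-refl) (pairing-1ₚ d moment)))
      (normalised 0≤d)
      where 0≤d = toℚ-mono {0} {d} z≤n

    moment-x : ∀ i → 𝔼 (weaken (1≤toℚ d) (x i)) ≈ moment (varᴹ i)
    moment-x i = R.trans (𝔼-pairing (weaken (1≤toℚ d) (x i)) ℕ.≤-refl) (pairing-x i moment (ℕ.>-nonZero⁻¹ d))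

    moments : Moments G d d
    moments = record
      { μ = moment ; μ-1 = moment-1 ; μ-psd = moment-psd ; μ-bool = moment-bool ; μ-indep = moment-indep }

  -- For d = 1 nothing forces Ẽ[xᵢ] ≤ 1, so Ẽ may have no extension to degree 2.  Evaluation at the
  -- all-ones point replaces it; the edge constraints on the coloring are vacuous in this case.
  trivial-moments : ∀ {n} (G : Graph n) → Moments G 1 2
  trivial-moments G = record
    { μ       = λ _ → 1#
    ; μ-1     = R.refl
    ; μ-psd   = λ _ _ → PSD-1
    ; μ-bool  = λ _ _ _ → R.refl
    ; μ-indep = λ m _ m+2≤1 → ⊥-elim (ℕ.<⇒≱ (s≤s (s≤s z≤n)) (ℕ.≤-trans (ℕ.m≤n+m 2 (degree m)) m+2≤1))
    }

-- Degree budgets and truncation of monomials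

4*a≤d+2⇒2*a≤e : ∀ {d e} a → 2 ℕ.≤ e → d ℕ.≤ e → 4 ℕ.* a ℕ.≤ d ℕ.+ 2 → 2 ℕ.* a ℕ.≤ e
4*a≤d+2⇒2*a≤e {d} {e} a 2≤e d≤e p = ℕ.*-cancelˡ-≤ 2 (begin
  2 ℕ.* (2 ℕ.* a)  ≡⟨ ℕ.*-assoc 2 2 a ⟨
  4 ℕ.* a          ≤⟨ p ⟩
  d ℕ.+ 2          ≤⟨ ℕ.+-mono-≤ d≤e 2≤e ⟩
  e ℕ.+ e          ≡⟨ ≡.cong (e ℕ.+_) (ℕ.+-identityʳ e) ⟨
  2 ℕ.* e          ∎)
  where open ℕ.≤-Reasoning

-- For positive t the extra 2 is absorbed by 2 t. The case t = 0 is the one that asks for e to be at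
-- least 2.
4*t≤d⇒2*t+2≤e : ∀ {d e} t → 2 ℕ.≤ e → d ℕ.≤ e → 4 ℕ.* t ℕ.≤ d → 2 ℕ.* t ℕ.+ 2 ℕ.≤ e
4*t≤d⇒2*t+2≤e zero    2≤e d≤e p = 2≤e
4*t≤d⇒2*t+2≤e {d} {e} (suc t) 2≤e d≤e p = begin
  2 ℕ.* suc t ℕ.+ 2            ≤⟨ ℕ.+-monoʳ-≤ (2 ℕ.* suc t) (ℕ.*-monoʳ-≤ 2 (s≤s (z≤n {t}))) ⟩
  2 ℕ.* suc t ℕ.+ 2 ℕ.* suc t  ≡⟨ ℕ.*-distribʳ-+ (suc t) 2 2 ⟨
  4 ℕ.* suc t                  ≤⟨ p ⟩
  d                            ≤⟨ d≤e ⟩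
  e                            ∎
  where open ℕ.≤-Reasoning

-- The retraction handed to `pairing-psd`. The moment matrix is known to be semidefinite only on
-- monomials of low degree, while the enumeration runs up to a coarser integral bound; the monomials
-- in between have coefficient 0 and are sent to 1.
clamp : ∀ {N} (D q : ℕ) → (m : Monomial N) → Monomial N
clamp D q m with D ℕ.* degree m ℕ.≤? q
... | yes _ = m
... | no  _ = 1ᴹ

clamp≤ : ∀ {N} D q (m : Monomial N) → D ℕ.* degree (clamp D q m) ℕ.≤ q
clamp≤ {N} D q m with D ℕ.* degree m ℕ.≤? q
... | yes p = p
... | no  _ = ℕ.≤-trans (ℕ.≤-reflexive (≡.trans (≡.cong (D ℕ.*_) (degree-1ᴹ N)) (ℕ.*-zeroʳ D))) z≤n

clamp≡ : ∀ {N} D q (m : Monomial N) → D ℕ.* degree m ℕ.≤ q → clamp D q m ≡ m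
clamp≡ D q m p with D ℕ.* degree m ℕ.≤? q
... | yes _ = ≡.refl
... | no ¬p = ⊥-elim (¬p p)

-- The coloring pseudo-expectation and its constraints

module Coloring {c ℓ₁ ℓ₂} (ℛ : RealField c ℓ₁ ℓ₂) where

  open RealField ℛ hiding (zero)
  open OrderedField ℛ
  open Schur ℛ
  open PseudoExpectations ℛ
  open ColorProduct ℛ
  open Pairing ℛ
  open PolynomialPairing ℛ
  open Solver using (solve; _:=_; con; _:+_; _:*_; _:-_; :-_)
  open import Relation.Binary.Reasoning.Setoid R.setoid

  PSD-*ˡ-cancel : ∀ {n} {A : Matrix n} {r} → 0# < r → PSD (λ i j → r * A i j) → PSD A
  PSD-*ˡ-cancel {A = A} {r} 0<r psd a = 0<⇒0≤-cancel 0<r (≤-respʳ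
    (R.trans
      (sum₂-cong λ i j → solve 3 (λ r x m → x :* (r :* m) := r :* (x :* m)) R.refl r (a i * a j) (A i j))
      (sum₂-*ˡ r _))
    (psd a))

  pairing-sumᴹ : ∀ {N q k} B (f : Fin k → Poly≤ N q) F →
                 pairing B (coeff (sumᴹ f)) F ≈ sum λ i → pairing B (coeff (f i)) F
  pairing-sumᴹ {k = zero}  B f F = R.trans (pairing-vanishing B λ m → inj₁ R.refl) (R.sym (sum-nil _))
  pairing-sumᴹ {k = suc k} B f F = R.trans (pairing-+ B (coeff (f zero)) (coeff (sumᴹ (f ∘ suc))) F)
    (R.trans (R.+-congˡ (pairing-sumᴹ B (f ∘ suc) F)) (R.sym (sum-suc _)))

  module _ {n} {G : Graph n} {d e : ℕ} (2≤e : 2 ℕ.≤ e) (d≤e : d ℕ.≤ e) (M : Moments G d e)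
           (k₀ : ℕ) .{{_ : NonZero d}} .{{_ : NonZero k₀}}
           (mean : ∀ v → 1# ≤ fromℕ k₀ * Moments.μ M (varᴹ v)) where

    open Moments M

    k : ℕ
    k = 5 ℕ.* k₀ ℕ.* d

    D : ℚᵘ
    D = 1ℚᵘ ℚ.+ toℚ d /2

    ψ : Monomial (n ℕ.* k) → Carrier
    ψ m = Ψ M (parts m)

    ψ-⊕ : ∀ a b → ψ (a ⊕ b) ≈ Ψ M (parts a ⊕ᶜ parts b)
    ψ-⊕ a b = Ψ-cong M (parts-⊕ a b)

    ψ-var : ∀ a v c → ψ (a ⊕ varᴹ (combine v c)) ≈ Ψ M (parts a ⊕ᶜ single c (varᴹ v))
    ψ-var a v c = Ψ-cong M λ b → ≡.trans (parts-⊕ a _ b) (≡.cong (parts a b ⊕_) (parts-varᴹ v c b))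

    ψ-var-var : ∀ a v w c → ψ (a ⊕ (varᴹ (combine v c) ⊕ varᴹ (combine w c))) ≈
                            Ψ M (parts a ⊕ᶜ single c (varᴹ v ⊕ varᴹ w))
    ψ-var-var a v w c = Ψ-cong M λ b → ≡.trans (parts-⊕ a _ b) (≡.cong (parts a b ⊕_)
      (≡.trans (parts-⊕ (varᴹ (combine v c)) (varᴹ (combine w c)) b)
        (≡.trans (≡.cong₂ _⊕_ (parts-varᴹ v c b) (parts-varᴹ w c b))
          (≡.sym (single-⊕ c (varᴹ v) (varᴹ w) b)))))

    degree-parts : ∀ (m : Monomial (n ℕ.* k)) c → degree (parts {n} {k} m c) ℕ.≤ degree m
    degree-parts m c = ℕ.≤-trans (degree≤total (parts m) c) (ℕ.≤-reflexive (total-parts {n} {k} m))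

    -- The cut-off d + 1 is a natural number that bounds 1 + d/2; by `pairing-bound` a larger one
    -- gives the same functional.
    𝔼ᶜ : Poly≤ (n ℕ.* k) D → Carrier
    𝔼ᶜ f = pairing (d ℕ.+ 1) (coeff f) ψ

    D-Bounded : (f : Poly≤ (n ℕ.* k) D) → Bounded (d ℕ.+ 1) (coeff f)
    D-Bounded f = poly-Bounded f λ a a≤D → ℕ.*-cancelˡ-≤ 2 (ℕ.≤-trans (a≤1+d/2⇒2*a≤d+2 a d a≤D)
      (ℕ.≤-trans (ℕ.+-monoˡ-≤ 2 (ℕ.m≤n*m d 2)) (ℕ.≤-reflexive (≡.sym (ℕ.*-distribˡ-+ 2 d 1)))))

    half-support : (f : Poly≤ (n ℕ.* k) (D /2)) → ∀ m → coeff f m ≈ 0# ⊎ 4 ℕ.* degree m ℕ.≤ d ℕ.+ 2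
    half-support f m = Sum.map₂ (a≤[1+d/2]/2⇒4*a≤d+2 (degree m) d) (support f m)

    -2-support : (f : Poly≤ (n ℕ.* k) (D ℚ.- toℚ 2)) → ∀ m → coeff f m ≈ 0# ⊎ 2 ℕ.* degree m ℕ.+ 2 ℕ.≤ d
    -2-support f m = Sum.map₂ (a≤[1+d/2]-2⇒2*a+2≤d (degree m) d) (support f m)

    quarter-support : (f : Poly≤ (n ℕ.* k) ((D ℚ.- 1ℚᵘ) /2)) → ∀ m → coeff f m ≈ 0# ⊎ 4 ℕ.* degree m ℕ.≤ d
    quarter-support f m = Sum.map₂ (a≤[[1+d/2]-1]/2⇒4*a≤d (degree m) d) (support f m)

    half-Bounded : (f : Poly≤ (n ℕ.* k) (D /2)) → Bounded (d ℕ.+ 2) (coeff f)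
    half-Bounded f = poly-Bounded f λ a a≤ → ℕ.≤-trans (ℕ.m≤n*m a 4) (a≤[1+d/2]/2⇒4*a≤d+2 a d a≤)

    -2-Bounded : (f : Poly≤ (n ℕ.* k) (D ℚ.- toℚ 2)) → Bounded d (coeff f)
    -2-Bounded f = poly-Bounded f λ a a≤ → ℕ.≤-trans (ℕ.m≤n*m a 2)
      (ℕ.≤-trans (ℕ.m≤m+n _ 2) (a≤[1+d/2]-2⇒2*a+2≤d a d a≤))

    quarter-Bounded : (f : Poly≤ (n ℕ.* k) ((D ℚ.- 1ℚᵘ) /2)) → Bounded d (coeff f)
    quarter-Bounded f = poly-Bounded f λ a a≤ → ℕ.≤-trans (ℕ.m≤n*m a 4) (a≤[[1+d/2]-1]/2⇒4*a≤d a d a≤)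

    𝔼ᶜ-· : ∀ {q r D₁ D₂} (f : Poly≤ (n ℕ.* k) q) (g : Poly≤ (n ℕ.* k) r) (q+r≤D : q ℚ.+ r ℚ.≤ D) →
           Bounded D₁ (coeff f) → Bounded D₂ (coeff g) →
           𝔼ᶜ (weaken q+r≤D (f · g)) ≈ pairing D₁ (coeff f) λ u → pairing D₂ (coeff g) λ v → ψ (u ⊕ v)
    𝔼ᶜ-· {D₁ = D₁} {D₂} f g q+r≤D f≤ g≤ = R.trans
      (R.sym (pairing-bound (D-Bounded (weaken q+r≤D (f · g))) (ℕ.m≤m+n (d ℕ.+ 1) (D₁ ℕ.+ D₂)) ψ))
      (pairing-· f g f≤ g≤ (ℕ.m≤n+m (D₁ ℕ.+ D₂) (d ℕ.+ 1)) ψ)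

    linearᶜ : IsLinear 𝔼ᶜ
    linearᶜ = record
      { +ᴹ-isGroupHomomorphism = record
        { isMonoidHomomorphism = record
          { isMagmaHomomorphism = record
            { isRelHomomorphism = record { cong = pairing-congˡ (d ℕ.+ 1) }
            ; homo = λ f g → pairing-+ (d ℕ.+ 1) (coeff f) (coeff g) ψ }
          ; ε-homo = pairing-vanishing (d ℕ.+ 1) λ m → inj₁ R.refl }
        ; ⁻¹-homo = λ f → pairing-neg (d ℕ.+ 1) (coeff f) ψ }
      ; *ₗ-homo = λ r f → pairing-*ˡ (d ℕ.+ 1) r (coeff f) ψ }

    ψ-1 : ψ 1ᴹ ≈ 1#
    ψ-1 = Ψ-1 M (parts-1ᴹ {n} {k})

    normalisedᶜ : ∀ (0≤D : 0ℚᵘ ℚ.≤ D) → 𝔼ᶜ (weaken 0≤D 1ₚ) ≈ 1#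
    normalisedᶜ 0≤D = R.trans (pairing-1ₚ (d ℕ.+ 1) ψ) ψ-1

    -- The degree of a monomial in one color is at most its total degree a. Here 2 a ≤ 1 + d/2, and
    -- this is at most e because both d and 2 are.
    positiveᶜ : ∀ (f : Poly≤ (n ℕ.* k) (D /2)) → 0# ≤ 𝔼ᶜ (f ²)
    positiveᶜ f = ≤-respʳ (R.sym (𝔼ᶜ-· f f (D/2+D/2≤D D) (half-Bounded f) (half-Bounded f)))
      (pairing-psd (λ u v → ψ (u ⊕ v)) (clamp 4 (d ℕ.+ 2))
        (λ m → Sum.map₂ (clamp≡ 4 (d ℕ.+ 2) m) (half-support f m))
        λ u → PSD-cong (λ i j → R.sym (ψ-⊕ (clamp 4 (d ℕ.+ 2) (u i)) (clamp 4 (d ℕ.+ 2) (u j))))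
          (Ψ-psd M (λ i → parts (clamp 4 (d ℕ.+ 2) (u i))) λ i c →
            ℕ.≤-trans (ℕ.*-monoʳ-≤ 2 (degree-parts (clamp 4 (d ℕ.+ 2) (u i)) c))
              (4*a≤d+2⇒2*a≤e (degree (clamp 4 (d ℕ.+ 2) (u i))) 2≤e d≤e (clamp≤ 4 (d ℕ.+ 2) (u i)))))

    multiplier-degree : ∀ (u : Monomial (n ℕ.* k)) c → 2 ℕ.* degree u ℕ.+ 2 ℕ.≤ d →
                        degree (parts {n} {k} u c) ℕ.+ 2 ℕ.≤ d
    multiplier-degree u c p =
      ℕ.≤-trans (ℕ.+-monoˡ-≤ 2 (ℕ.≤-trans (degree-parts u c) (ℕ.m≤n*m (degree u) 2))) p

    -- This constraint and the edge constraint each involve a single color, so only one factor of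
    -- the product changes and the corresponding property of `μ` settles the claim.
    booleanᶜ : ∀ (f : Poly≤ (n ℕ.* k) (D ℚ.- toℚ 2)) i c → 𝔼ᶜ (f ·ᵇ x²-x (combine {n} {k} i c)) ≈ 0#
    booleanᶜ f i c = R.trans
      (𝔼ᶜ-· f (x²-x (combine i c)) (D-E+E≤D D (toℚ 2)) (-2-Bounded f) (poly-Boundedᴺ (x²-x (combine i c))))
      (pairing-vanishing d λ u → Sum.map₂ (vanish u) (-2-support f u))
      where
      vanish : ∀ u → 2 ℕ.* degree u ℕ.+ 2 ℕ.≤ d →
               pairing 2 (coeff (x²-x (combine i c))) (λ v → ψ (u ⊕ v)) ≈ 0#
      vanish u p = R.trans (pairing-x²-x (combine i c) λ v → ψ (u ⊕ v)) (R.trans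
        (R.+-cong (R.trans (ψ-var-var u i i c) (Ψ-single-cong M (parts u) c
          (μ-bool (parts u c) i (ℕ.≤-trans (multiplier-degree u c p) d≤e)))) (R.-‿cong (ψ-var u i c)))
        (R.-‿inverseʳ _))

    properᶜ : ∀ (f : Poly≤ (n ℕ.* k) (D ℚ.- toℚ 2)) {i j} → Graph.Adj G i j → ∀ c →
              𝔼ᶜ (f ·ᵇ (x (combine {n} {k} i c) · x (combine {n} {k} j c))) ≈ 0#
    properᶜ f {i} {j} i~j c = R.trans
      (𝔼ᶜ-· f xx (D-E+E≤D D (toℚ 2)) (-2-Bounded f) (poly-Boundedᴺ xx))
      (pairing-vanishing d λ u → Sum.map₂ (vanish u) (-2-support f u))
      where
      xx : Poly≤ (n ℕ.* k) (toℚ 2)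
      xx = x (combine {n} {k} i c) · x (combine {n} {k} j c)
      vanish : ∀ u → 2 ℕ.* degree u ℕ.+ 2 ℕ.≤ d → pairing 2 (coeff xx) (λ v → ψ (u ⊕ v)) ≈ 0#
      vanish u p = R.trans (pairing-xx (combine i c) (combine j c) λ v → ψ (u ⊕ v)) (R.trans
        (ψ-var-var u i j c)
        (Ψ-single-zeroed M (parts u) c (μ-indep (parts u c) i~j (multiplier-degree u c p))))

    -- The covering constraint admits f of degree at most (D - 1)/2 = d/4.
    t : ℕ
    t = d ℕ./ 4

    4*t≤d : 4 ℕ.* t ℕ.≤ d
    4*t≤d = ℕ.≤-trans (ℕ.≤-reflexive (ℕ.*-comm 4 t)) (ℕ.m/n*n≤m d 4)

    a≤t : ∀ a → 4 ℕ.* a ℕ.≤ d → a ℕ.≤ t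
    a≤t a 4a≤d = ℕ.≤-trans (ℕ.≤-reflexive (≡.sym (ℕ.m*n/n≡m a 4)))
      (ℕ./-monoˡ-≤ 4 (ℕ.≤-trans (ℕ.≤-reflexive (ℕ.*-comm a 4)) 4a≤d))

    0≤mean : ∀ v → 0# ≤ p M v
    0≤mean v = 0<⇒0≤-cancel (0<fromℕ k₀) (≤-trans (<⇒≤ 0<1) (mean v))

    -- With q = k₀ p ≥ 1 and p ≤ q:  β - 2 = q (5 d - 3 t - 2) + (q - 1) (2 t + 2) + (q - p) t.
    2≤β : ∀ v → 0# ≤ β M v k t - fromℕ 2
    2≤β v = ≤-respʳ (R.sym value) (0≤+ (0≤+
      (0≤* 0≤q (0≤fromℕ s))
      (0≤* (≤⇒0≤- (mean v)) (0≤fromℕ (2 ℕ.* t ℕ.+ 2))))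
      (0≤* (≤-respʳ q-p (0≤* (0≤fromℕ (ℕ.pred k₀)) (0≤mean v))) (0≤fromℕ t)))
      where
      q = fromℕ k₀ * p M v
      0≤q : 0# ≤ q
      0≤q = ≤-trans (<⇒≤ 0<1) (mean v)
      q-p : fromℕ (ℕ.pred k₀) * p M v ≈ q - p M v
      q-p = R.trans (solve 2 (λ a b → a :* b := (con (+ 1) :+ a) :* b :- b) R.refl (fromℕ (ℕ.pred k₀)) (p M v))
        (R.+-congʳ (R.*-congʳ (R.trans (R.+-congʳ (R.+-identityʳ 1#))
          (R.reflexive (≡.cong fromℕ (ℕ.suc-pred k₀))))))
      -- From t ≤ d and 1 ≤ d. The 5 in the number of colors is this 3 + 2.
      3t+2≤5d : 3 ℕ.* t ℕ.+ 2 ℕ.≤ 5 ℕ.* d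
      3t+2≤5d = ℕ.≤-trans
        (ℕ.+-mono-≤ (ℕ.*-monoʳ-≤ 3 (ℕ.≤-trans (ℕ.m≤n*m t 4) 4*t≤d)) (ℕ.*-monoʳ-≤ 2 (ℕ.>-nonZero⁻¹ d)))
        (ℕ.≤-reflexive (≡.sym (ℕ.*-distribʳ-+ d 3 2)))
      s = 5 ℕ.* d ℕ.∸ (3 ℕ.* t ℕ.+ 2)
      fromℕ-s : fromℕ 5 * fromℕ d ≈ fromℕ 3 * fromℕ t + fromℕ 2 + fromℕ s
      fromℕ-s = begin
        fromℕ 5 * fromℕ d                          ≈⟨ fromℕ-* 5 d ⟨
        fromℕ (5 ℕ.* d)                            ≡⟨ ≡.cong fromℕ (ℕ.m+[n∸m]≡n 3t+2≤5d) ⟨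
        fromℕ (3 ℕ.* t ℕ.+ 2 ℕ.+ s)                ≈⟨ fromℕ-+ (3 ℕ.* t ℕ.+ 2) s ⟩
        fromℕ (3 ℕ.* t ℕ.+ 2) + fromℕ s
          ≈⟨ R.+-congʳ (R.trans (fromℕ-+ (3 ℕ.* t) 2) (R.+-congʳ (fromℕ-* 3 t))) ⟩
        fromℕ 3 * fromℕ t + fromℕ 2 + fromℕ s      ∎
      fromℕ-k : fromℕ k ≈ fromℕ 5 * fromℕ d * fromℕ k₀
      fromℕ-k = R.trans (fromℕ-* (5 ℕ.* k₀) d) (R.trans (R.*-congʳ (fromℕ-* 5 k₀))
        (solve 3 (λ a b e → a :* b :* e := a :* e :* b) R.refl (fromℕ 5) (fromℕ k₀) (fromℕ d)))
      value : β M v k t - fromℕ 2 ≈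
              q * fromℕ s + (q - 1#) * fromℕ (2 ℕ.* t ℕ.+ 2) + (q - p M v) * fromℕ t
      value = begin
        p M v * fromℕ k - (two M v + p M v) * fromℕ t - fromℕ 2
          ≈⟨ R.+-congʳ (R.+-congʳ (R.*-congˡ (R.trans fromℕ-k (R.*-congʳ fromℕ-s)))) ⟩
        p M v * ((fromℕ 3 * fromℕ t + fromℕ 2 + fromℕ s) * fromℕ k₀) - (two M v + p M v) * fromℕ t - fromℕ 2
          ≈⟨ solve 4 (λ p t s κ →
               p :* ((con (+ 3) :* t :+ con (+ 2) :+ s) :* κ) :- (con (+ 2) :+ p) :* t :- con (+ 2)
               := κ :* p :* s :+ (κ :* p :- con (+ 1)) :* (con (+ 2) :* t :+ con (+ 2)) :+ (κ :* p :- p) :* t)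
               R.refl (p M v) (fromℕ t) (fromℕ s) (fromℕ k₀) ⟩
        q * fromℕ s + (q - fromℕ 1) * (fromℕ 2 * fromℕ t + fromℕ 2) + (q - p M v) * fromℕ t
          ≈⟨ R.+-congʳ (R.+-congˡ (R.*-cong (R.+-congˡ (R.-‿cong (R.+-identityʳ 1#)))
               (R.trans (R.+-congʳ (R.sym (fromℕ-* 2 t))) (R.sym (fromℕ-+ (2 ℕ.* t) 2))))) ⟩
        q * fromℕ s + (q - 1#) * fromℕ (2 ℕ.* t ℕ.+ 2) + (q - p M v) * fromℕ t ∎

    -- Adding (β - 2) Ψ, which is semidefinite by `2≤β`, to the covering inequality 2 T - β Ψ leaves
    -- 2 (T - Ψ).
    excess-psd : ∀ v {N} (u : Fin N → Colored n k) → (∀ i → total (u i) ℕ.≤ t) →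
                 PSD (λ i j → T M v (u i ⊕ᶜ u j) - Ψ M (u i ⊕ᶜ u j))
    excess-psd v u u≤t = PSD-*ˡ-cancel (0<fromℕ 2) (PSD-cong
      (λ i j → solve 3 (λ T P b → con (+ 2) :* T :- b :* P :+ (b :- con (+ 2)) :* P := con (+ 2) :* (T :- P))
         R.refl (T M v (u i ⊕ᶜ u j)) (Ψ M (u i ⊕ᶜ u j)) (β M v k t))
      (PSD-+ (covering-psd M v (0≤mean v) k t 2t+2≤e u u≤t)
        (PSD-*ˡ (2≤β v) (Ψ-psd M u λ i c →
          ℕ.≤-trans (ℕ.*-monoʳ-≤ 2 (ℕ.≤-trans (degree≤total (u i) c) (u≤t i)))
            (ℕ.≤-trans (ℕ.m≤m+n _ 2) 2t+2≤e)))))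
      where
      2t+2≤e = 4*t≤d⇒2*t+2≤e t 2≤e d≤e 4*t≤d

    coveringᶜ : ∀ (f : Poly≤ (n ℕ.* k) ((D ℚ.- 1ℚᵘ) /2)) i →
      0# ≤ 𝔼ᶜ (_·ᵇ_ {D = D} {1ℚᵘ} (_² {D = D ℚ.- 1ℚᵘ} f)
        (sumᴹ (λ c → x (combine {n} {k} i c)) -ᴹ weaken (toℚ-mono z≤n) 1ₚ))
    coveringᶜ f i = ≤-respʳ (R.sym value)
      (pairing-psd κ (clamp 4 d) (λ m → Sum.map₂ (clamp≡ 4 d m) (quarter-support f m))
        λ u → PSD-cong (λ a b → R.sym (κ-excess (clamp 4 d (u a)) (clamp 4 d (u b))))
          (excess-psd i (λ a → parts (clamp 4 d (u a))) λ a →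
            ℕ.≤-trans (ℕ.≤-reflexive (total-parts {n} {k} (clamp 4 d (u a))))
              (a≤t (degree (clamp 4 d (u a))) (clamp≤ 4 d (u a)))))
      where
      g : Poly≤ (n ℕ.* k) 1ℚᵘ
      g = sumᴹ (λ c → x (combine {n} {k} i c)) -ᴹ weaken (toℚ-mono z≤n) 1ₚ
      excess : Monomial (n ℕ.* k) → Carrier
      excess u = sum (λ c → ψ (u ⊕ varᴹ (combine {n} {k} i c))) - ψ u
      κ : Monomial (n ℕ.* k) → Monomial (n ℕ.* k) → Carrier
      κ u v = excess (u ⊕ v)
      pairing-g : ∀ u → pairing 1 (coeff g) (λ v → ψ (u ⊕ v)) ≈ excess u
      pairing-g u = R.trans (pairing-+ 1 (coeff (sumᴹ λ c → x (combine {n} {k} i c)))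
          (λ m → - coeff {n ℕ.* k} 1ₚ m) _)
        (R.+-cong
          (R.trans (pairing-sumᴹ 1 (λ c → x (combine {n} {k} i c)) _)
            (sum-cong λ c → pairing-x (combine i c) (λ v → ψ (u ⊕ v)) ℕ.≤-refl))
          (R.trans (pairing-neg 1 (coeff {n ℕ.* k} 1ₚ) _) (R.-‿cong (R.trans (pairing-1ₚ 1 λ v → ψ (u ⊕ v))
            (R.reflexive (≡.cong ψ (⊕-identityʳ u)))))))
      κ-excess : ∀ u v → κ u v ≈ T M i (parts u ⊕ᶜ parts v) - Ψ M (parts u ⊕ᶜ parts v)
      κ-excess u v = R.+-cong
        (R.trans (sum-cong λ c → ψ-var (u ⊕ v) i c)
          (R.trans (T-sum M i (parts (u ⊕ v))) (T-cong M i (parts-⊕ {n} {k} u v))))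
        (R.-‿cong (ψ-⊕ u v))
      value : 𝔼ᶜ (_·ᵇ_ {D = D} {1ℚᵘ} (_² {D = D ℚ.- 1ℚᵘ} f) g) ≈
              pairing d (coeff f) λ u → pairing d (coeff f) λ v → κ u v
      -- The linear factor is evaluated first, which turns `excess` into a moment function; its
      -- pairing with f² is then a quadratic form in the coefficients of f.
      value = R.trans
        (𝔼ᶜ-· (_² {D = D ℚ.- 1ℚᵘ} f) g (D-E+E≤D D 1ℚᵘ)
          (·-Bounded f f (quarter-Bounded f) (quarter-Bounded f)) (poly-Boundedᴺ g))
        (R.trans (pairing-congʳ (d ℕ.+ d) pairing-g)
          (pairing-· f f (quarter-Bounded f) (quarter-Bounded f) ℕ.≤-refl excess))

    coloringPE : ColoringPE G k D
    coloringPE = record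
      { 𝔼 = 𝔼ᶜ ; linear = linearᶜ ; normalised = normalisedᶜ ; positive = positiveᶜ
      ; boolean = booleanᶜ ; proper = properᶜ ; covering = coveringᶜ }

-- A lower bound for the logarithm

module Logarithm {c ℓ₁ ℓ₂} (ℛ : RealField c ℓ₁ ℓ₂) where

  open RealField ℛ hiding (zero)
  open OrderedField ℛ
  open Solver using (solve; _:=_; con; _:+_; _:*_; _:-_; :-_)

  0<⇒0<recip : ∀ {x} (0<x : 0# < x) (x#0 : x # 0#) → 0# < recip x x#0
  0<⇒0<recip {x} 0<x x#0 = 0≤∧#0⇒0<
    (0<⇒0≤-cancel 0<x (≤-respʳ (R.sym (recip-inverseʳ x x#0)) (<⇒≤ 0<1)))
    (*#0⇒#0 (#-sym (<⇒# (<-respʳ-≈ (R.trans (R.sym (recip-inverseʳ x x#0)) (R.*-comm _ _)) 0<1))))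

  1/ᴿ-inverse : ∀ n .{{_ : NonZero n}} → fromℕ n * 1/ᴿ n ≈ 1#
  1/ᴿ-inverse n = R.trans (R.*-congˡ (R.*-identityˡ _)) (recip-inverseʳ (fromℕ n) _)

  0<1/ᴿ : ∀ n .{{_ : NonZero n}} → 0# < 1/ᴿ n
  0<1/ᴿ n = <-respʳ-≈ (R.sym (R.*-identityˡ _)) (0<⇒0<recip (0<fromℕ n) _)

  0≤^ : ∀ {x} j → 0# ≤ x → 0# ≤ x ^ j
  0≤^ zero    0≤x = <⇒≤ 0<1
  0≤^ (suc j) 0≤x = 0≤* 0≤x (0≤^ j 0≤x)

  -- (1 + b) (1 - (j + 1) b) = 1 - j b - (j + 1) b²
  ^-bound : ∀ {a b} j → 0# ≤ 1# + a → 0# ≤ b - a → 0# ≤ b →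
            (∀ i → i ℕ.≤ j → 0# ≤ 1# - fromℕ i * b) →
            0# ≤ 1# - (1# + a) ^ j * (1# - fromℕ j * b)
  ^-bound {a} {b} zero 0≤1+a a≤b 0≤b 0≤c = ≈⇒≤ (R.sym (R.trans
    (R.+-congˡ (R.-‿cong (R.*-identityˡ _)))
    (solve 2 (λ o b → o :- (o :- con (+ 0) :* b) := con (+ 0)) R.refl 1# b)))
  -- The claim is the division-free form of (1 + a)^j ≤ 1 / (1 - j b). The step adds P times the
  -- loss (j + 1) b² and P times the slack (b - a) (1 - (j + 1) b).
  ^-bound {a} {b} (suc j) 0≤1+a a≤b 0≤b 0≤c = ≤-respʳ value (0≤+
    (^-bound j 0≤1+a a≤b 0≤b λ i i≤j → 0≤c i (ℕ.m≤n⇒m≤1+n i≤j))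
    (0≤* (0≤^ j 0≤1+a) (0≤+ (0≤* (0≤x² b) (0≤fromℕ (suc j))) (0≤* a≤b (0≤c (suc j) ℕ.≤-refl)))))
    where
    P = (1# + a) ^ j
    one = R.sym (R.+-identityʳ 1#)
    value : 1# - P * (1# - fromℕ j * b)
            + P * (b * b * fromℕ (suc j) + (b - a) * (1# - fromℕ (suc j) * b))
            ≈ 1# - (1# + a) ^ suc j * (1# - fromℕ (suc j) * b)
    value = R.trans
      (R.+-cong (R.+-congˡ (R.-‿cong (R.*-congˡ (R.+-congʳ one))))
        (R.*-congˡ (R.+-cong (R.*-congˡ (R.+-congʳ one))
          (R.*-congˡ (R.+-cong one (R.-‿cong (R.*-congʳ (R.+-congʳ one))))))))
      (R.trans
        (solve 5 (λ o a b j P →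
          o :- P :* (con (+ 1) :- j :* b)
            :+ P :* (b :* b :* (con (+ 1) :+ j) :+ (b :- a) :* (con (+ 1) :- (con (+ 1) :+ j) :* b))
          := o :- (con (+ 1) :+ a) :* P :* (con (+ 1) :- (con (+ 1) :+ j) :* b)) R.refl
          1# a b (fromℕ j) P)
        (R.+-congˡ (R.-‿cong (R.*-cong (R.*-congʳ (R.+-congʳ (R.sym one)))
          (R.+-cong (R.sym one) (R.-‿cong (R.*-congʳ (R.+-congʳ (R.sym one)))))))))

  -- If 4 L < 1, then a = L / M is at most b = 1 / (4 M), so (1 + L / M)^M is at most 1 / (1 - 1/4)
  -- = 4/3. Its limit X would then be less than 4/3 + 1/3, which is below 2.
  1/4≤log : ∀ {X L} → fromℕ 2 ≤ X → IsLog X L → 1# ≤ fromℕ 4 * L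
  1/4≤log {X} {L} 2≤X isLog 4L<1 = step (archimedean (- L)) (isLog (0<1/ᴿ 3))
    where
    r₄ = 1/ᴿ 4
    4r₄≈1 : fromℕ 4 * r₄ ≈ 1#
    4r₄≈1 = 1/ᴿ-inverse 4

    -- At this stage L may be very negative; taking m above - L keeps the base 1 + L / M
    -- nonnegative.
    module At (m : ℕ) (-L<m : - L < fromℕ m) where
      M = suc m
      r = 1/ᴿ M
      a = L * r
      b = r * r₄
      s = (1# + a) ^ M

      0≤b : 0# ≤ b
      0≤b = 0≤* (<⇒≤ (0<1/ᴿ M)) (<⇒≤ (0<1/ᴿ 4))

      b*4L≈a : b * (fromℕ 4 * L) ≈ a
      b*4L≈a = R.trans
        (solve 4 (λ r q L f → r :* q :* (f :* L) := L :* r :* (f :* q)) R.refl r r₄ L (fromℕ 4))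
        (R.trans (R.*-congˡ 4r₄≈1) (R.*-identityʳ a))

      a≤b : 0# ≤ b - a
      a≤b = ≤-respʳ
        (R.trans (R.distribˡ b 1# (- (fromℕ 4 * L))) (R.+-cong (R.*-identityʳ b)
          (R.trans (solve 2 (λ x y → x :* :- y := :- (x :* y)) R.refl b (fromℕ 4 * L)) (R.-‿cong b*4L≈a))))
        (0≤* 0≤b (≤⇒0≤- (<⇒≤ 4L<1)))

      0≤1+a : 0# ≤ 1# + a
      0≤1+a = ≤-respʳ
        (R.trans (solve 3 (λ r M L → r :* (M :+ L) := M :* r :+ L :* r) R.refl r (fromℕ M) L)
          (R.+-congʳ (1/ᴿ-inverse M)))
        (0≤* (<⇒≤ (0<1/ᴿ M)) (≤-respʳ (solve 2 (λ M L → M :- :- L := M :+ L) R.refl (fromℕ M) L)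
          (≤⇒0≤- (≤-trans (<⇒≤ -L<m) (fromℕ-mono (ℕ.n≤1+n m))))))

      1-r₄ : 1# - r₄ ≈ fromℕ 3 * r₄
      1-r₄ = R.trans (R.+-congʳ (R.sym 4r₄≈1))
        (solve 1 (λ q → con (+ 4) :* q :- q := con (+ 3) :* q) R.refl r₄)

      Mb≈r₄ : fromℕ M * b ≈ r₄
      Mb≈r₄ = R.trans (R.sym (R.*-assoc _ _ _)) (R.trans (R.*-congʳ (1/ᴿ-inverse M)) (R.*-identityˡ _))

      0≤1-ib : ∀ i → i ℕ.≤ M → 0# ≤ 1# - fromℕ i * b
      0≤1-ib i i≤M = ≤-respʳ
        (R.trans (R.+-congˡ (R.trans (R.sym 1-r₄) (R.+-congˡ (R.-‿cong (R.sym Mb≈r₄)))))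
          (solve 4 (λ M i b o → (M :- i) :* b :+ (o :- M :* b) := o :- i :* b) R.refl (fromℕ M) (fromℕ i) b 1#))
        (0≤+ (0≤* (≤⇒0≤- (fromℕ-mono i≤M)) 0≤b) (0≤* (0≤fromℕ 3) (<⇒≤ (0<1/ᴿ 4))))

      3s≤4 : 0# ≤ fromℕ 4 - fromℕ 3 * s
      3s≤4 = ≤-respʳ
        (R.trans (R.*-congˡ (R.+-congˡ (R.-‿cong (R.*-congˡ (R.trans (R.+-congˡ (R.-‿cong Mb≈r₄)) 1-r₄)))))
          (R.trans
            (R.trans (R.distribˡ (fromℕ 4) 1# _) (R.+-cong (R.*-identityʳ (fromℕ 4))
              (solve 3 (λ f s q → f :* :- (s :* (con (+ 3) :* q)) := :- (con (+ 3) :* s :* (f :* q)))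
                R.refl (fromℕ 4) s r₄)))
            (R.+-congˡ (R.-‿cong (R.trans (R.*-congˡ 4r₄≈1) (R.*-identityʳ _))))))
        (0≤* (0≤fromℕ 4) (^-bound M 0≤1+a a≤b 0≤b 0≤1-ib))

      s+1/3≤2 : s + 1/ᴿ 3 ≤ fromℕ 2
      s+1/3≤2 = 0≤-⇒≤ (0<⇒0≤-cancel (0<fromℕ 3) (≤-respʳ
        (R.trans (R.+-congˡ (R.+-congˡ (R.-‿cong (R.sym (1/ᴿ-inverse 3)))))
          (solve 2 (λ s q → con (+ 4) :- con (+ 3) :* s :+ (con (+ 2) :- con (+ 3) :* q)
                            := con (+ 3) :* (con (+ 2) :- (s :+ q))) R.refl s (1/ᴿ 3)))
        (0≤+ 3s≤4 (≤-respʳ (solve 1 (λ o → o := o :+ (o :+ con (+ 0)) :- o) R.refl 1#) (<⇒≤ 0<1)))))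

    step : ∃[ N₀ ] - L < fromℕ N₀ →
           ∃[ N ] (∀ m → N ℕ.≤ m → IsWithin (1/ᴿ 3) ((1# + L * (1/ᴿ suc m)) ^ suc m) X) → ⊥
    step (N₀ , -L<N₀) (N , within) =
      ≤-trans (At.s+1/3≤2 m -L<m) 2≤X (proj₂ (within m (ℕ.m≤m⊔n N N₀)))
      where
      m = N ℕ.⊔ N₀
      -L<m : - L < fromℕ m
      -L<m = [ id , (λ m<N₀ → ⊥-elim (fromℕ-mono (ℕ.m≤n⊔m N N₀) m<N₀)) ]′ (<-cotrans -L<N₀ (fromℕ m))

-- Upper bounds on λ from test polynomials

module Eigenvalue {c ℓ₁ ℓ₂} (ℛ : RealField c ℓ₁ ℓ₂) where

  open RealField ℛ hiding (zero)
  open OrderedField ℛ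
  open PseudoExpectations ℛ
  open Pairing ℛ
  open PolynomialPairing ℛ
  open Logarithm ℛ using (0≤^)
  open Solver using (solve; _:=_; con; _:+_; _:*_; _:-_; :-_)

  fromℕ-^ : ∀ m j → fromℕ (m ℕ.^ j) ≈ fromℕ m ^ j
  fromℕ-^ m zero    = R.+-identityʳ 1#
  fromℕ-^ m (suc j) = R.trans (fromℕ-* m (m ℕ.^ j)) (R.*-congˡ (fromℕ-^ m j))

  δ-multilinear : ∀ {N} (m u : Monomial N) i → 2 ℕ.≤ Vec.lookup m i → Vec.lookup u i ℕ.≤ 1 → δ m u ≈ 0#
  δ-multilinear m u i 2≤m u≤1 = δ-≢ m u λ { ≡.refl → ℕ.<⇒≱ 2≤m u≤1 }

  module _ {n d : ℕ} where

    ⟨⟩-pairing : ∀ (f g : Poly≤ n (toℚ d)) → ⟨_,_⟩ {d = d} f g ≈ pairing d (coeff f) (coeff g)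
    ⟨⟩-pairing f g = ∑≈sumᴸ (monomials n d) _

    -- Test polynomials are chosen inside the edge complement, where they are their own projections;
    -- the eigenvalue hypothesis then applies to them directly.
    self-projection : ∀ {G : Graph n} (f : Poly≤ n (toℚ d)) → _∈EdgeComplement_ {d = d} f G →
                      IsProjection {d = d} G f f
    self-projection f f∈ = record
      { in-complement = f∈
      ; orthogonal    = λ q _ → R.trans (⟨⟩-pairing (f -ᴹ f) q)
          (pairing-vanishing d λ m → inj₁ (R.-‿inverseʳ (coeff f m)))
      }

    edge-multiple-at-1ᴹ : ∀ (g : Poly≤ n (toℚ d ℚ.- toℚ 2)) i j →
                          coeff (_·ᵇ_ {D = toℚ d} g (x i · x j)) 1ᴹ ≈ 0#
    edge-multiple-at-1ᴹ g i j = R.trans (∑≈sumᴸ (divisors (1ᴹ {n})) _)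
      (R.trans (⋆-expansion {D = d} g≤d (poly-Boundedᴺ (x i · x j)) 1ᴹ)
        (pairing-vanishing d λ u → inj₂ (R.trans (pairing-xx i j λ v → δ (u ⊕ v) 1ᴹ)
          (R.trans (δ-sym (u ⊕ (varᴹ i ⊕ varᴹ j)) 1ᴹ) (δ-degree 1ᴹ (u ⊕ (varᴹ i ⊕ varᴹ j)) (0<degree u))))))
      where
      g≤d : Bounded d (coeff g)
      g≤d = poly-Boundedᴺ (weaken (ℚ.≤-trans (ℚ.≤-reflexive (ℚ.≃-sym (ℚ.+-identityʳ _)))
        (ℚ.≤-trans (ℚ.+-monoʳ-≤ (toℚ d ℚ.- toℚ 2) (toℚ-mono {0} {2} z≤n)) (D-E+E≤D (toℚ d) (toℚ 2)))) g)
      0<degree : ∀ u → degree (1ᴹ {n}) ℕ.< degree (u ⊕ (varᴹ i ⊕ varᴹ j))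
      0<degree u = ℕ.≤-trans (s≤s (ℕ.≤-reflexive (degree-1ᴹ n)))
        (ℕ.≤-trans (ℕ.≤-reflexive (≡.sym (degree-varᴹ i)))
          (ℕ.≤-trans (ℕ.m≤m+n _ _) (ℕ.≤-trans (ℕ.≤-reflexive (≡.sym (degree-⊕ (varᴹ i) (varᴹ j))))
            (ℕ.≤-trans (ℕ.m≤n+m _ (degree u)) (ℕ.≤-reflexive (≡.sym (degree-⊕ u _)))))))

  module _ {n d : ℕ} .{{_ : NonZero d}} {G : Graph n} (Ẽ : IndependentSetPE G (toℚ d)) (lam : Carrier)
           (eigenvalue : ∀ (f : Poly≤ n (toℚ d /2)) → Multilinear f →
             ∀ (Πf : Poly≤ n (toℚ d)) → IsProjection {d = d} G (weaken (d/2≤d d) f) Πf →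
             lam * ‖_‖² {d = d} Πf ≤ IndependentSetPE.𝔼 Ẽ (f ²)) where

    open IndependentSetPE Ẽ using (𝔼)
    open FromIndependentSetPE {G = G} {d = d} Ẽ

    rayleigh : ∀ (f : Poly≤ n (toℚ d /2)) → Multilinear f →
      _∈EdgeComplement_ {d = d} (weaken (d/2≤d d) f) G →
      lam * pairing d (coeff f) (coeff f) ≤
      pairing d (coeff f) (λ u → pairing d (coeff f) λ v → moment (u ⊕ v))
    rayleigh f multilinear f∈ = ≤-respˡ (R.*-congˡ (⟨⟩-pairing {d = d} f′ f′))
      (≤-respʳ (𝔼-· f f (D/2+D/2≤D (toℚ d)) (poly-Boundedᴺ f′) (poly-Boundedᴺ f′))
        (eigenvalue f multilinear f′ (self-projection {d = d} f′ f∈)))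
      where f′ = weaken (d/2≤d d) f

    -- The test polynomial is 1, which has norm 1 and expectation 1. It lies in the edge complement
    -- because a multiple of x_i x_j has no constant term.
    λ≤1 : lam ≤ 1#
    λ≤1 = ≤-respˡ
      (R.trans (R.*-congˡ (R.trans (pairing-1ₚ d (coeff {n} 1ₚ)) (δ-refl (1ᴹ {n})))) (R.*-identityʳ lam))
      (≤-respʳ
        (R.trans (pairing-1ₚ d λ u → pairing d (coeff {n} 1ₚ) λ v → moment (u ⊕ v))
          (R.trans (pairing-1ₚ d λ v → moment (1ᴹ ⊕ v))
            (R.trans (R.reflexive (≡.cong moment (⊕-identityˡ (1ᴹ {n})))) moment-1)))
        (rayleigh f multilinear in-complement))
      where
      f : Poly≤ n (toℚ d /2)
      f = weaken (2*a≤d⇒a≤d/2 0 d z≤n) 1ₚ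
      multilinear : Multilinear f
      multilinear m i 2≤m = δ-multilinear m 1ᴹ i 2≤m
        (ℕ.≤-trans (ℕ.≤-reflexive (Vec.lookup-replicate i 0)) z≤n)
      in-complement : _∈EdgeComplement_ {d = d} (weaken (d/2≤d d) f) G
      in-complement {i} {j} _ g = R.trans (⟨⟩-pairing {d = d} (weaken (d/2≤d d) f) h)
        (R.trans (pairing-1ₚ d (coeff h)) (edge-multiple-at-1ᴹ {d = d} g i j))
        where h = _·ᵇ_ {D = toℚ d} g (x i · x j)

    -- The test polynomial 1 - 2 xᵥ satisfies (1 - 2 xᵥ)² = 1 on the hypercube and has norm 5.
    5λ≤1 : (v : Fin n) → (∀ {i j} → ¬ Graph.Adj G i j) → 2 ℕ.≤ d → fromℕ 5 * lam ≤ 1#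
    5λ≤1 v edgeless 2≤d = ≤-respˡ
      (R.trans (R.*-congˡ norm) (R.*-comm lam (fromℕ 5)))
      (≤-respʳ square (rayleigh f multilinear λ i~j → ⊥-elim (edgeless i~j)))
      where
      1≤d = ℕ.≤-trans (s≤s z≤n) 2≤d
      xᵥ = varᴹ v
      f : Poly≤ n (toℚ d /2)
      f = weaken (2*a≤d⇒a≤d/2 0 d z≤n) 1ₚ +ᴹ (- fromℕ 2) *ₗ weaken (2*a≤d⇒a≤d/2 1 d 2≤d) (x v)
      pairing-f : ∀ F → pairing d (coeff f) F ≈ F 1ᴹ + (- fromℕ 2) * F xᵥ
      pairing-f F = R.trans (pairing-+ d (coeff {n} 1ₚ) (λ m → - fromℕ 2 * coeff (x v) m) F)
        (R.+-cong (pairing-1ₚ d F)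
          (R.trans (pairing-*ˡ d (- fromℕ 2) (coeff (x v)) F) (R.*-congˡ (pairing-x v F 1≤d))))
      lookup-xᵥ≤1 : ∀ i → Vec.lookup xᵥ i ℕ.≤ 1
      lookup-xᵥ≤1 i = ℕ.≤-trans (lookup≤degree xᵥ i) (ℕ.≤-reflexive (degree-varᴹ v))
        where
        lookup≤degree : ∀ {N} (m : Monomial N) i → Vec.lookup m i ℕ.≤ degree m
        lookup≤degree (e Vec.∷ m) zero    = ℕ.m≤m+n e _
        lookup≤degree (e Vec.∷ m) (suc i) = ℕ.≤-trans (lookup≤degree m i) (ℕ.m≤n+m _ e)
      multilinear : Multilinear f
      multilinear m i 2≤m = R.trans (R.+-cong
          (δ-multilinear m 1ᴹ i 2≤m (ℕ.≤-trans (ℕ.≤-reflexive (Vec.lookup-replicate i 0)) z≤n))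
          (R.trans (R.*-congˡ (δ-multilinear m xᵥ i 2≤m (lookup-xᵥ≤1 i))) (R.zeroʳ _)))
        (R.+-identityˡ 0#)
      1<xᵥ : degree (1ᴹ {n}) ℕ.< degree xᵥ
      1<xᵥ = ℕ.≤-reflexive (≡.trans (≡.cong suc (degree-1ᴹ n)) (≡.sym (degree-varᴹ v)))
      δ-1-x : δ 1ᴹ xᵥ ≈ 0#
      δ-1-x = δ-degree 1ᴹ xᵥ 1<xᵥ
      one = R.sym (R.+-identityʳ 1#)
      norm : pairing d (coeff f) (coeff f) ≈ fromℕ 5
      norm = R.trans (pairing-f (coeff f)) (R.trans
        (R.+-cong
          (R.+-cong (R.trans (δ-refl (1ᴹ {n})) one) (R.*-congˡ δ-1-x))
          (R.*-congˡ (R.+-cong (R.trans (δ-sym xᵥ 1ᴹ) δ-1-x) (R.*-congˡ (R.trans (δ-refl xᵥ) one)))))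
        (solve 0 (con (+ 1) :+ (:- con (+ 2)) :* con (+ 0)
                    :+ (:- con (+ 2)) :* (con (+ 0) :+ (:- con (+ 2)) :* con (+ 1)) := con (+ 5)) R.refl))
      p : Carrier
      p = moment xᵥ
      square : (pairing d (coeff f) λ u → pairing d (coeff f) λ w → moment (u ⊕ w)) ≈ 1#
      square = R.trans (pairing-f λ u → pairing d (coeff f) λ w → moment (u ⊕ w)) (R.trans
        (R.+-cong (pairing-f λ w → moment (1ᴹ ⊕ w)) (R.*-congˡ (pairing-f λ w → moment (xᵥ ⊕ w))))
        (R.trans
          (R.+-cong
            (R.+-cong (R.trans (moment-≡ (⊕-identityˡ 1ᴹ)) moment-1) (R.*-congˡ (moment-≡ (⊕-identityˡ xᵥ))))
            (R.*-congˡ (R.+-cong (moment-≡ (⊕-identityʳ xᵥ)) (R.*-congˡ xᵥ²))))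
          (solve 2 (λ p o → o :+ (:- con (+ 2)) :* p :+ (:- con (+ 2)) :* (p :+ (:- con (+ 2)) :* p) := o)
            R.refl p 1#)))
        where
        moment-≡ : ∀ {a b} → a ≡ b → moment a ≈ moment b
        moment-≡ a≡b = R.reflexive (≡.cong moment a≡b)
        xᵥ² : moment (xᵥ ⊕ xᵥ) ≈ p
        xᵥ² = R.trans (moment-≡ (≡.sym (⊕-identityˡ (xᵥ ⊕ xᵥ)))) (R.trans
          (moment-bool 1ᴹ v (ℕ.≤-trans (ℕ.≤-reflexive (≡.cong (ℕ._+ 2) (degree-1ᴹ n))) 2≤d))
          (moment-≡ (⊕-identityˡ xᵥ)))

  -- For n at least 2, λ ≤ 1 gives 2 λ ≤ 2 ≤ n ^ d. For n = 1 the right side is 1, so a sharper test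
  -- is used: a single vertex has no edges, and 2 ≤ n d forces d ≥ 2, which admits the linear test
  -- polynomial.
  2λ≤n^d : ∀ {n d} .{{_ : NonZero d}} {G : Graph n} → 2 ℕ.≤ n ℕ.* d →
           (Ẽ : IndependentSetPE G (toℚ d)) (lam : Carrier) → 0# < lam →
           (∀ (f : Poly≤ n (toℚ d /2)) → Multilinear f →
             ∀ (Πf : Poly≤ n (toℚ d)) → IsProjection {d = d} G (weaken (d/2≤d d) f) Πf →
             lam * ‖_‖² {d = d} Πf ≤ IndependentSetPE.𝔼 Ẽ (f ²)) →
           fromℕ 2 * lam ≤ fromℕ n ^ d
  2λ≤n^d {suc zero} {d} {G} 2≤d Ẽ lam 0<λ eigenvalue = ≤-trans
    (≤-trans (0≤-⇒≤ (≤-respʳ (solve 1 (λ l → con (+ 3) :* l := con (+ 5) :* l :- con (+ 2) :* l) R.refl lam)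
               (0≤* (0≤fromℕ 3) (<⇒≤ 0<λ))))
      (5λ≤1 Ẽ lam eigenvalue zero edgeless (ℕ.≤-trans 2≤d (ℕ.≤-reflexive (ℕ.+-identityʳ d)))))
    (≈⇒≤ (R.trans (R.sym (R.+-identityʳ 1#))
      (R.trans (R.reflexive (≡.cong fromℕ (≡.sym (ℕ.^-zeroˡ d)))) (fromℕ-^ 1 d))))
    where
    edgeless : ∀ {i j} → ¬ Graph.Adj G i j
    edgeless {zero} {zero} = Graph.loopless G ≡.refl
  2λ≤n^d {suc (suc n)} {d} _ Ẽ lam 0<λ eigenvalue = ≤-trans
    (0≤-⇒≤ (≤-respʳ (R.trans (R.distribˡ (fromℕ 2) 1# (- lam)) (R.+-cong (R.*-identityʳ (fromℕ 2))
        (solve 1 (λ l → con (+ 2) :* :- l := :- (con (+ 2) :* l)) R.refl lam)))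
      (0≤* (0≤fromℕ 2) (≤⇒0≤- (λ≤1 Ẽ lam eigenvalue)))))
    (≤-respʳ (fromℕ-^ (2 ℕ.+ n) d) (fromℕ-mono (ℕ.≤-trans (s≤s (s≤s z≤n))
      (ℕ.≤-trans (ℕ.≤-reflexive (≡.sym (ℕ.*-identityʳ (2 ℕ.+ n)))) (ℕ.^-monoʳ-≤ (2 ℕ.+ n) (ℕ.>-nonZero⁻¹ d))))))

theorem2 : ∀ {c ℓ₁ ℓ₂} (ℝ : RealField c ℓ₁ ℓ₂) →
    let open RealField ℝ
        open PseudoExpectations ℝ
        open IndependentSetPE using (𝔼)
    in
    ∃[ C ] 0# < C ×
      (∀ {n} (G : Graph n) (d : ℕ) .{{_ : NonZero d}} →
       -- Excludes n = 0, where log (n ^ d / λ) is undefined, and n = d = 1, where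
       -- λ = 1 is possible and the bound on k would read k ≤ 0.
       2 ℕ.≤ n ℕ.* d →
       (Ẽ : IndependentSetPE G (toℚ d)) →
       (k₀ : ℕ) .{{_ : NonZero k₀}} →
       (∀ i → 1/ᴿ k₀ ≤ 𝔼 Ẽ (weaken (1≤toℚ d) (x i))) →
       (lam : Carrier) (0<lam : 0# < lam) →
       (∀ (f : Poly≤ n (toℚ d /2)) → Multilinear f →
        ∀ (Πf : Poly≤ n (toℚ d)) → IsProjection {d = d} G (weaken (d/2≤d d) f) Πf →
        lam * ‖_‖² {d = d} Πf ≤ 𝔼 Ẽ (f ²)) →
       ∀ (L : Carrier) → IsLog (fromℕ n ^ d /ᴿ lam ⟨ 0<lam ⟩) L →
       ∃[ k ] 1 ℕ.≤ k ×
              fromℕ k ≤ C * fromℕ k₀ * fromℕ d * L ×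
              ColoringPE G k (1ℚᵘ ℚ.+ toℚ d /2))
-- 20 = 5 · 4, from k = 5 k₀ d and 1 ≤ 4 L.
theorem2 ℝ = fromℕ 20 , 0<fromℕ 20 , λ G d 2≤nd Ẽ k₀ mean lam 0<lam eigenvalue L isLog →
  5 ℕ.* k₀ ℕ.* d , ℕ.*-mono-≤ (ℕ.*-mono-≤ {1} {5} (s≤s z≤n) (ℕ.>-nonZero⁻¹ k₀)) (ℕ.>-nonZero⁻¹ d) ,
  colors≤ k₀ d L (1/4≤log (2≤n^d/λ 0<lam (2λ≤n^d {G = G} 2≤nd Ẽ lam 0<lam eigenvalue)) isLog) ,
  coloring G d Ẽ k₀ mean
  where
  open RealField ℝ hiding (zero)
  open OrderedField ℝ
  open PseudoExpectations ℝ
  open IndependentSetPE using (𝔼)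
  open PolynomialPairing ℝ
  open Coloring ℝ using (coloringPE)
  open Logarithm ℝ
  open Eigenvalue ℝ
  open Solver using (solve; _:=_; con; _:+_; _:*_; _:-_; :-_)

  2≤n^d/λ : ∀ {lam y} (0<lam : 0# < lam) → fromℕ 2 * lam ≤ y → fromℕ 2 ≤ y /ᴿ lam ⟨ 0<lam ⟩
  2≤n^d/λ {lam} {y} 0<lam 2λ≤y = 0≤-⇒≤ (≤-respʳ
    (R.trans (solve 4 (λ r y f l → r :* (y :- f :* l) := y :* r :- f :* (l :* r)) R.refl r y (fromℕ 2) lam)
      (R.+-congˡ (R.-‿cong (R.trans (R.*-congˡ (recip-inverseʳ lam _)) (R.*-identityʳ _)))))
    (0≤* (<⇒≤ (0<⇒0<recip 0<lam _)) (≤⇒0≤- 2λ≤y)))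
    where r = recip lam (#-sym (<⇒# 0<lam))

  colors≤ : ∀ k₀ d L → 1# ≤ fromℕ 4 * L → fromℕ (5 ℕ.* k₀ ℕ.* d) ≤ fromℕ 20 * fromℕ k₀ * fromℕ d * L
  colors≤ k₀ d L 1≤4L = 0≤-⇒≤ (≤-respʳ
    (R.trans (R.distribˡ _ _ _) (R.trans
      (R.+-cong
        (solve 3 (λ k d L → con (+ 5) :* k :* d :* (con (+ 4) :* L) := con (+ 20) :* k :* d :* L)
          R.refl (fromℕ k₀) (fromℕ d) L)
        (R.trans (solve 2 (λ x o → x :* :- o := :- (x :* o)) R.refl _ 1#) (R.-‿cong (R.*-identityʳ _))))
      (R.+-congˡ (R.-‿cong (R.sym (R.trans (fromℕ-* (5 ℕ.* k₀) d) (R.*-congʳ (fromℕ-* 5 k₀))))))))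
    (0≤* (0≤* (0≤* (0≤fromℕ 5) (0≤fromℕ k₀)) (0≤fromℕ d)) (≤⇒0≤- 1≤4L)))

  1≤k₀*mean : ∀ k₀ .{{_ : NonZero k₀}} {p} → 1/ᴿ k₀ ≤ p → 1# ≤ fromℕ k₀ * p
  1≤k₀*mean k₀ {p} 1/k₀≤p = 0≤-⇒≤ (≤-respʳ
    (R.trans (solve 3 (λ k p r → k :* (p :- r) := k :* p :- k :* r) R.refl (fromℕ k₀) p (1/ᴿ k₀))
      (R.+-congˡ (R.-‿cong (1/ᴿ-inverse k₀))))
    (0≤* (0≤fromℕ k₀) (≤⇒0≤- 1/k₀≤p)))

  coloring : ∀ {n} (G : Graph n) d .{{_ : NonZero d}} (Ẽ : IndependentSetPE G (toℚ d))
             k₀ .{{_ : NonZero k₀}} →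
             (∀ i → 1/ᴿ k₀ ≤ 𝔼 Ẽ (weaken (1≤toℚ d) (x i))) →
             ColoringPE G (5 ℕ.* k₀ ℕ.* d) (1ℚᵘ ℚ.+ toℚ d /2)
  -- Even with t = 0 the covering argument squares y and so uses degree 2, hence e = 2 here. Every
  -- vertex has mean 1 under the substitute moments, and 1 ≤ k₀.
  coloring G (suc zero) Ẽ k₀ mean = coloringPE (s≤s (s≤s z≤n)) (s≤s z≤n) (trivial-moments G) k₀
    λ _ → ≤-respˡ (R.+-identityʳ 1#)
      (≤-respʳ (R.sym (R.*-identityʳ (fromℕ k₀))) (fromℕ-mono {1} (ℕ.>-nonZero⁻¹ k₀)))
  coloring G d@(suc (suc _)) Ẽ k₀ mean = coloringPE (s≤s (s≤s z≤n)) ℕ.≤-refl moments k₀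
    λ v → 1≤k₀*mean k₀ (≤-respʳ (moment-x v) (mean v))
    where open FromIndependentSetPE {G = G} {d = d} Ẽ
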